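{- (1) Every language in NP has a census function computable in FP if and only if $\mathrm{spanP}_1\subseteq\mathrm{FP}$. (2) Every language in PH has a census function computable in FP if and only if $\#_1\cdot\mathrm{PH}\subseteq\mathrm{FP}$.
   Context: Strings are over $\Sigma=\{0,1\}$; $\mathrm{census}_L(1^n)=|\{x\in L:|x|=n\}|$. FP is the class of polynomial-time computable functions; PH is the polynomial hierarchy. A tally spanP machine is a nondeterministic polynomial-time machine with unary input alphabet having an output device on which some output is printed on each accepting path; $\mathrm{span}_M(x)$ is the number of distinct outputs on accepting paths of $M(x)$ (0 if there is no accepting path). $\mathrm{spanP}_1$ is the class of functions $\mathrm{span}_M$ for tally spanP machines $M$. For a language class $\mathcal C$, $\#_1\cdot\mathcal C$ is the class of functions $f$ for which there exist $A\in\mathcal C$ and a polynomial $p$ with $f(1^n)=|\{y: |y|=p(n),\ \langle 1^n,y\rangle\in A\}|$ for all $n$, where $\langle\cdot,\cdot\rangle$ is a fixed polynomial-time computable and invertible bijective pairing function. -}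

module Defs where

open import Data.Nat using (ℕ; zero; suc; _+_; _*_; _^_; _≤_; _%_; _/_; _≡ᵇ_)
open import Data.Fin using (Fin)
open import Data.Bool using (Bool; true; false; not; if_then_else_)
open import Data.List using (List; []; _∷_; _++_; map; concatMap; length; replicate)
open import Data.Nat.ListAction using (sum)
open import Data.List.Membership.Propositional using (_∈_)
open import Data.List.Relation.Unary.Unique.Propositional using (Unique)
open import Data.Product using (Σ; Σ-syntax; _×_; _,_; proj₁; proj₂)
open import Function.Bundles using (_⇔_)
open import Relation.Binary.PropositionalEquality using (_≡_)

Str : Set
Str = List Bool          -- false = 0, true = 1

ones : ℕ → Str
ones n = replicate n true

-- polynomials with natural coefficients, c₀ + c₁ n + c₂ n² + …
Poly : Set
Poly = List ℕ

eval : Poly → ℕ → ℕ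
eval []       n = 0
eval (c ∷ cs) n = c + n * eval cs n

strings : ℕ → List Str
strings zero    = [] ∷ []
strings (suc n) = concatMap (λ x → (false ∷ x) ∷ (true ∷ x) ∷ []) (strings n)

countLen : (Str → Bool) → ℕ → ℕ
countLen P n = sum (map (λ y → if P y then 1 else 0) (strings n))

-- fixed polynomial-time computable, invertible pairing function
-- ⟨x,y⟩ = x with every bit doubled, then 01, then y
pair : Str → Str → Str
pair x y = concatMap (λ b → b ∷ b ∷ []) x ++ (false ∷ true ∷ []) ++ y

-- binary representation of a natural number (least significant bit first,
-- no leading zeros, 0 ↦ empty string)
bitsF : ℕ → ℕ → Str
bitsF zero    _ = []
bitsF (suc f) zero = []
bitsF (suc f) (suc m) = ((suc m % 2) ≡ᵇ 1) ∷ bitsF f (suc m / 2)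

toBin : ℕ → Str
toBin n = bitsF n n

-- Turing machines (single two-way infinite tape, alphabet {0,1,blank})

data Sym : Set where
  b0 b1 blank : Sym

data Move : Set where
  mvL mvR mvS : Move

record Tape : Set where
  constructor tape
  field
    left  : List Sym     -- cells left of the head, nearest first
    head  : Sym
    right : List Sym     -- cells right of the head, nearest first

moveL : Tape → Tape
moveL (tape []       h r) = tape [] blank (h ∷ r)
moveL (tape (l ∷ ls) h r) = tape ls l (h ∷ r)

moveR : Tape → Tape
moveR (tape l h [])       = tape (h ∷ l) blank []
moveR (tape l h (r ∷ rs)) = tape (h ∷ l) r rs

move : Move → Tape → Tape
move mvL = moveL
move mvR = moveR
move mvS t = t

write : Sym → Tape → Tape
write s (tape l _ r) = tape l s r

bit : Bool → Sym
bit false = b0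
bit true  = b1

initTape : Str → Tape
initTape x with map bit x
... | []     = tape [] blank []
... | s ∷ ss = tape [] s ss

readSyms : List Sym → Str
readSyms []          = []
readSyms (b0 ∷ r)    = false ∷ readSyms r
readSyms (b1 ∷ r)    = true ∷ readSyms r
readSyms (blank ∷ r) = []

readOut : Tape → Str
readOut (tape _ h r) = readSyms (h ∷ r)

record DTM : Set where
  field
    Q       : ℕ
    start   : Fin Q
    halting : Fin Q → Bool
    δ       : Fin Q → Sym → Fin Q × Sym × Move

DConfig : DTM → Set
DConfig M = Fin (DTM.Q M) × Tape

dstep : (M : DTM) → DConfig M → DConfig M
dstep M (q , t) with DTM.halting M q
... | true  = (q , t)
... | false with DTM.δ M q (Tape.head t)
...   | (q' , s , m) = (q' , move m (write s t))

drun : (M : DTM) → ℕ → DConfig M → DConfig M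
drun M zero    c = c
drun M (suc k) c = drun M k (dstep M c)

Computes : DTM → (Str → Str) → Poly → Set
Computes M f p = ∀ x → Σ[ t ∈ ℕ ]
  ( t ≤ eval p (length x)
  × DTM.halting M (proj₁ (drun M t (DTM.start M , initTape x))) ≡ true
  × readOut (proj₂ (drun M t (DTM.start M , initTape x))) ≡ f x )

InFP : (Str → Str) → Set
InFP f = Σ[ M ∈ DTM ] Σ[ p ∈ Poly ] Computes M f p

InFP₁ : (ℕ → ℕ) → Set
InFP₁ g = Σ[ h ∈ (Str → Str) ] (InFP h × (∀ n → h (ones n) ≡ toBin (g n)))

Language : Set
Language = Str → Bool

InP : Language → Set
InP L = InFP (λ x → if L x then true ∷ [] else false ∷ [])

ΣP : ℕ → Language → Set
ΣP zero    L = InP L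
ΣP (suc k) L = Σ[ A ∈ Language ] Σ[ p ∈ Poly ]
  ( ΣP k (λ z → not (A z))          -- A ∈ Π^p_k
  × (∀ x → (L x ≡ true) ⇔ (Σ[ y ∈ Str ] (length y ≡ eval p (length x) × A (pair x y) ≡ true))) )

InNP : Language → Set
InNP = ΣP 1

InPH : Language → Set
InPH L = Σ[ k ∈ ℕ ] ΣP k L

census : Language → ℕ → ℕ
census L n = countLen L n

HasFPCensus : Language → Set
HasFPCensus L = InFP₁ (census L)

Sharp₁PH : (ℕ → ℕ) → Set
Sharp₁PH f = Σ[ A ∈ Language ] Σ[ p ∈ Poly ]
  (InPH A × (∀ n → f n ≡ countLen (λ y → A (pair (ones n) y)) (eval p n)))

record NTM : Set where
  field
    Q       : ℕ
    start   : Fin Q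
    halting : Fin Q → Bool
    accept  : Fin Q → Bool          -- meaningful on halting states
    δ       : Fin Q → Sym → List (Fin Q × Sym × Move)

NConfig : NTM → Set
NConfig M = Fin (NTM.Q M) × Tape

data NStep (M : NTM) : NConfig M → NConfig M → Set where
  nstep : ∀ {q t q' s m} → NTM.halting M q ≡ false →
          (q' , s , m) ∈ NTM.δ M q (Tape.head t) →
          NStep M (q , t) (q' , move m (write s t))

data NSteps (M : NTM) : ℕ → NConfig M → NConfig M → Set where
  done : ∀ {c} → NSteps M zero c c
  more : ∀ {k c c' c''} → NStep M c c' → NSteps M k c' c'' → NSteps M (suc k) c c''

nInit : (M : NTM) → Str → NConfig M
nInit M x = (NTM.start M , initTape x)

TallyPolyTime : NTM → Poly → Set
TallyPolyTime M p = ∀ n k c → NSteps M k (nInit M (ones n)) c → k ≤ eval p n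

AccOut : (M : NTM) → Str → Str → Set
AccOut M x z = Σ[ k ∈ ℕ ] Σ[ c ∈ NConfig M ]
  ( NSteps M k (nInit M x) c
  × NTM.halting M (proj₁ c) ≡ true
  × NTM.accept M (proj₁ c) ≡ true
  × readOut (proj₂ c) ≡ z )

IsSpan : NTM → (ℕ → ℕ) → Set
IsSpan M f = ∀ n → Σ[ zs ∈ List Str ]
  (Unique zs × (∀ z → (z ∈ zs) ⇔ AccOut M (ones n) z) × f n ≡ length zs)

SpanP₁ : (ℕ → ℕ) → Set
SpanP₁ f = Σ[ M ∈ NTM ] Σ[ p ∈ Poly ] (TallyPolyTime M p × IsSpan M f)

{-# OPTIONS --safe #-}

-- The string ⟨1ⁿ, y⟩ with |y| = p(n) has length q(n) = 2n + 2 + p(n), which is strictly increasing in n, so the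
-- strings of this shape and of length q(n) all belong to the same n.  Hence |{y : |y| = p(n), ⟨1ⁿ, y⟩ ∈ A}| is the
-- census at q(n) of a language in PH, and |span| is the census at q(n) of the NP language of all ⟨1ⁿ, padded output⟩,
-- whose certificates are sequences of nondeterministic choices; the census is then evaluated at 1^{q(n)}.
-- Conversely, the census of L is counted by ⟨1ⁿ, y⟩ ↦ (y ∈ L), and, for L in NP, by the machine that guesses a string
-- of length q(n), checks that it is ⟨x, certificate for x⟩ and outputs x; the length forces |x| = n.
--
-- For polynomial time, stack programs whose only loops repeat a body |input| times (nested loops give all polynomial
-- clocks, so they run in polynomial time by construction) are compiled to one-tape machines: one stack lies to the
-- right of the origin, the others are interleaved on its left.  Machines given by hypothesis are simulated by such
-- programs, which makes FP closed under composition and pairing.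

module Submission where

open import Defs
open import Data.Nat using (ℕ; zero; suc; _+_; _*_; _∸_; _≤_; _<_; z≤n; s≤s; NonZero; _/_; _%_; _⊔_; _<?_; _⊓_)
open import Data.Nat.Properties as ℕₚ using (≤-refl; ≤-trans; ≤-reflexive; +-mono-≤; *-mono-≤; +-monoʳ-≤; m≤m+n; m≤n+m)
open import Data.Nat.Tactic.RingSolver using (solve-∀)
open import Data.Integer using (ℤ; +_; -[1+_])
open import Data.Fin using (Fin; zero; suc; splitAt; join; toℕ; fromℕ<; combine; remQuot)
open import Data.Fin.Properties using (splitAt-join; toℕ<n; toℕ-injective; toℕ-fromℕ<; join-splitAt; remQuot-combine)
open import Data.Bool using (Bool; true; false; not; if_then_else_; _∧_)
open import Data.List using (List; []; _∷_; _++_; map; length; replicate; reverse; _ʳ++_; allFin; foldl; concatMap; take; filter; _∷ʳ_)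
open import Data.Maybe using (Maybe; just; nothing; maybe)
open import Data.Product using (Σ-syntax; _×_; _,_; proj₁; proj₂)
open import Data.Sum using (_⊎_; inj₁; inj₂; map₂; [_,_])
open import Data.Unit using (⊤; tt)
open import Relation.Nullary using (¬_; yes; no; does; contradiction; Dec)
open import Relation.Binary.PropositionalEquality using (_≡_; _≢_; refl; sym; trans; cong; cong₂; subst; module ≡-Reasoning)
open import Data.Nat.DivMod using (m≡m%n+[m/n]*n; [m+kn]%n≡m%n; m<n⇒m%n≡m; m%n<n)
open import Relation.Nullary.Decidable using (map′; dec-true; dec-false)
open import Data.List.Properties using (length-replicate; length-reverse; reverse-involutive; length-ʳ++; length-map; length-tabulate; unfold-reverse; concatMap-++; ++-assoc; ++-identityʳ; ≡-dec; ʳ++-ʳ++; length-++; length-take)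
open import Data.List.Membership.Propositional using (_∈_; find; lose)
open import Data.List.Membership.Propositional.Properties using (∈-map⁺; ∈-allFin; ∈-map⁻; ∈-filter⁺; ∈-filter⁻)
open import Data.List.Relation.Unary.Any using (here; there; any?)
open import Data.Vec using (Vec; []; _∷_; lookup; updateAt; _[_]≔_)
open import Data.Vec.Properties using (lookup∘updateAt; lookup∘updateAt′; lookup∘update; lookup∘update′; lookup-replicate)
open import Function using (_∘_)
open import Data.Nat.ListAction using (sum)
open import Data.List.Membership.Propositional.Properties.WithK using (unique∧set⇒bag)
open import Data.List.Relation.Binary.BagAndSetEquality using (∼bag⇒↭)
open import Data.List.Relation.Binary.Permutation.Propositional.Properties using (↭-length)
open import Data.List.Relation.Unary.All using (All; []; _∷_)
open import Data.List.Relation.Unary.AllPairs using ([]; _∷_)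
open import Data.List.Relation.Unary.Unique.Propositional using (Unique)
open import Function.Bundles using (_⇔_; mk⇔; Equivalence)
import Data.Integer as ℤ
import Data.Integer.Properties as ℤₚ
import Data.Nat as ℕ
import Data.Fin as Fin
import Data.Maybe.Properties as Maybeₚ
import Data.Vec as Vec
import Data.Bool as Bool
import Data.List.Relation.Unary.Unique.Propositional.Properties as Uniqueₚ

-- Polynomials

-- Several mismatches shape the proof. A machine may leave anything on its tape besides its output,
-- so two machines cannot simply be run one after the other; `SFP` asks for a clean tape, and a
-- given machine enters it only by being simulated for a full polynomial clock and having its output
-- extracted. Certificates in `ΣP` have exactly one length while a reduction changes lengths, so
-- certificates are padded and the reduced matrix cuts them back. A reduction must also be able to
-- refuse malformed strings at every level of alternation, where complementation reverses the
-- refusal; hence reductions that may answer directly, with a default value. A span counts outputs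
-- of many lengths, a census sees only one; an output is therefore put into a self-delimiting pair
-- whose filler is cut at a common length, which keeps distinct outputs distinct. Finally, a
-- `Language` is Boolean, so the language built from a span machine has to be decided and not merely
-- described by certificates; the finite list of outputs in `IsSpan` decides it.

padd : Poly → Poly → Poly
padd []       q        = q
padd (a ∷ p)  []       = a ∷ p
padd (a ∷ p)  (b ∷ q)  = (a + b) ∷ padd p q

pscale : ℕ → Poly → Poly
pscale c = map (c *_)

pmul : Poly → Poly → Poly
pmul []      q = []
pmul (a ∷ p) q = padd (pscale a q) (0 ∷ pmul p q)

pcomp : Poly → Poly → Poly
pcomp []      q = []
pcomp (a ∷ p) q = padd (a ∷ []) (pmul q (pcomp p q))

pconst : ℕ → Poly
pconst c = c ∷ []

pid : Poly
pid = 0 ∷ 1 ∷ []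

eval-const : ∀ c n → eval (pconst c) n ≡ c
eval-const = lem where
  lem : ∀ c n → c + n * 0 ≡ c
  lem = solve-∀

eval-id : ∀ n → eval pid n ≡ n
eval-id = lem where
  lem : ∀ n → 0 + n * (1 + n * 0) ≡ n
  lem = solve-∀

eval-add : ∀ p q n → eval (padd p q) n ≡ eval p n + eval q n
eval-add []      q       n = refl
eval-add (a ∷ p) []      n = sym (ℕₚ.+-identityʳ _)
eval-add (a ∷ p) (b ∷ q) n rewrite eval-add p q n = lem a b n (eval p n) (eval q n)
  where
  lem : ∀ a b n x y → a + b + n * (x + y) ≡ a + n * x + (b + n * y)
  lem = solve-∀

eval-scale : ∀ c p n → eval (pscale c p) n ≡ c * eval p n
eval-scale c []      n = sym (ℕₚ.*-zeroʳ c)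
eval-scale c (a ∷ p) n rewrite eval-scale c p n = lem c a n (eval p n)
  where
  lem : ∀ c a n x → c * a + n * (c * x) ≡ c * (a + n * x)
  lem = solve-∀

eval-mul : ∀ p q n → eval (pmul p q) n ≡ eval p n * eval q n
eval-mul []      q n = refl
eval-mul (a ∷ p) q n
  rewrite eval-add (pscale a q) (0 ∷ pmul p q) n | eval-scale a q n | eval-mul p q n
  = lem a n (eval p n) (eval q n)
  where
  lem : ∀ a n x y → a * y + (0 + n * (x * y)) ≡ (a + n * x) * y
  lem = solve-∀

eval-comp : ∀ p q n → eval (pcomp p q) n ≡ eval p (eval q n)
eval-comp []      q n = refl
eval-comp (a ∷ p) q n
  rewrite eval-add (a ∷ []) (pmul q (pcomp p q)) n | eval-mul q (pcomp p q) n | eval-comp p q n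
  = cong (_+ eval q n * eval p (eval q n)) (eval-const a n)

eval-mono : ∀ p {m n} → m ≤ n → eval p m ≤ eval p n
eval-mono []      le = z≤n
eval-mono (a ∷ p) le = +-monoʳ-≤ a (*-mono-≤ le (eval-mono p le))

-- Structured programs for one-tape machines

data Code : Set where
  wr  : Sym → Code
  mv  : Move → Code
  _▸_ : Code → Code → Code
  br  : Code → Code → Code → Code
  wh  : Code → Code

infixr 5 _▸_

goL goR : ℤ → ℤ
goL (+ zero)     = -[1+ 0 ]
goL (+ suc n)    = + n
goL -[1+ n ]     = -[1+ suc n ]
goR (+ n)        = + suc n
goR -[1+ zero ]  = + 0
goR -[1+ suc n ] = -[1+ n ]

shift : Move → ℤ → ℤ
shift mvL = goL
shift mvR = goR
shift mvS i = i

Content : Set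
Content = ℤ → Sym

upd : ℤ → Sym → Content → Content
upd i s g j = if does (j ℤ.≟ i) then s else g j

Cfg : Set
Cfg = Content × ℤ

-- A relation, because `wh` may diverge. The number is the exact count of machine steps, which `sim`
-- transfers unchanged to a machine.
data Run : Code → Cfg → ℕ → Cfg → Set where
  r-wr   : ∀ {s g i} → Run (wr s) (g , i) 1 (upd i s g , i)
  r-mv   : ∀ {m g i} → Run (mv m) (g , i) 1 (g , shift m i)
  r-seq  : ∀ {P Q c m d n e} → Run P c m d → Run Q d n e → Run (P ▸ Q) c (m + n) e
  r-br0  : ∀ {P Q R g i n d} → g i ≡ b0 → Run P (g , i) n d → Run (br P Q R) (g , i) (suc n) d
  r-br1  : ∀ {P Q R g i n d} → g i ≡ b1 → Run Q (g , i) n d → Run (br P Q R) (g , i) (suc n) d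
  r-br-  : ∀ {P Q R g i n d} → g i ≡ blank → Run R (g , i) n d → Run (br P Q R) (g , i) (suc n) d
  r-stop : ∀ {P g i} → g i ≡ blank → Run (wh P) (g , i) 1 (g , i)
  r-go   : ∀ {P g i m d n e} → g i ≢ blank → Run P (g , i) m d → Run (wh P) d n e →
           Run (wh P) (g , i) (suc (m + n)) e

-- States have the shape of the code and are not yet numbered, so that the states of a part are
-- included in those of the whole by plain injections; `toF` numbers them at the end.
St : Code → Set
St (wr _)     = ⊤
St (mv _)     = ⊤
St (P ▸ Q)    = St P ⊎ St Q
St (br P Q R) = ⊤ ⊎ (St P ⊎ (St Q ⊎ St R))
St (wh P)     = ⊤ ⊎ St P

ent : ∀ P → St P
ent (wr _)     = tt
ent (mv _)     = tt
ent (P ▸ Q)    = inj₁ (ent P)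
ent (br P Q R) = inj₁ tt
ent (wh P)     = inj₁ tt

-- In a transition, `nothing` as next state means leaving the code.
Trans : Set → Set
Trans S = Maybe S × Sym × Move

retarget : ∀ {S S' : Set} → (S → S') → Maybe S' → Trans S → Trans S'
retarget e x (n , s , m) = maybe (λ a → just (e a)) x n , s , m

branch : ∀ P Q R → Sym → St (br P Q R)
branch P Q R b0    = inj₂ (inj₁ (ent P))
branch P Q R b1    = inj₂ (inj₂ (inj₁ (ent Q)))
branch P Q R blank = inj₂ (inj₂ (inj₂ (ent R)))

again : ∀ P → Sym → Maybe (St (wh P))
again P b0    = just (inj₂ (ent P))
again P b1    = just (inj₂ (ent P))
again P blank = nothing

tr : ∀ P → St P → Sym → Trans (St P)
tr (wr s)     tt                      h = nothing , s , mvS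
tr (mv m)     tt                      h = nothing , h , m
tr (P ▸ Q)    (inj₁ a)                h = retarget inj₁ (just (inj₂ (ent Q))) (tr P a h)
tr (P ▸ Q)    (inj₂ a)                h = retarget inj₂ nothing (tr Q a h)
tr (br P Q R) (inj₁ tt)               h = just (branch P Q R h) , h , mvS
tr (br P Q R) (inj₂ (inj₁ a))         h = retarget (λ s → inj₂ (inj₁ s)) nothing (tr P a h)
tr (br P Q R) (inj₂ (inj₂ (inj₁ a)))  h = retarget (λ s → inj₂ (inj₂ (inj₁ s))) nothing (tr Q a h)
tr (br P Q R) (inj₂ (inj₂ (inj₂ a)))  h = retarget (λ s → inj₂ (inj₂ (inj₂ s))) nothing (tr R a h)
tr (wh P)     (inj₁ tt)               h = again P h , h , mvS
tr (wh P)     (inj₂ a)                h = retarget inj₂ (just (inj₁ tt)) (tr P a h)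

size : Code → ℕ
size (wr _)     = 1
size (mv _)     = 1
size (P ▸ Q)    = size P + size Q
size (br P Q R) = 1 + (size P + (size Q + size R))
size (wh P)     = 1 + size P

toF : ∀ P → St P → Fin (size P)
toF (wr _)     tt                     = zero
toF (mv _)     tt                     = zero
toF (P ▸ Q)    (inj₁ a)               = join (size P) (size Q) (inj₁ (toF P a))
toF (P ▸ Q)    (inj₂ a)               = join (size P) (size Q) (inj₂ (toF Q a))
toF (br P Q R) (inj₁ tt)              = zero
toF (br P Q R) (inj₂ (inj₁ a))        = suc (join (size P) _ (inj₁ (toF P a)))
toF (br P Q R) (inj₂ (inj₂ (inj₁ a))) = suc (join (size P) _ (inj₂ (join (size Q) _ (inj₁ (toF Q a)))))
toF (br P Q R) (inj₂ (inj₂ (inj₂ a))) = suc (join (size P) _ (inj₂ (join (size Q) _ (inj₂ (toF R a)))))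
toF (wh P)     (inj₁ tt)              = zero
toF (wh P)     (inj₂ a)               = suc (toF P a)

fromF : ∀ P → Fin (size P) → St P
fromF (wr _)     _ = tt
fromF (mv _)     _ = tt
fromF (P ▸ Q)    i with splitAt (size P) i
... | inj₁ a = inj₁ (fromF P a)
... | inj₂ a = inj₂ (fromF Q a)
fromF (br P Q R) zero = inj₁ tt
fromF (br P Q R) (suc i) with splitAt (size P) i
... | inj₁ a = inj₂ (inj₁ (fromF P a))
... | inj₂ j with splitAt (size Q) j
...   | inj₁ a = inj₂ (inj₂ (inj₁ (fromF Q a)))
...   | inj₂ a = inj₂ (inj₂ (inj₂ (fromF R a)))
fromF (wh P)     zero    = inj₁ tt
fromF (wh P)     (suc i) = inj₂ (fromF P i)

fromF-toF : ∀ P s → fromF P (toF P s) ≡ s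
fromF-toF (wr _)     tt = refl
fromF-toF (mv _)     tt = refl
fromF-toF (P ▸ Q)    (inj₁ a)
  rewrite splitAt-join (size P) (size Q) (inj₁ (toF P a)) = cong inj₁ (fromF-toF P a)
fromF-toF (P ▸ Q)    (inj₂ a)
  rewrite splitAt-join (size P) (size Q) (inj₂ (toF Q a)) = cong inj₂ (fromF-toF Q a)
fromF-toF (br P Q R) (inj₁ tt) = refl
fromF-toF (br P Q R) (inj₂ (inj₁ a))
  rewrite splitAt-join (size P) (size Q + size R) (inj₁ (toF P a))
  = cong (λ s → inj₂ (inj₁ s)) (fromF-toF P a)
fromF-toF (br P Q R) (inj₂ (inj₂ (inj₁ a)))
  rewrite splitAt-join (size P) (size Q + size R) (inj₂ (join (size Q) (size R) (inj₁ (toF Q a))))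
        | splitAt-join (size Q) (size R) (inj₁ (toF Q a))
  = cong (λ s → inj₂ (inj₂ (inj₁ s))) (fromF-toF Q a)
fromF-toF (br P Q R) (inj₂ (inj₂ (inj₂ a)))
  rewrite splitAt-join (size P) (size Q + size R) (inj₂ (join (size Q) (size R) (inj₂ (toF R a))))
        | splitAt-join (size Q) (size R) (inj₂ (toF R a))
  = cong (λ s → inj₂ (inj₂ (inj₂ s))) (fromF-toF R a)
fromF-toF (wh P)     (inj₁ tt) = refl
fromF-toF (wh P)     (inj₂ a)  = cong inj₂ (fromF-toF P a)

-- Tapes as two-way infinite sequences of cells

nth : List Sym → ℕ → Sym
nth []       _       = blank
nth (s ∷ ss) zero    = s
nth (s ∷ ss) (suc j) = nth ss j

itL itR : ℕ → ℤ → ℤ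
itL zero    i = i
itL (suc j) i = itL j (goL i)
itR zero    i = i
itR (suc j) i = itR j (goR i)

goR-goL : ∀ i → goR (goL i) ≡ i
goR-goL (+ zero)  = refl
goR-goL (+ suc n) = refl
goR-goL -[1+ n ]  = refl

goL-goR : ∀ i → goL (goR i) ≡ i
goL-goR (+ n)        = refl
goL-goR -[1+ zero ]  = refl
goL-goR -[1+ suc n ] = refl

goL-< : ∀ i → goL i ℤ.< i
goL-< (+ zero)  = ℤ.-<+
goL-< (+ suc n) = ℤ.+<+ ≤-refl
goL-< -[1+ n ]  = ℤ.-<- ≤-refl

goR-> : ∀ i → i ℤ.< goR i
goR-> i = subst (ℤ._< goR i) (goL-goR i) (goL-< (goR i))

itL-≤ : ∀ j i → itL j i ℤ.≤ i
itL-≤ zero    i = ℤₚ.≤-refl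
itL-≤ (suc j) i = ℤₚ.≤-trans (itL-≤ j (goL i)) (ℤₚ.<⇒≤ (goL-< i))

itR-≥ : ∀ j i → i ℤ.≤ itR j i
itR-≥ zero    i = ℤₚ.≤-refl
itR-≥ (suc j) i = ℤₚ.≤-trans (ℤₚ.<⇒≤ (goR-> i)) (itR-≥ j (goR i))

itL-≢ : ∀ j i → itL j (goL i) ≢ i
itL-≢ j i eq = ℤₚ.<⇒≢ (ℤₚ.≤-<-trans (itL-≤ j (goL i)) (goL-< i)) eq

itR-≢ : ∀ j i → itR j (goR i) ≢ i
itR-≢ j i eq = ℤₚ.<⇒≢ (ℤₚ.<-≤-trans (goR-> i) (itR-≥ j (goR i))) (sym eq)

upd-≡ : ∀ i s g → upd i s g i ≡ s
upd-≡ i s g with i ℤ.≟ i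
... | yes _  = refl
... | no i≢i = contradiction refl i≢i

upd-≢ : ∀ {i j} s g → j ≢ i → upd i s g j ≡ g j
upd-≢ {i} {j} s g j≢i with j ℤ.≟ i
... | yes j≡i = contradiction j≡i j≢i
... | no _    = refl

-- The comparison is cell by cell because the lists of a `Tape` may carry explicit blanks at their
-- far ends: equal contents do not make equal tapes.
record At (t : Tape) (g : Content) (i : ℤ) : Set where
  constructor at
  field
    hd : Tape.head t ≡ g i
    lf : ∀ j → nth (Tape.left t) j ≡ g (itL j (goL i))
    rt : ∀ j → nth (Tape.right t) j ≡ g (itR j (goR i))
open At

At-move : ∀ m {t g i} → At t g i → At (move m t) g (shift m i)
At-move mvS a = a
At-move mvL {tape [] h r} {g} {i} (at e l rr) = at (l 0) (λ j → l (suc j)) right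
  where
  right : ∀ j → nth (h ∷ r) j ≡ g (itR j (goR (goL i)))
  right zero    rewrite goR-goL i = e
  right (suc j) rewrite goR-goL i = rr j
At-move mvL {tape (x ∷ ls) h r} {g} {i} (at e l rr) = at (l 0) (λ j → l (suc j)) right
  where
  right : ∀ j → nth (h ∷ r) j ≡ g (itR j (goR (goL i)))
  right zero    rewrite goR-goL i = e
  right (suc j) rewrite goR-goL i = rr j
At-move mvR {tape l h []} {g} {i} (at e ll r) = at (r 0) left (λ j → r (suc j))
  where
  left : ∀ j → nth (h ∷ l) j ≡ g (itL j (goL (goR i)))
  left zero    rewrite goL-goR i = e
  left (suc j) rewrite goL-goR i = ll j
At-move mvR {tape l h (x ∷ rs)} {g} {i} (at e ll r) = at (r 0) left (λ j → r (suc j))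
  where
  left : ∀ j → nth (h ∷ l) j ≡ g (itL j (goL (goR i)))
  left zero    rewrite goL-goR i = e
  left (suc j) rewrite goL-goR i = ll j

At-write : ∀ s {t g i} → At t g i → At (write s t) (upd i s g) i
At-write s {g = g} {i} (at e l r) = at
  (sym (upd-≡ i s g))
  (λ j → trans (l j) (sym (upd-≢ s g (itL-≢ j i))))
  (λ j → trans (r j) (sym (upd-≢ s g (itR-≢ j i))))

-- Running code inside a host machine

-- The step relation is a parameter because code runs in two kinds of host: a deterministic machine,
-- and a nondeterministic one where each of its steps has to be the only one possible (`Forced`).
module Host {S : Set} (_↦_ : S × Tape → S × Tape → Set) where

  data Star : ℕ → S × Tape → S × Tape → Set where
    stop : ∀ {c} → Star zero c c
    step : ∀ {n c d e} → c ↦ d → Star n d e → Star (suc n) c e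

  _⊕_ : ∀ {m n c d e} → Star m c d → Star n d e → Star (m + n) c e
  stop     ⊕ r = r
  step p q ⊕ r = step p (q ⊕ r)

  target : ∀ {A : Set} → (A → S) → S → Tape → Trans A → S × Tape
  target e x t (n , s , m) = maybe e x n , move m (write s t)

  Hosts : ∀ P → (St P → S) → S → Set
  Hosts P e x = ∀ s t → (e s , t) ↦ target e x t (tr P s (Tape.head t))

  private
    embed : ∀ {A B : Set} {e : B → S} {x} {f : A → B} {y : Maybe B} t r →
            target e x t (retarget f y r) ≡ target (λ a → e (f a)) (maybe e x y) t r
    embed t (just _  , _) = refl
    embed t (nothing , _) = refl

  -- A host of a compound code also hosts its parts: the embedding is composed with an injection,
  -- and the exit becomes the state to which `retarget` sends it. `embed` is exactly this
  -- compatibility, and induction on the run does the rest.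
  sim : ∀ {P e x g i n g' i' t} → Run P (g , i) n (g' , i') → Hosts P e x → At t g i →
        Σ[ t' ∈ Tape ] (Star n (e (ent P) , t) (x , t') × At t' g' i')
  sim {wr s} {t = t} r-wr H a = _ , step (H tt t) stop , At-write s a
  sim {mv m} {t = t} r-mv H a = _ , step (H tt t) stop , At-move m a
  sim {P ▸ Q} {e} {x} (r-seq r₁ r₂) H a
    with t₁ , s₁ , a₁ ← sim {P} {λ s → e (inj₁ s)} {e (inj₂ (ent Q))} r₁
           (λ s t → subst ((e (inj₁ s) , t) ↦_) (embed t (tr P s (Tape.head t))) (H (inj₁ s) t)) a
    with t₂ , s₂ , a₂ ← sim {Q} {λ s → e (inj₂ s)} {x} r₂
           (λ s t → subst ((e (inj₂ s) , t) ↦_) (embed t (tr Q s (Tape.head t))) (H (inj₂ s) t)) a₁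
    = t₂ , s₁ ⊕ s₂ , a₂
  sim {br P Q R} {e} {x} {t = t} (r-br0 eq r) H a
    with t₁ , s₁ , a₁ ← sim {P} {λ s → e (inj₂ (inj₁ s))} {x} r
           (λ s t → subst ((e (inj₂ (inj₁ s)) , t) ↦_) (embed t (tr P s (Tape.head t))) (H (inj₂ (inj₁ s)) t)) a
    = t₁ , step (subst (λ h → (e (inj₁ tt) , t) ↦ (e (branch P Q R h) , t)) (trans (hd a) eq) (H (inj₁ tt) t)) s₁ , a₁
  sim {br P Q R} {e} {x} {t = t} (r-br1 eq r) H a
    with t₁ , s₁ , a₁ ← sim {Q} {λ s → e (inj₂ (inj₂ (inj₁ s)))} {x} r
           (λ s t → subst ((e (inj₂ (inj₂ (inj₁ s))) , t) ↦_) (embed t (tr Q s (Tape.head t)))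
               (H (inj₂ (inj₂ (inj₁ s))) t)) a
    = t₁ , step (subst (λ h → (e (inj₁ tt) , t) ↦ (e (branch P Q R h) , t)) (trans (hd a) eq) (H (inj₁ tt) t)) s₁ , a₁
  sim {br P Q R} {e} {x} {t = t} (r-br- eq r) H a
    with t₁ , s₁ , a₁ ← sim {R} {λ s → e (inj₂ (inj₂ (inj₂ s)))} {x} r
           (λ s t → subst ((e (inj₂ (inj₂ (inj₂ s))) , t) ↦_) (embed t (tr R s (Tape.head t)))
               (H (inj₂ (inj₂ (inj₂ s))) t)) a
    = t₁ , step (subst (λ h → (e (inj₁ tt) , t) ↦ (e (branch P Q R h) , t)) (trans (hd a) eq) (H (inj₁ tt) t)) s₁ , a₁
  sim {wh P} {e} {x} {t = t} (r-stop eq) H a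
    = t , step (subst (λ h → (e (inj₁ tt) , t) ↦ (maybe e x (again P h) , t)) (trans (hd a) eq) (H (inj₁ tt) t)) stop , a
  sim {wh P} {e} {x} {g} {i} {t = t} (r-go ne r₁ r₂) H a
    with t₁ , s₁ , a₁ ← sim {P} {λ s → e (inj₂ s)} {e (inj₁ tt)} r₁
           (λ s t → subst ((e (inj₂ s) , t) ↦_) (embed t (tr P s (Tape.head t))) (H (inj₂ s) t)) a
    with t₂ , s₂ , a₂ ← sim {wh P} {e} {x} r₂ H a₁
    = t₂ , step (subst (λ n → (e (inj₁ tt) , t) ↦ (maybe e x n , t)) (loops (Tape.head t) (λ z → ne (trans (sym (hd a)) z)))
        (H (inj₁ tt) t)) (s₁ ⊕ s₂) , a₂
    where
    loops : ∀ h → h ≢ blank → again P h ≡ just (inj₂ (ent P))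
    loops b0    _ = refl
    loops b1    _ = refl
    loops blank z = contradiction refl z

-- Time-bounded runs of code

≤-by : ∀ {a b} s → a + s ≡ b → a ≤ b
≤-by {a} s eq = subst (a ≤_) eq (m≤m+n a s)

_∶_↝[_]_ : Code → Cfg → ℕ → Cfg → Set
P ∶ c ↝[ B ] d = Σ[ n ∈ ℕ ] (n ≤ B × Run P c n d)

infix 4 _∶_↝[_]_

_then_ : ∀ {P Q c d e A B} → P ∶ c ↝[ A ] d → Q ∶ d ↝[ B ] e → P ▸ Q ∶ c ↝[ A + B ] e
(m , m≤ , r) then (n , n≤ , s) = m + n , +-mono-≤ m≤ n≤ , r-seq r s

infixr 5 _then_

within : ∀ {P c d A B} → A ≤ B → P ∶ c ↝[ A ] d → P ∶ c ↝[ B ] d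
within le (n , n≤ , r) = n , ≤-trans n≤ le , r

write↝ : ∀ s {g i} → wr s ∶ (g , i) ↝[ 1 ] (upd i s g , i)
write↝ s = 1 , ≤-refl , r-wr

noop : Code
noop = mv mvS

noop↝ : ∀ {c} → noop ∶ c ↝[ 1 ] c
noop↝ = 1 , ≤-refl , r-mv

rep : ℕ → Code → Code
rep zero    P = noop
rep (suc n) P = P ▸ rep n P

repL : ∀ n {g i} → rep n (mv mvL) ∶ (g , i) ↝[ suc n ] (g , itL n i)
repL zero    = noop↝
repL (suc n) = (1 , ≤-refl , r-mv) then repL n

repR : ∀ n {g i} → rep n (mv mvR) ∶ (g , i) ↝[ suc n ] (g , itR n i)
repR zero    = noop↝
repR (suc n) = (1 , ≤-refl , r-mv) then repR n

itL-neg : ∀ n m → itL n -[1+ m ] ≡ -[1+ n + m ]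
itL-neg zero    m = refl
itL-neg (suc n) m = trans (itL-neg n (suc m)) (cong -[1+_] (ℕₚ.+-suc n m))

itR-neg : ∀ n m → itR n -[1+ n + m ] ≡ -[1+ m ]
itR-neg zero    m = refl
itR-neg (suc n) m = itR-neg n m

itR-home : ∀ a → itR (suc a) -[1+ a + 0 ] ≡ + 0
itR-home zero    = refl
itR-home (suc a) = itR-home a

-- Stacks on a single tape

-- The bottom element of a stack is in cell 1; cell 0 is always blank, so that scanning back stops there.
cell : Str → ℕ → Sym
cell []      j = blank
cell (b ∷ w) j = if does (j ℕ.≟ suc (length w)) then bit b else cell w j

bit-≢ : ∀ b → bit b ≢ blank
bit-≢ false ()
bit-≢ true  ()

cell-top : ∀ b w → cell (b ∷ w) (suc (length w)) ≡ bit b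
cell-top b w rewrite dec-true (suc (length w) ℕ.≟ suc (length w)) refl = refl

cell-below : ∀ b w {j} → j ≢ suc (length w) → cell (b ∷ w) j ≡ cell w j
cell-below b w {j} ne rewrite dec-false (j ℕ.≟ suc (length w)) ne = refl

cell-beyond : ∀ w {j} → length w < j → cell w j ≡ blank
cell-beyond []      lt = refl
cell-beyond (b ∷ w) lt =
  trans (cell-below b w (λ e → ℕₚ.<-irrefl (sym e) lt)) (cell-beyond w (ℕₚ.<-trans ≤-refl lt))

cell-base : ∀ w → cell w 0 ≡ blank
cell-base []      = refl
cell-base (b ∷ w) = trans (cell-below b w (λ ())) (cell-base w)

cell-occupied : ∀ w {j} → j < length w → cell w (suc j) ≢ blank
cell-occupied (b ∷ w) {j} lt e with j ℕ.≟ length w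
... | yes refl = bit-≢ b (trans (sym (cell-top b w)) e)
... | no ne    = cell-occupied w (ℕₚ.≤∧≢⇒< (ℕₚ.≤-pred lt) ne)
                   (trans (sym (cell-below b w (λ z → ne (ℕₚ.suc-injective z)))) e)

-- Keeps the interleaved stacks apart: a cell left of the origin determines its stack as a residue
-- modulo k and its height as a quotient.
divMod-unique : ∀ {k} (x y : Fin k) i j → toℕ x + i * k ≡ toℕ y + j * k → x ≡ y × i ≡ j
divMod-unique {suc k} x y i j eq = toℕ-injective x≡y ,
  ℕₚ.*-cancelʳ-≡ i j (suc k) (ℕₚ.+-cancelˡ-≡ (toℕ y) _ _ (trans (cong (_+ i * suc k) (sym x≡y)) eq))
  where
  mod : ∀ (z : Fin (suc k)) n → (toℕ z + n * suc k) % suc k ≡ toℕ z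
  mod z n = trans ([m+kn]%n≡m%n (toℕ z) n (suc k)) (m<n⇒m%n≡m (toℕ<n z))
  x≡y : toℕ x ≡ toℕ y
  x≡y = trans (sym (mod x i)) (trans (cong (_% suc k) eq) (mod y j))

-- One stack grows to the right of the origin; the stacks indexed by J are interleaved
-- with stride k to its left.
module Stacks (J : Set) (k : ℕ) (φ : J → Fin k) (ψ : Fin k → J)
              (φψ : ∀ i → φ (ψ i) ≡ i) (ψφ : ∀ a → ψ (φ a) ≡ a) where

  I : Set
  I = Maybe J

  φ-injective : ∀ {a b} → φ a ≡ φ b → a ≡ b
  φ-injective {a} {b} e = trans (sym (ψφ a)) (trans (cong ψ e) (ψφ b))

  _≟I_ : (a b : I) → Dec (a ≡ b)
  _≟I_ = Maybeₚ.≡-dec (λ a b → map′ φ-injective (cong φ) (φ a Fin.≟ φ b))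

  Store : Set
  Store = I → Str

  _[_≔_] : Store → I → Str → Store
  (σ [ c ≔ w ]) d = if does (d ≟I c) then w else σ d

  ≔-same : ∀ σ c w → (σ [ c ≔ w ]) c ≡ w
  ≔-same σ c w with c ≟I c
  ... | yes _ = refl
  ... | no ne = contradiction refl ne

  ≔-other : ∀ σ {c d} w → d ≢ c → (σ [ c ≔ w ]) d ≡ σ d
  ≔-other σ {c} {d} w ne with d ≟I c
  ... | yes e = contradiction e ne
  ... | no _  = refl

  ≔-elim : ∀ (X : Str → Set) σ {c} w d → (d ≡ c → X w) → (d ≢ c → X (σ d)) → X ((σ [ c ≔ w ]) d)
  ≔-elim X σ {c} w d same other with d ≟I c
  ... | yes e = same e
  ... | no ne = other ne

  addr : I → ℕ → ℤ
  addr nothing  j = + j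
  addr (just a) j = -[1+ toℕ (φ a) + j * k ]

  addr-injective : ∀ c d {i j} → addr c i ≡ addr d j → c ≡ d × i ≡ j
  addr-injective nothing  nothing  refl = refl , refl
  addr-injective (just a) (just b) {i} {j} e
    with x≡y , i≡j ← divMod-unique (φ a) (φ b) i j (ℤₚ.-[1+-injective e)
    = cong just (φ-injective x≡y) , i≡j

  -- The stacks leave no gaps on the left, so once they are all empty that half of the tape is
  -- blank, as `Clean` requires.
  addr-surjective : .{{_ : NonZero k}} → ∀ m → Σ[ a ∈ J ] Σ[ j ∈ ℕ ] (addr (just a) j ≡ -[1+ m ])
  addr-surjective m = ψ r , m / k , cong -[1+_] (trans (cong (_+ m / k * k) eq) (sym (m≡m%n+[m/n]*n m k)))
    where
    r = fromℕ< (m%n<n m k)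
    eq : toℕ (φ (ψ r)) ≡ m % k
    eq = trans (cong toℕ (φψ r)) (toℕ-fromℕ< (m%n<n m k))

  -- Bounds the steps of one move along a stack: the stride k and the `noop` that ends `rep` take k
  -- + 1 steps.
  W : ℕ
  W = suc (suc k)

  out inn toBase fromBase : I → Code
  out nothing       = mv mvR
  out (just a)      = rep k (mv mvL)
  inn nothing       = mv mvL
  inn (just a)      = rep k (mv mvR)
  toBase nothing    = noop
  toBase (just a)   = rep (suc (toℕ (φ a))) (mv mvL)
  fromBase nothing  = noop
  fromBase (just a) = rep (suc (toℕ (φ a))) (mv mvR)

  private
    swap-addr : ∀ a j → k + (a + j * k) ≡ a + suc j * k
    swap-addr a j = lem a (j * k) k where
      lem : ∀ a m k → k + (a + m) ≡ a + (k + m)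
      lem = solve-∀

  out↝ : ∀ c {g j} → out c ∶ (g , addr c j) ↝[ W ] (g , addr c (suc j))
  out↝ nothing  = within (s≤s z≤n) (1 , ≤-refl , r-mv)
  out↝ (just a) {g} {j} = subst (λ i → rep k (mv mvL) ∶ (g , addr (just a) j) ↝[ W ] (g , i))
    (trans (itL-neg k _) (cong -[1+_] (swap-addr (toℕ (φ a)) j))) (within (ℕₚ.n≤1+n _) (repL k))

  inn↝ : ∀ c {g j} → inn c ∶ (g , addr c (suc j)) ↝[ W ] (g , addr c j)
  inn↝ nothing  = within (s≤s z≤n) (1 , ≤-refl , r-mv)
  inn↝ (just a) {g} {j} = subst (λ i → rep k (mv mvR) ∶ (g , i) ↝[ W ] (g , addr (just a) j))
    (cong -[1+_] (swap-addr (toℕ (φ a)) j))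
    (subst (λ i → rep k (mv mvR) ∶ (g , -[1+ k + (toℕ (φ a) + j * k) ]) ↝[ W ] (g , i))
      (itR-neg k _) (within (ℕₚ.n≤1+n _) (repR k)))

  toBase↝ : ∀ c {g} → toBase c ∶ (g , + 0) ↝[ W ] (g , addr c 0)
  toBase↝ nothing  = within (s≤s z≤n) noop↝
  toBase↝ (just a) {g} = subst (λ i → toBase (just a) ∶ (g , + 0) ↝[ W ] (g , i))
    (itL-neg (toℕ (φ a)) 0) (within (s≤s (≤-trans (toℕ<n (φ a)) (ℕₚ.n≤1+n _))) (repL (suc (toℕ (φ a)))))

  fromBase↝ : ∀ c {g} → fromBase c ∶ (g , addr c 0) ↝[ W ] (g , + 0)
  fromBase↝ nothing  = within (s≤s z≤n) noop↝
  fromBase↝ (just a) {g} = subst (λ i → fromBase (just a) ∶ (g , addr (just a) 0) ↝[ W ] (g , i))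
    (itR-home (toℕ (φ a))) (within (s≤s (≤-trans (toℕ<n (φ a)) (ℕₚ.n≤1+n _))) (repR (suc (toℕ (φ a)))))

  record Rep (σ : Store) (g : Content) : Set where
    constructor represents
    field
      cells : ∀ c j → g (addr c j) ≡ cell (σ c) j
  open Rep public

  Rep-ext : ∀ {σ σ' g} → (∀ c → σ c ≡ σ' c) → Rep σ g → Rep σ' g
  Rep-ext e R = represents (λ c j → trans (cells R c j) (cong (λ w → cell w j) (e c)))

  Rep-upd : ∀ {σ g} c n s w → Rep σ g → cell w n ≡ s → (∀ {j} → j ≢ n → cell w j ≡ cell (σ c) j) →
            Rep (σ [ c ≔ w ]) (upd (addr c n) s g)
  Rep-upd {σ} {g} c n s w R top rest = represents new
    where
    new : ∀ d j → upd (addr c n) s g (addr d j) ≡ cell ((σ [ c ≔ w ]) d) j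
    new d j with d ≟I c
    ... | no ne = trans (upd-≢ s g (λ e → ne (proj₁ (addr-injective d c e)))) (cells R d j)
    ... | yes refl with j ℕ.≟ n
    ...   | yes refl = trans (upd-≡ (addr d n) s g) (sym top)
    ...   | no ne = trans (upd-≢ s g (λ e → ne (proj₂ (addr-injective d d e)))) (trans (cells R d j) (sym (rest ne)))

  scan-out : ∀ {σ g} c → Rep σ g → ∀ r j → j + r ≡ length (σ c) →
             wh (out c) ∶ (g , addr c (suc j)) ↝[ suc (r * suc W) ] (g , addr c (suc (length (σ c))))
  scan-out {σ} {g} c R zero j e rewrite ℕₚ.+-identityʳ j | e =
    1 , ≤-refl , r-stop (trans (cells R c _) (cell-beyond (σ c) ≤-refl))
  scan-out {σ} {g} c R (suc r) j e
    with m , m≤ , p ← out↝ c {g} {suc j}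
    with n , n≤ , q ← scan-out {σ} {g} c R r (suc j) (trans (sym (ℕₚ.+-suc j r)) e)
    = suc (m + n) , s≤s (≤-trans (+-mono-≤ m≤ n≤) (≤-reflexive (ℕₚ.+-suc W (r * suc W)))) ,
      r-go (λ z → cell-occupied (σ c) (subst (j <_) e (≤-by r (sym (ℕₚ.+-suc j r)))) (trans (sym (cells R c _)) z)) p q

  scan-in : ∀ {σ g} c → Rep σ g → ∀ j → j ≤ length (σ c) →
            wh (inn c) ∶ (g , addr c j) ↝[ suc (j * suc W) ] (g , addr c 0)
  scan-in {σ} c R zero le = 1 , ≤-refl , r-stop (trans (cells R c 0) (cell-base (σ c)))
  scan-in {σ} {g} c R (suc j) le
    with m , m≤ , p ← inn↝ c {g} {j}
    with n , n≤ , q ← scan-in {σ} {g} c R j (ℕₚ.<⇒≤ le)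
    = suc (m + n) , s≤s (≤-trans (+-mono-≤ m≤ n≤) (≤-reflexive (ℕₚ.+-suc W (j * suc W)))) ,
      r-go (λ z → cell-occupied (σ c) le (trans (sym (cells R c _)) z)) p q

  -- In `top`, the first `out c` steps over the base cell; being blank, it would end the outward
  -- scan at once. The last `inn c` comes back from the first free cell.
  home top remove : I → Code
  home c = wh (inn c) ▸ fromBase c
  top  c = toBase c ▸ out c ▸ wh (out c) ▸ inn c
  remove c = wr blank ▸ inn c ▸ home c

  home↝ : ∀ {σ g} c → Rep σ g → ∀ j → j ≤ length (σ c) →
          home c ∶ (g , addr c j) ↝[ suc j * suc W ] (g , + 0)
  home↝ c R j le = within (≤-reflexive (lem j W)) (scan-in c R j le then fromBase↝ c)
    where
    lem : ∀ j w → suc (j * suc w) + w ≡ suc j * suc w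
    lem = solve-∀

  top↝ : ∀ {σ g w} c → Rep σ g → σ c ≡ w → top c ∶ (g , + 0) ↝[ (3 + length w) * suc W ] (g , addr c (length w))
  top↝ {σ} {g} c R refl = within (≤-by 2 (lem (length (σ c)) W))
    (toBase↝ c then out↝ c then scan-out {σ} c R (length (σ c)) 0 refl then inn↝ c)
    where
    lem : ∀ l w → w + (w + (suc (l * suc w) + w)) + 2 ≡ (3 + l) * suc w
    lem = solve-∀

  remove↝ : ∀ {σ g b w} c → Rep σ g → σ c ≡ b ∷ w →
          Σ[ g' ∈ Content ] (remove c ∶ (g , addr c (suc (length w))) ↝[ (2 + length w) * suc W ] (g' , + 0) ×
              Rep (σ [ c ≔ w ]) g')
  remove↝ {σ} {g} {b} {w} c R e = _ , within (≤-reflexive (lem (length w) W))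
      (write↝ blank then inn↝ c then home↝ c R' (length w) ℓ) , R'
    where
    R' : Rep (σ [ c ≔ w ]) (upd (addr c (suc (length w))) blank g)
    R' = Rep-upd c _ blank w R (cell-beyond w ≤-refl)
           (λ {j} ne → trans (sym (cell-below b w ne)) (cong (λ v → cell v j) (sym e)))
    ℓ : length w ≤ length ((σ [ c ≔ w ]) c)
    ℓ = ≤-reflexive (cong length (sym (≔-same σ c w)))
    lem : ∀ l w → 1 + (w + suc l * suc w) ≡ (2 + l) * suc w
    lem = solve-∀

  _⊩_⇒[_]_ : Code → Store → ℕ → Store → Set
  P ⊩ σ ⇒[ B ] σ' = ∀ g → Rep σ g → Σ[ g' ∈ Content ] (P ∶ (g , + 0) ↝[ B ] (g' , + 0) × Rep σ' g')

  infix 4 _⊩_⇒[_]_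

  -- Bound for one operation on a stack of height h: one traversal outwards and one back, with
  -- `suc W` per cell, and six more such units for what happens at the two ends.
  U : ℕ → ℕ
  U h = (6 + 2 * h) * suc W

  U-mono : ∀ {m n} → m ≤ n → U m ≤ U n
  U-mono le = *-mono-≤ (+-monoʳ-≤ 6 (*-mono-≤ (≤-refl {2}) le)) (≤-refl {suc W})

  ⊩-seq : ∀ {P Q σ σ' σ'' A B} → P ⊩ σ ⇒[ A ] σ' → Q ⊩ σ' ⇒[ B ] σ'' → P ▸ Q ⊩ σ ⇒[ A + B ] σ''
  ⊩-seq p q g R with g₁ , r₁ , R₁ ← p g R with g₂ , r₂ , R₂ ← q g₁ R₁ = g₂ , r₁ then r₂ , R₂

  ⊩-within : ∀ {P σ σ' A B} → A ≤ B → P ⊩ σ ⇒[ A ] σ' → P ⊩ σ ⇒[ B ] σ'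
  ⊩-within le p g R with g₁ , r₁ , R₁ ← p g R = g₁ , within le r₁ , R₁

  ⊩-ext : ∀ {P σ₁ σ₂ σ₁' σ₂' B} → (∀ c → σ₁ c ≡ σ₁' c) → (∀ c → σ₂ c ≡ σ₂' c) →
          P ⊩ σ₁ ⇒[ B ] σ₂ → P ⊩ σ₁' ⇒[ B ] σ₂'
  ⊩-ext e₁ e₂ p g R with g₁ , r₁ , R₁ ← p g (Rep-ext (λ c → sym (e₁ c)) R) = g₁ , r₁ , Rep-ext e₂ R₁

  ⊩-noop : ∀ {σ} → noop ⊩ σ ⇒[ 1 ] σ
  ⊩-noop g R = g , noop↝ , R

  push : I → Bool → Code
  push c b = toBase c ▸ out c ▸ wh (out c) ▸ wr (bit b) ▸ home c

  ⊩-push : ∀ {σ} c b → push c b ⊩ σ ⇒[ U (length (σ c)) ] (σ [ c ≔ b ∷ σ c ])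
  ⊩-push {σ} c b g R = _ , within (≤-by (2 * suc W) (lem (length w) W))
    (toBase↝ c then out↝ c then scan-out c R (length w) 0 refl then write↝ (bit b) then home↝ c R' (suc (length w)) ℓ) , R'
    where
    w = σ c
    R' : Rep (σ [ c ≔ b ∷ w ]) (upd (addr c (suc (length w))) (bit b) g)
    R' = Rep-upd c _ (bit b) (b ∷ w) R (cell-top b w) (cell-below b w)
    ℓ : suc (length w) ≤ length ((σ [ c ≔ b ∷ w ]) c)
    ℓ = ≤-reflexive (cong length (sym (≔-same σ c (b ∷ w))))
    lem : ∀ l w → w + (w + (suc (l * suc w) + (1 + suc (suc l) * suc w))) + 2 * suc w ≡ (6 + 2 * l) * suc w
    lem = solve-∀

  pop : I → Code → Code → Code → Code
  pop c E P Q = top c ▸ br (remove c ▸ P) (remove c ▸ Q) (home c ▸ E)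

  ⊩-pop-[] : ∀ {σ σ' c E P Q B} → σ c ≡ [] → E ⊩ σ ⇒[ B ] σ' → pop c E P Q ⊩ σ ⇒[ U 0 + B ] σ'
  ⊩-pop-[] {σ} {c = c} {B = B} e p g R
    with g' , (m , m≤ , q) , R' ← p g R
    with (n , n≤ , r) ← top↝ {σ} c R e
    with (l , l≤ , s) ← home↝ {σ} {g} c R 0 z≤n
    = g' , (n + suc (l + m) , ≤-trans (+-mono-≤ n≤ (s≤s (+-mono-≤ l≤ m≤))) (≤-by _ (lem W B)) ,
        r-seq r (r-br- (trans (cells R c 0) (cell-base (σ c))) (r-seq s q))) , R'
    where
    lem : ∀ w B → (3 + 0) * suc w + suc (1 * suc w + B) + (2 * w + 1) ≡ (6 + 2 * 0) * suc w + B
    lem = solve-∀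

  private
    at-top : ∀ {σ g c b w} → Rep σ g → σ c ≡ b ∷ w → g (addr c (suc (length w))) ≡ bit b
    at-top {c = c} {b} {w} R e = trans (cells R c _) (trans (cong (λ v → cell v _) e) (cell-top b w))

    branched : ∀ c {E P Q g i c₁ c₂ l m} b → g i ≡ bit b → Run (remove c) (g , i) l c₁ →
               Run (if b then Q else P) c₁ m c₂ → Run (br (remove c ▸ P) (remove c ▸ Q) E) (g , i) (suc (l + m)) c₂
    branched c false t s q = r-br0 t (r-seq s q)
    branched c true  t s q = r-br1 t (r-seq s q)

  ⊩-pop-∷ : ∀ {σ σ' c E P Q B} b w → σ c ≡ b ∷ w → (if b then Q else P) ⊩ σ [ c ≔ w ] ⇒[ B ] σ' →
            pop c E P Q ⊩ σ ⇒[ U (suc (length w)) + B ] σ'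
  ⊩-pop-∷ {σ} {c = c} {B = B} b w e p g R
    with t ← at-top {σ} {c = c} R e
    with g₁ , (l , l≤ , s) , R₁ ← remove↝ {σ} c R e
    with g' , (m , m≤ , q) , R' ← p g₁ R₁
    with (n , n≤ , r) ← top↝ {σ} c R e
    = g' , (n + suc (l + m) , ≤-trans (+-mono-≤ n≤ (s≤s (+-mono-≤ l≤ m≤))) (≤-by _ (lem (length w) W B)) ,
        r-seq r (branched c b t s q)) , R'
    where
    lem : ∀ l w B → (3 + suc l) * suc w + suc ((2 + l) * suc w + B) + (2 * w + 1) ≡ (6 + 2 * suc l) * suc w + B
    lem = solve-∀

  -- The test of `wh` sees the cell where `top c` leaves the head, which is the top element or, for
  -- an empty stack, the blank base. Hence `top c` stands before the loop and again at the end of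
  -- its body.
  while : I → Code → Code → Code
  while c P Q = top c ▸ wh (br (remove c ▸ P) (remove c ▸ Q) noop ▸ top c) ▸ home c

  ⊩-while-[] : ∀ {σ c P Q} → σ c ≡ [] → while c P Q ⊩ σ ⇒[ U 0 ] σ
  ⊩-while-[] {σ} {c} e g R
    with (n , n≤ , r) ← top↝ {σ} c R e
    with (l , l≤ , s) ← home↝ {σ} {g} c R 0 z≤n
    = g , (n + (1 + l) , ≤-trans (+-mono-≤ n≤ (s≤s l≤)) (≤-by _ (lem W)) ,
        r-seq r (r-seq (r-stop (trans (cells R c 0) (cell-base (σ c)))) s)) , R
    where
    lem : ∀ w → (3 + 0) * suc w + suc (1 * suc w) + (2 * w + 1) ≡ (6 + 2 * 0) * suc w
    lem = solve-∀

  ⊩-while-∷ : ∀ {σ σ' σ'' c P Q A B} b w → σ c ≡ b ∷ w → (if b then Q else P) ⊩ σ [ c ≔ w ] ⇒[ A ] σ' →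
              while c P Q ⊩ σ' ⇒[ B ] σ'' → while c P Q ⊩ σ ⇒[ U (suc (length w)) + A + B ] σ''
  ⊩-while-∷ {σ} {c = c} {A = A} {B = B} b w e p q g R
    with t ← at-top {σ} {c = c} R e
    with g₁ , (l , l≤ , s) , R₁ ← remove↝ {σ} c R e
    with g₂ , (m , m≤ , s') , R₂ ← p g₁ R₁
    -- The run of the remaining loop is taken apart: its opening `top c` becomes the end of the
    -- present turn, so that no traversal is paid for twice.
    with g₃ , (_ , k≤ , r-seq {m = i₁} r₁ (r-seq {m = i₂} {n = i₃} r₂ r₃)) , R₃ ← q g₂ R₂
    with (n , n≤ , r) ← top↝ {σ} c R e
    = g₃ , (n + (suc (suc (l + m) + i₁ + i₂) + i₃) ,
        ≤-trans (≤-reflexive (assoc n l m i₁ i₂ i₃))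
            (≤-trans (+-mono-≤ (+-mono-≤ n≤ (s≤s (s≤s (+-mono-≤ l≤ m≤)))) k≤) (≤-by _ (lem (length w) W A B))) ,
        r-seq r (r-seq (r-go (λ z → bit-≢ b (trans (sym t) z)) (r-seq (branched c b t s s') r₁) r₂) r₃)) , R₃
    where
    assoc : ∀ n l m i₁ i₂ i₃ → n + (suc (suc (l + m) + i₁ + i₂) + i₃) ≡ n + suc (suc (l + m)) + (i₁ + (i₂ + i₃))
    assoc = solve-∀
    lem : ∀ l w A B → (3 + suc l) * suc w + suc (suc ((2 + l) * suc w + A)) + B + 2 * w ≡ (6 + 2 * suc l) * suc w + A + B
    lem = solve-∀

-- Stack programs, their operation counts and the growth of their stacks

iter : ∀ {A : Set} → ℕ → (A → A) → A → A
iter zero    f x = x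
iter (suc m) f x = iter m f (f x)

-- Stack programs; `loop P` repeats P as many times as the input is long.
data Cmd (K : ℕ) : Set where
  skip : Cmd K
  psh  : Fin K → Bool → Cmd K
  pp   : Fin K → Cmd K → Cmd K → Cmd K → Cmd K
  _⨟_  : Cmd K → Cmd K → Cmd K
  loop : Cmd K → Cmd K

infixr 5 _⨟_

mutual
  exec : ∀ {K} → Cmd K → ℕ → Vec Str K → Vec Str K
  exec skip         n v = v
  exec (psh r b)    n v = updateAt v r (b ∷_)
  exec (pp r E P Q) n v = popped r E P Q n v (lookup v r)
  exec (P ⨟ Q)      n v = exec Q n (exec P n v)
  exec (loop P)     n v = iter n (exec P n) v

  popped : ∀ {K} → Fin K → Cmd K → Cmd K → Cmd K → ℕ → Vec Str K → Str → Vec Str K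
  popped r E P Q n v []          = exec E n v
  popped r E P Q n v (false ∷ w) = exec P n (v [ r ]≔ w)
  popped r E P Q n v (true ∷ w)  = exec Q n (v [ r ]≔ w)

depth : ∀ {K} → Cmd K → ℕ
depth skip         = 0
depth (psh r b)    = 0
depth (pp r E P Q) = depth E ⊔ (depth P ⊔ depth Q)
depth (P ⨟ Q)      = depth P ⊔ depth Q
depth (loop P)     = suc (depth P)

-- In a loop the 2 and the 4 pay for its counters: the counting loop and the refilling loop each
-- cost one final test, and one pop and one push per turn. Branches are added, not maximised, to
-- stay a polynomial.
opsP : ∀ {K} → Cmd K → Poly
opsP skip         = pconst 1
opsP (psh r b)    = pconst 1
opsP (pp r E P Q) = padd (pconst 1) (padd (opsP E) (padd (opsP P) (opsP Q)))
opsP (P ⨟ Q)      = padd (opsP P) (opsP Q)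
opsP (loop P)     = 2 ∷ padd (pconst 4) (opsP P)

ops : ∀ {K} → Cmd K → ℕ → ℕ
ops P n = eval (opsP P) n

ops-pp : ∀ {K} r (E P Q : Cmd K) n → ops (pp r E P Q) n ≡ 1 + (ops E n + (ops P n + ops Q n))
ops-pp r E P Q n rewrite eval-add (pconst 1) (padd (opsP E) (padd (opsP P) (opsP Q))) n
  | eval-add (opsP E) (padd (opsP P) (opsP Q)) n | eval-add (opsP P) (opsP Q) n | ℕₚ.*-zeroʳ n = refl

ops-seq : ∀ {K} (P Q : Cmd K) n → ops (P ⨟ Q) n ≡ ops P n + ops Q n
ops-seq P Q n = eval-add (opsP P) (opsP Q) n

ops-loop : ∀ {K} (P : Cmd K) n → ops (loop P) n ≡ 2 + n * (4 + ops P n)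
ops-loop P n rewrite eval-add (pconst 4) (opsP P) n | ℕₚ.*-zeroʳ n = refl

record Bounded {K : ℕ} (v : Vec Str K) (h : ℕ) : Set where
  constructor bounded
  field
    height : ∀ r → length (lookup v r) ≤ h
open Bounded

Bounded-mono : ∀ {K} {v : Vec Str K} {h h'} → h ≤ h' → Bounded v h → Bounded v h'
Bounded-mono le B = bounded (λ r → ≤-trans (height B r) le)

Bounded-push : ∀ {K} {v : Vec Str K} {h} r b → Bounded v h → Bounded (updateAt v r (b ∷_)) (suc h)
Bounded-push {v = v} {h} r b B = bounded new
  where
  new : ∀ s → length (lookup (updateAt v r (b ∷_)) s) ≤ suc h
  new s with s Fin.≟ r
  ... | yes refl rewrite lookup∘updateAt s {b ∷_} v = s≤s (height B s)
  ... | no ne rewrite lookup∘updateAt′ s r {b ∷_} ne v = ≤-trans (height B s) (ℕₚ.n≤1+n _)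

Bounded-pop : ∀ {K} {v : Vec Str K} {h b w} r → Bounded v h → lookup v r ≡ b ∷ w → Bounded (v [ r ]≔ w) h
Bounded-pop {v = v} {h} {w = w} r B e = bounded new
  where
  new : ∀ s → length (lookup (v [ r ]≔ w) s) ≤ h
  new s with s Fin.≟ r
  ... | yes refl rewrite lookup∘update s v w = ≤-trans (ℕₚ.n≤1+n _) (subst (λ l → length l ≤ _) e (height B s))
  ... | no ne rewrite lookup∘update′ {i = s} {j = r} ne v w = height B s

mutual
  -- The polynomial that counts operations also bounds growth, because only a push lengthens a
  -- stack, and by one symbol.
  exec-bounded : ∀ {K} (P : Cmd K) n {v h} → Bounded v h → Bounded (exec P n v) (h + ops P n)
  exec-bounded skip         n B = Bounded-mono (m≤m+n _ _) B
  exec-bounded (psh r b)    n {v} {h} B rewrite ℕₚ.*-zeroʳ n | ℕₚ.+-comm h 1 = Bounded-push {v = v} r b B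
  exec-bounded (pp r E P Q) n {v} {h} B = popped-bounded r E P Q n (lookup v r) refl B
  exec-bounded (P ⨟ Q)      n {v} {h} B = Bounded-mono
    (≤-reflexive (trans (ℕₚ.+-assoc h _ _) (cong (_+_ h) (sym (ops-seq P Q n)))))
    (exec-bounded Q n (exec-bounded P n B))
  exec-bounded (loop P)     n {v} {h} B = Bounded-mono
    (+-monoʳ-≤ h (≤-trans (*-mono-≤ (≤-refl {n}) (m≤n+m _ 4)) (≤-trans (m≤n+m _ 2) (≤-reflexive (sym (ops-loop P n))))))
    (iter-bounded P n n B)

  iter-bounded : ∀ {K} (P : Cmd K) n m {v h} → Bounded v h → Bounded (iter m (exec P n) v) (h + m * ops P n)
  iter-bounded P n zero    B = Bounded-mono (m≤m+n _ _) B
  iter-bounded P n (suc m) {h = h} B = Bounded-mono (≤-reflexive (ℕₚ.+-assoc h _ _))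
      (iter-bounded P n m (exec-bounded P n B))

  popped-bounded : ∀ {K} r (E P Q : Cmd K) n {v h} w → lookup v r ≡ w → Bounded v h →
                   Bounded (popped r E P Q n v w) (h + ops (pp r E P Q) n)
  popped-bounded r E P Q n {v} {h} [] e B = Bounded-mono
    (+-monoʳ-≤ h (≤-trans (≤-trans (m≤m+n (ops E n) _) (m≤n+m _ 1)) (≤-reflexive (sym (ops-pp r E P Q n)))))
        (exec-bounded E n B)
  popped-bounded r E P Q n {v} {h} (false ∷ w) e B = Bounded-mono
    (+-monoʳ-≤ h (≤-trans (≤-trans (≤-trans (m≤m+n (ops P n) _) (m≤n+m _ (ops E n))) (m≤n+m _ 1))
        (≤-reflexive (sym (ops-pp r E P Q n)))))
    (exec-bounded P n (Bounded-pop {v = v} r B e))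
  popped-bounded r E P Q n {v} {h} (true ∷ w) e B = Bounded-mono
    (+-monoʳ-≤ h (≤-trans (≤-trans (≤-trans (m≤n+m (ops Q n) _) (m≤n+m _ (ops E n))) (m≤n+m _ 1))
        (≤-reflexive (sym (ops-pp r E P Q n)))))
    (exec-bounded Q n (Bounded-pop {v = v} r B e))

-- The string is written from cell 1 to the right. Read as a stack growing to the right it has its
-- last symbol on top, hence `reverse`.
record Clean (x : Str) (g : Content) : Set where
  constructor clean
  field
    pos : ∀ j → g (+ j) ≡ cell (reverse x) j
    neg : ∀ m → g -[1+ m ] ≡ blank

-- Nothing but the argument is on the tape at the start, and nothing but the value at the end; this is what makes
-- the class closed under composition.
record SFP (f : Str → Str) : Set where
  constructor sfp
  field
    prog  : Code
    time  : Poly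
    short : ∀ x → length (f x) ≤ eval time (length x)
    runs  : ∀ x g → Clean x g → Σ[ g' ∈ Content ]
            (prog ∶ (g , + 1) ↝[ eval time (length x) ] (g' , + 1) × Clean (f x) g')

-- Each loop level d owns two unary counters: N d holds the iterations to come and E d those already done, so that
-- N d can be refilled afterwards.
module Compile (K D : ℕ) where

  J : Set
  J = Fin K ⊎ (Fin D ⊎ Fin D)

  k : ℕ
  k = K + (D + D)

  φ : J → Fin k
  φ a = join K (D + D) (map₂ (join D D) a)

  ψ : Fin k → J
  ψ i = map₂ (splitAt D) (splitAt K i)

  ψφ : ∀ a → ψ (φ a) ≡ a
  ψφ (inj₁ r) rewrite splitAt-join K (D + D) (inj₁ r) = refl
  ψφ (inj₂ s) rewrite splitAt-join K (D + D) (inj₂ (join D D s)) = cong inj₂ (splitAt-join D D s)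

  φψ : ∀ i → φ (ψ i) ≡ i
  φψ i = trans (lem (splitAt K i)) (join-splitAt K (D + D) i)
    where
    lem : ∀ s → join K (D + D) (map₂ (join D D) (map₂ (splitAt D) s)) ≡ join K (D + D) s
    lem (inj₁ r) = refl
    lem (inj₂ j) = cong (join K (D + D) ∘ inj₂) (join-splitAt D D j)

  open Stacks J k φ ψ φψ ψφ public

  usr : Fin K → I
  usr r = just (inj₁ r)

  N E : Fin D → I
  N d = just (inj₂ (inj₁ d))
  E d = just (inj₂ (inj₂ d))

  code : (P : Cmd K) → depth P ≤ D → Code
  code skip         p = noop
  code (psh r b)    p = push (usr r) b
  code (pp r X P Q) p = pop (usr r)
    (code X (ℕₚ.m⊔n≤o⇒m≤o _ _ p))
    (code P (ℕₚ.m⊔n≤o⇒m≤o _ _ (ℕₚ.m⊔n≤o⇒n≤o (depth X) _ p)))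
    (code Q (ℕₚ.m⊔n≤o⇒n≤o (depth P) _ (ℕₚ.m⊔n≤o⇒n≤o (depth X) _ p)))
  code (P ⨟ Q)      p = code P (ℕₚ.m⊔n≤o⇒m≤o _ _ p) ▸ code Q (ℕₚ.m⊔n≤o⇒n≤o (depth P) _ p)
  code (loop P)     p = while (N d) body body ▸ while (E d) back back
    where
    -- The level of a loop is the depth of its body, so a loop never shares its counters with a loop
    -- nested in it.
    d    = fromℕ< p
    body = push (E d) true ▸ code P (ℕₚ.<⇒≤ p)
    back = push (N d) true

  Counts : Set
  Counts = Fin D → ℕ

  _⟨_↦_⟩ : Counts → Fin D → ℕ → Counts
  (τ ⟨ d ↦ i ⟩) e = if does (e Fin.≟ d) then i else τ e

  ↦-same : ∀ τ d i → (τ ⟨ d ↦ i ⟩) d ≡ i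
  ↦-same τ d i rewrite dec-true (d Fin.≟ d) refl = refl

  ↦-other : ∀ τ {d e} i → e ≢ d → (τ ⟨ d ↦ i ⟩) e ≡ τ e
  ↦-other τ {d} {e} i ne rewrite dec-false (e Fin.≟ d) ne = refl

  store : ℕ → Vec Str K → Counts → Store
  store n v τ nothing                = []
  store n v τ (just (inj₁ r))        = lookup v r
  store n v τ (just (inj₂ (inj₁ d))) = ones (τ d)
  store n v τ (just (inj₂ (inj₂ d))) = ones (n ∸ τ d)

  store-ext : ∀ {n v τ τ'} → (∀ d → τ d ≡ τ' d) → ∀ c → store n v τ c ≡ store n v τ' c
  store-ext e nothing                = refl
  store-ext e (just (inj₁ r))        = refl
  store-ext e (just (inj₂ (inj₁ d))) = cong ones (e d)
  store-ext {n} e (just (inj₂ (inj₂ d))) = cong (λ m → ones (n ∸ m)) (e d)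

  store-usr : ∀ {n v v' τ} r w → lookup v' r ≡ w → (∀ s → s ≢ r → lookup v' s ≡ lookup v s) →
              ∀ c → (store n v τ [ usr r ≔ w ]) c ≡ store n v' τ c
  store-usr {n} {v} {v'} {τ} r w same other c with c ≟I usr r
  ... | yes refl = sym same
  store-usr r w same other nothing                | no ne = refl
  store-usr r w same other (just (inj₁ s))        | no ne = sym (other s (λ { refl → ne refl }))
  store-usr r w same other (just (inj₂ (inj₁ d))) | no ne = refl
  store-usr r w same other (just (inj₂ (inj₂ d))) | no ne = refl

  store-push : ∀ {n v τ} r b c → (store n v τ [ usr r ≔ b ∷ lookup v r ]) c ≡ store n (updateAt v r (b ∷_)) τ c
  store-push {v = v} r b = store-usr r _ (lookup∘updateAt r v) (λ s ne → lookup∘updateAt′ s r ne v)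

  store-pop : ∀ {n v τ} r w c → (store n v τ [ usr r ≔ w ]) c ≡ store n (v [ r ]≔ w) τ c
  store-pop {v = v} r w = store-usr r w (lookup∘update r v w) (λ s ne → lookup∘update′ ne v w)

  store-count : ∀ {n v τ} d i {w₁ w₂} → w₁ ≡ ones i → w₂ ≡ ones (n ∸ i) → ∀ c →
                (store n v τ [ N d ≔ w₁ ] [ E d ≔ w₂ ]) c ≡ store n v (τ ⟨ d ↦ i ⟩) c
  store-count {n} {v} {τ} d i {w₁} {w₂} refl refl c with c ≟I E d
  ... | yes refl = cong (λ m → ones (n ∸ m)) (sym (↦-same τ d i))
  ... | no ne with c ≟I N d
  ...   | yes refl = cong ones (sym (↦-same τ d i))
  store-count d i refl refl nothing                | no ne | no ne' = refl
  store-count d i refl refl (just (inj₁ s))        | no ne | no ne' = refl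
  store-count {τ = τ} d i refl refl (just (inj₂ (inj₁ e))) | no ne | no ne' =
    cong ones (sym (↦-other τ i (λ { refl → ne' refl })))
  store-count {n} {τ = τ} d i refl refl (just (inj₂ (inj₂ e))) | no ne | no ne' =
    cong (λ m → ones (n ∸ m)) (sym (↦-other τ i (λ { refl → ne refl })))

  store-count′ : ∀ {n v τ} d i {w₁ w₂} → w₁ ≡ ones i → w₂ ≡ ones (n ∸ i) → ∀ c →
                (store n v τ [ E d ≔ w₂ ] [ N d ≔ w₁ ]) c ≡ store n v (τ ⟨ d ↦ i ⟩) c
  store-count′ {n} {v} {τ} d i {w₁} {w₂} refl refl c with c ≟I N d
  ... | yes refl = cong ones (sym (↦-same τ d i))
  ... | no ne with c ≟I E d
  ...   | yes refl = cong (λ m → ones (n ∸ m)) (sym (↦-same τ d i))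
  store-count′ d i refl refl nothing                | no ne | no ne' = refl
  store-count′ d i refl refl (just (inj₁ s))        | no ne | no ne' = refl
  store-count′ {τ = τ} d i refl refl (just (inj₂ (inj₁ e))) | no ne | no ne' =
    cong ones (sym (↦-other τ i (λ { refl → ne refl })))
  store-count′ {n} {τ = τ} d i refl refl (just (inj₂ (inj₂ e))) | no ne | no ne' =
    cong (λ m → ones (n ∸ m)) (sym (↦-other τ i (λ { refl → ne' refl })))

  1≤U : ∀ h → 1 ≤ U h
  1≤U h = s≤s z≤n

  ↦-twice : ∀ τ d i j e → ((τ ⟨ d ↦ i ⟩) ⟨ d ↦ j ⟩) e ≡ (τ ⟨ d ↦ j ⟩) e
  ↦-twice τ d i j e with e Fin.≟ d
  ... | yes _ = refl
  ... | no _  = refl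

  ↦-id : ∀ τ d i → τ d ≡ i → ∀ e → (τ ⟨ d ↦ i ⟩) e ≡ τ e
  ↦-id τ d i eq e with e Fin.≟ d
  ... | yes refl = sym eq
  ... | no _     = refl

  -- Full counters are demanded only below level m: while a body runs, the counters of the enclosing
  -- loops are somewhere in the middle of their count.
  Ready : ℕ → ℕ → Counts → Set
  Ready n m τ = ∀ d → toℕ d < m → τ d ≡ n

  Ready-mono : ∀ {n m m' τ} → m ≤ m' → Ready n m' τ → Ready n m τ
  Ready-mono le R d lt = R d (≤-trans lt le)

  refill : ∀ {n v H} τ d r → r ≤ n → n ≤ H →
           while (E d) (push (N d) true) (push (N d) true)
             ⊩ store n v (τ ⟨ d ↦ n ∸ r ⟩) ⇒[ suc (r * 2) * U H ] store n v (τ ⟨ d ↦ n ⟩)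
  refill {n} {v} {H} τ d zero le n≤H = ⊩-within (≤-trans (U-mono (z≤n {H})) (≤-reflexive (sym (ℕₚ.*-identityˡ (U H)))))
    (⊩-while-[] {c = E d} (cong ones (trans (cong (n ∸_) (↦-same τ d n)) (ℕₚ.n∸n≡0 n))))
  refill {n} {v} {H} τ d (suc r) le n≤H = ⊩-within cost
    (⊩-while-∷ {c = E d} true (ones r)
      (cong ones (trans (cong (n ∸_) (↦-same τ d _)) (ℕₚ.m∸[m∸n]≡n le)))
      (⊩-ext (λ _ → refl) pushed (⊩-push (N d) true))
      (refill τ d r (ℕₚ.<⇒≤ le) n≤H))
    where
    τ₁ = τ ⟨ d ↦ n ∸ suc r ⟩
    σ₁ = store n v τ₁ [ E d ≔ ones r ]
    N-val : σ₁ (N d) ≡ ones (n ∸ suc r)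
    N-val = trans (≔-other (store n v τ₁) {E d} {N d} (ones r) (λ ())) (cong ones (↦-same τ d _))
    pushed : ∀ c → (σ₁ [ N d ≔ true ∷ σ₁ (N d) ]) c ≡ store n v (τ ⟨ d ↦ n ∸ r ⟩) c
    pushed c = trans (store-count′ {n} {v} {τ₁} d (n ∸ r)
        (trans (cong (true ∷_) N-val) (cong ones (sym (ℕₚ.+-∸-assoc 1 le))))
        (cong ones (sym (ℕₚ.m∸[m∸n]≡n (ℕₚ.<⇒≤ le)))) c)
      (store-ext {n} {v} (↦-twice τ d (n ∸ suc r) (n ∸ r)) c)
    len : length (σ₁ (N d)) ≤ H
    len = ≤-trans (≤-reflexive (trans (cong length N-val) (length-replicate (n ∸ suc r))))
        (≤-trans (ℕₚ.m∸n≤m n (suc r)) n≤H)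
    cost : U (suc (length (ones r))) + U (length (σ₁ (N d))) + suc (r * 2) * U H ≤ suc (suc r * 2) * U H
    cost = ≤-trans (+-mono-≤ (+-mono-≤ (U-mono (≤-trans (≤-reflexive (cong suc (length-replicate r))) (≤-trans le n≤H)))
        (U-mono len)) ≤-refl)
      (≤-reflexive (lem r (U H)))
      where
      lem : ∀ r u → u + u + suc (r * 2) * u ≡ suc (suc r * 2) * u
      lem = solve-∀

  mutual
    -- H is a single ceiling for every height reached during the run, program stacks and counters
    -- alike; each operation then costs at most `U H`, and the total is a product.
    code-correct : ∀ P p {n v τ h H} → Ready n (depth P) τ → Bounded v h → h + ops P n ≤ H → n ≤ H →
                   code P p ⊩ store n v τ ⇒[ ops P n * U H ] store n (exec P n v) τ
    code-correct skip p {n} {H = H} R B le n≤H rewrite ℕₚ.*-zeroʳ n = ⊩-within (≤-trans (1≤U H) (m≤m+n _ _)) ⊩-noop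
    code-correct (psh r b) p {n} {v} {τ} {h} {H} R B le n≤H rewrite ℕₚ.*-zeroʳ n =
      ⊩-within (≤-trans (U-mono (≤-trans (height B r) (ℕₚ.m+n≤o⇒m≤o h le))) (m≤m+n _ _))
        (⊩-ext (λ _ → refl) (store-push {n} {v} {τ} r b) (⊩-push (usr r) b))
    code-correct (pp r X P Q) p {n} {v} {τ} {h} {H} R B le n≤H = popped-correct r X P Q p (lookup v r) refl R B le n≤H
    code-correct (P ⨟ Q) p {n} {v} {τ} {h} {H} R B le n≤H rewrite ops-seq P Q n =
      ⊩-within (≤-reflexive (sym (ℕₚ.*-distribʳ-+ (U H) (ops P n) (ops Q n))))
        (⊩-seq (code-correct P _ (Ready-mono (ℕₚ.m≤m⊔n _ _) R) B (≤-trans (+-monoʳ-≤ h (m≤m+n _ _)) le) n≤H)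
               (code-correct Q _ (Ready-mono (ℕₚ.m≤n⊔m (depth P) _) R) (exec-bounded P n B)
                 (≤-trans (≤-reflexive (ℕₚ.+-assoc h _ _)) le) n≤H))
    code-correct (loop P) p {n} {v} {τ} {h} {H} R B le n≤H =
      ⊩-within (≤-reflexive (trans (lem n (ops P n) (U H)) (cong (_* U H) (sym (ops-loop P n)))))
        (⊩-seq
          (⊩-ext (store-ext {n} {v} (↦-id τ d n (R d d<))) (λ _ → refl)
            (loop-correct P p n ≤-refl (Ready-mono (ℕₚ.n≤1+n _) R) B
              (≤-trans (+-monoʳ-≤ h (≤-trans (*-mono-≤ (≤-refl {n}) (m≤n+m _ 4)) (m≤n+m _ 2)))
                  (subst (λ o → h + o ≤ H) (ops-loop P n) le)) n≤H))
          (⊩-ext (store-ext {n} (λ e → cong (λ i → (τ ⟨ d ↦ i ⟩) e) (ℕₚ.n∸n≡0 n)))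
                 (store-ext {n} (↦-id τ d n (R d d<)))
                 (refill τ d n ≤-refl n≤H)))
      where
      d = fromℕ< p
      d< : toℕ d < suc (depth P)
      d< = s≤s (≤-reflexive (toℕ-fromℕ< p))
      lem : ∀ n o u → suc (n * (2 + o)) * u + suc (n * 2) * u ≡ (2 + n * (4 + o)) * u
      lem = solve-∀

    popped-correct : ∀ r X P Q p {n v τ h H} w → lookup v r ≡ w → Ready n (depth (pp r X P Q)) τ → Bounded v h →
                     h + ops (pp r X P Q) n ≤ H → n ≤ H →
                     code (pp r X P Q) p ⊩ store n v τ ⇒[ ops (pp r X P Q) n * U H ] store n (popped r X P Q n v w) τ
    popped-correct r X P Q p {n} {v} {τ} {h} {H} [] e R B le n≤H rewrite ops-pp r X P Q n =
      ⊩-within (+-mono-≤ (U-mono (z≤n {H})) (*-mono-≤ (m≤m+n (ops X n) _) (≤-refl {U H})))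
        (⊩-pop-[] {c = usr r} e (code-correct X _ (Ready-mono (ℕₚ.m≤m⊔n _ _) R) B
          (≤-trans (+-monoʳ-≤ h (≤-trans (m≤m+n (ops X n) _) (m≤n+m _ 1))) le) n≤H))
    popped-correct r X P Q p {n} {v} {τ} {h} {H} (false ∷ w) e R B le n≤H rewrite ops-pp r X P Q n =
      ⊩-within (+-mono-≤ (U-mono (len-pop B e (ℕₚ.m+n≤o⇒m≤o h le)))
          (*-mono-≤ (≤-trans (m≤m+n (ops P n) _) (m≤n+m _ (ops X n))) (≤-refl {U H})))
        (⊩-pop-∷ {c = usr r} false w e (⊩-ext (λ c → sym (store-pop {n} {v} {τ} r w c)) (λ _ → refl)
          (code-correct P _ (Ready-mono (≤-trans (ℕₚ.m≤m⊔n (depth P) _) (ℕₚ.m≤n⊔m (depth X) _)) R)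
              (Bounded-pop {v = v} r B e)
            (≤-trans (+-monoʳ-≤ h (≤-trans (≤-trans (m≤m+n (ops P n) _) (m≤n+m _ (ops X n))) (m≤n+m _ 1))) le) n≤H)))
    popped-correct r X P Q p {n} {v} {τ} {h} {H} (true ∷ w) e R B le n≤H rewrite ops-pp r X P Q n =
      ⊩-within (+-mono-≤ (U-mono (len-pop B e (ℕₚ.m+n≤o⇒m≤o h le)))
          (*-mono-≤ (≤-trans (m≤n+m (ops Q n) _) (m≤n+m _ (ops X n))) (≤-refl {U H})))
        (⊩-pop-∷ {c = usr r} true w e (⊩-ext (λ c → sym (store-pop {n} {v} {τ} r w c)) (λ _ → refl)
          (code-correct Q _ (Ready-mono (≤-trans (ℕₚ.m≤n⊔m (depth P) _) (ℕₚ.m≤n⊔m (depth X) _)) R)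
              (Bounded-pop {v = v} r B e)
            (≤-trans (+-monoʳ-≤ h (≤-trans (≤-trans (m≤n+m (ops Q n) _) (m≤n+m _ (ops X n))) (m≤n+m _ 1))) le) n≤H)))

    len-pop : ∀ {v : Vec Str K} {h H r b w} → Bounded v h → lookup v r ≡ b ∷ w → h ≤ H → suc (length w) ≤ H
    len-pop {r = r} B e le = ≤-trans (≤-reflexive (cong length (sym e))) (≤-trans (height B r) le)

    loop-correct : ∀ P (p : depth P < D) {n v τ h H} i →
                   let d    = fromℕ< p
                       body = push (E d) true ▸ code P (ℕₚ.<⇒≤ p) in
                   i ≤ n → Ready n (depth P) τ → Bounded v h → h + i * ops P n ≤ H → n ≤ H →
                   while (N d) body body ⊩ store n v (τ ⟨ d ↦ i ⟩) ⇒[ suc (i * (2 + ops P n)) * U H ]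
                     store n (iter i (exec P n) v) (τ ⟨ d ↦ 0 ⟩)
    loop-correct P p {n} {v} {τ} {h} {H} zero i≤n R B le n≤H = ⊩-within (≤-trans (U-mono (z≤n {H})) (m≤m+n _ _))
      (⊩-while-[] {c = N (fromℕ< p)} (cong ones (↦-same τ (fromℕ< p) 0)))
    loop-correct P p {n} {v} {τ} {h} {H} (suc i) i≤n R B le n≤H = ⊩-within cost
      (⊩-while-∷ {c = N d} true (ones i) (cong ones (↦-same τ d (suc i)))
        (⊩-seq (⊩-ext (λ _ → refl) pushed (⊩-push (E d) true))
               (code-correct P _ R' B (≤-trans (+-monoʳ-≤ h (m≤m+n _ _)) le) n≤H))
        (loop-correct P p i (ℕₚ.<⇒≤ i≤n) R (exec-bounded P n B) (≤-trans (≤-reflexive (ℕₚ.+-assoc h _ _)) le) n≤H))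
      where
      d  = fromℕ< p
      τ₁ = τ ⟨ d ↦ suc i ⟩
      σ₁ = store n v τ₁ [ N d ≔ ones i ]
      E-val : σ₁ (E d) ≡ ones (n ∸ suc i)
      E-val = trans (≔-other (store n v τ₁) {N d} {E d} (ones i) (λ ())) (cong (λ m → ones (n ∸ m)) (↦-same τ d _))
      pushed : ∀ c → (σ₁ [ E d ≔ true ∷ σ₁ (E d) ]) c ≡ store n v (τ ⟨ d ↦ i ⟩) c
      pushed c = trans (store-count {n} {v} {τ₁} d i refl
          (trans (cong (true ∷_) E-val) (cong ones (sym (ℕₚ.+-∸-assoc 1 i≤n)))) c)
        (store-ext {n} {v} (↦-twice τ d (suc i) i) c)
      -- The body uses only levels strictly below d, and these are untouched by the change at d.
      R' : Ready n (depth P) (τ ⟨ d ↦ i ⟩)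
      R' e lt = trans (↦-other τ {d} {e} i (λ { refl → ℕₚ.<-irrefl (toℕ-fromℕ< p) lt })) (R e lt)
      cost : U (suc (length (ones i))) + (U (length (σ₁ (E d))) + ops P n * U H) + suc (i * (2 + ops P n)) * U H
             ≤ suc (suc i * (2 + ops P n)) * U H
      cost = ≤-trans (+-mono-≤ (+-mono-≤ (U-mono (≤-trans (≤-reflexive (cong suc (length-replicate i))) (≤-trans i≤n n≤H)))
                 (+-mono-≤ (U-mono (≤-trans (≤-reflexive (trans (cong length E-val) (length-replicate (n ∸ suc i))))
                     (≤-trans (ℕₚ.m∸n≤m n (suc i)) n≤H))) ≤-refl)) ≤-refl)
               (≤-reflexive (lem i (ops P n) (U H)))
        where
        lem : ∀ i o u → u + (u + o * u) + suc (i * (2 + o)) * u ≡ suc (suc i * (2 + o)) * u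
        lem = solve-∀

open Bounded

-- From a stack program to a complete program on a clean tape

loaded : ∀ {K} → Str → Vec Str (suc K)
loaded x = x ∷ Vec.replicate _ []

loaded-rest : ∀ {K} x (r : Fin K) → lookup (loaded x) (suc r) ≡ []
loaded-rest x r = lookup-replicate r []

result : ∀ {K} → Cmd (suc K) → Str → Str
result P x = lookup (exec P (length x) (loaded x)) zero

module Assemble {K' : ℕ} (P : Cmd (suc K')) where

  D : ℕ
  D = depth P

  open Compile (suc K') D

  pushN : ∀ m → m ≤ D → Code
  pushN zero    p = noop
  pushN (suc m) p = pushN m (ℕₚ.<⇒≤ p) ▸ push (N (fromℕ< p)) true

  bump : Store → ℕ → Store
  bump σ m nothing                = σ nothing
  bump σ m (just (inj₁ r))        = σ (usr r)
  bump σ m (just (inj₂ (inj₁ d))) = if does (toℕ d <? m) then true ∷ σ (N d) else σ (N d)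
  bump σ m (just (inj₂ (inj₂ d))) = σ (E d)

  bump-< : ∀ σ m d → toℕ d < m → bump σ m (N d) ≡ true ∷ σ (N d)
  bump-< σ m d lt rewrite dec-true (toℕ d <? m) lt = refl

  bump-≮ : ∀ σ m d → ¬ toℕ d < m → bump σ m (N d) ≡ σ (N d)
  bump-≮ σ m d nlt rewrite dec-false (toℕ d <? m) nlt = refl

  bump-suc : ∀ σ m (p : m < D) c →
             (bump σ m [ N (fromℕ< p) ≔ true ∷ bump σ m (N (fromℕ< p)) ]) c ≡ bump σ (suc m) c
  bump-suc σ m p c with c ≟I N (fromℕ< p)
  ... | yes refl = trans (cong (true ∷_) (bump-≮ σ m d (λ lt → ℕₚ.<-irrefl (toℕ-fromℕ< p) lt)))
                         (sym (bump-< σ (suc m) d (s≤s (≤-reflexive (toℕ-fromℕ< p)))))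
    where d = fromℕ< p
  bump-suc σ m p nothing         | no ne = refl
  bump-suc σ m p (just (inj₁ r)) | no ne = refl
  bump-suc σ m p (just (inj₂ (inj₂ d))) | no ne = refl
  bump-suc σ m p (just (inj₂ (inj₁ d))) | no ne with toℕ d <? m
  ... | yes lt = trans (bump-< σ m d lt) (sym (bump-< σ (suc m) d (ℕₚ.<-trans lt ≤-refl)))
  ... | no nlt = trans (bump-≮ σ m d nlt) (sym (bump-≮ σ (suc m) d (λ lt → nlt (ℕₚ.≤∧≢⇒< (ℕₚ.≤-pred lt)
                   (λ e → ne (cong (just ∘ inj₂ ∘ inj₁) (toℕ-injective (trans e (sym (toℕ-fromℕ< p))))))))))

  pushN-ok : ∀ {H} m p σ → (∀ d → length (σ (N d)) ≤ H) → pushN m p ⊩ σ ⇒[ suc m * U H ] bump σ m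
  pushN-ok {H} zero p σ h = ⊩-within (≤-trans (1≤U H) (m≤m+n _ _)) (⊩-ext (λ _ → refl) same ⊩-noop)
    where
    same : ∀ c → σ c ≡ bump σ 0 c
    same nothing                = refl
    same (just (inj₁ r))        = refl
    same (just (inj₂ (inj₁ d))) = sym (bump-≮ σ 0 d (λ ()))
    same (just (inj₂ (inj₂ d))) = refl
  pushN-ok {H} (suc m) p σ h = ⊩-within
    (≤-trans (+-mono-≤ (≤-refl {suc m * U H}) (U-mono len)) (≤-reflexive (ℕₚ.+-comm (suc m * U H) (U H))))
    (⊩-seq (pushN-ok m (ℕₚ.<⇒≤ p) σ h) (⊩-ext (λ _ → refl) (bump-suc σ m p) (⊩-push (N d) true)))
    where
    d = fromℕ< p
    len : length (bump σ m (N d)) ≤ H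
    len = subst (λ w → length w ≤ H) (sym (bump-≮ σ m d (λ lt → ℕₚ.<-irrefl (toℕ-fromℕ< p) lt))) (h d)

  -- While the input is being read: y is unread (last symbol first) and the m symbols read so far form w.
  init : Str → Str → ℕ → Store
  init y w m nothing                = y
  init y w m (just (inj₁ r))        = lookup (loaded {K'} w) r
  init y w m (just (inj₂ (inj₁ d))) = ones m
  init y w m (just (inj₂ (inj₂ d))) = []

  -- Besides moving one symbol it adds one to every counter `N d`, so that after the whole input
  -- each loop counter holds the input length. The input comes off its stack last symbol first,
  -- which leaves the first symbol on top of stack `zero`.
  load : Bool → Code
  load b = push (usr zero) b ▸ pushN D ≤-refl

  prologue : Code
  prologue = while nothing (load false) (load true)

  load-ok : ∀ {H} b y w m → length w ≤ H → m ≤ H →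
            load b ⊩ (init (b ∷ y) w m [ nothing ≔ y ]) ⇒[ (2 + D) * U H ] init y (b ∷ w) (suc m)
  load-ok {H} b y w m w≤ m≤ = ⊩-within (+-mono-≤ (U-mono w≤) ≤-refl)
    (⊩-ext (λ c → sym (unread c)) (λ _ → refl)
      (⊩-seq (⊩-ext (λ _ → refl) pushed (⊩-push (usr zero) b))
             (⊩-ext (λ _ → refl) counted (pushN-ok D ≤-refl (init y (b ∷ w) m)
                 (λ d → ≤-trans (≤-reflexive (length-replicate m)) m≤)))))
    where
    unread : ∀ c → (init (b ∷ y) w m [ nothing ≔ y ]) c ≡ init y w m c
    unread nothing                = refl
    unread (just (inj₁ r))        = refl
    unread (just (inj₂ (inj₁ d))) = refl
    unread (just (inj₂ (inj₂ d))) = refl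
    pushed : ∀ c → (init y w m [ usr zero ≔ b ∷ w ]) c ≡ init y (b ∷ w) m c
    pushed c with c ≟I usr zero
    ... | yes refl = refl
    pushed nothing                | no ne = refl
    pushed (just (inj₁ zero))     | no ne = contradiction refl ne
    pushed (just (inj₁ (suc r)))  | no ne = refl
    pushed (just (inj₂ (inj₁ d))) | no ne = refl
    pushed (just (inj₂ (inj₂ d))) | no ne = refl
    counted : ∀ c → bump (init y (b ∷ w) m) D c ≡ init y (b ∷ w) (suc m) c
    counted nothing                = refl
    counted (just (inj₁ r))        = refl
    counted (just (inj₂ (inj₁ d))) = bump-< (init y (b ∷ w) m) D d (toℕ<n d)
    counted (just (inj₂ (inj₂ d))) = refl

  if-load : ∀ {σ σ' B} b → load b ⊩ σ ⇒[ B ] σ' → (if b then load true else load false) ⊩ σ ⇒[ B ] σ'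
  if-load false p = p
  if-load true  p = p

  prologue-ok : ∀ {H} y w m → length y + length w ≤ H → length y + m ≤ H →
                prologue ⊩ init y w m ⇒[ suc (length y * (3 + D)) * U H ] init [] (y ʳ++ w) (length y + m)
  prologue-ok {H} [] w m _ _ = ⊩-within (≤-trans (U-mono (z≤n {H})) (m≤m+n _ _)) (⊩-while-[] {c = nothing} refl)
  prologue-ok {H} (b ∷ y) w m h₁ h₂ = ⊩-within
    (≤-trans (+-mono-≤ (+-mono-≤ (U-mono {suc (length y)} (≤-trans (m≤m+n _ _) h₁)) ≤-refl) ≤-refl)
        (≤-reflexive (lem (length y) D (U H))))
    (⊩-while-∷ {c = nothing} b y refl
      (if-load b (load-ok {H} b y w m (≤-trans (m≤n+m _ _) h₁) (≤-trans (m≤n+m _ _) h₂)))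
      (⊩-ext (λ _ → refl) (λ c → cong (λ i → init [] (y ʳ++ (b ∷ w)) i c) (ℕₚ.+-suc (length y) m))
        (prologue-ok y (b ∷ w) (suc m) (≤-trans (≤-reflexive (ℕₚ.+-suc _ _)) h₁)
            (≤-trans (≤-reflexive (ℕₚ.+-suc _ _)) h₂))))
    where
    lem : ∀ l d u → u + (2 + d) * u + suc (l * (3 + d)) * u ≡ suc (suc l * (3 + d)) * u
    lem = solve-∀

  unload : Code
  unload = while (usr zero) (push nothing false) (push nothing true)

  -- Of the left-hand stacks only the lengths are recorded: `clears` empties them whatever they
  -- contain, but its cost depends on their heights.
  unload-ok : ∀ {H} w y σ → σ (usr zero) ≡ w → σ nothing ≡ y → length w + length y ≤ H →
              Σ[ σ' ∈ Store ] (unload ⊩ σ ⇒[ suc (length w * 2) * U H ] σ' × σ' nothing ≡ w ʳ++ y ×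
                (∀ a → length (σ' (just a)) ≤ length (σ (just a))))
  unload-ok {H} [] y σ ew ey le = σ , ⊩-within (≤-trans (U-mono (z≤n {H})) (m≤m+n _ _)) (⊩-while-[] {c = usr zero} ew) ,
      ey , (λ a → ≤-refl)
  unload-ok {H} (b ∷ w) y σ ew ey le
    = let σ' , r , e , l = unload-ok {H} w (b ∷ y) σ₂ ew₂ ey₂ (≤-trans (≤-reflexive (ℕₚ.+-suc _ _)) le) in
      σ' , ⊩-within cost (⊩-while-∷ {c = usr zero} b w ew (if-push b (⊩-push nothing b)) r) , e ,
          (λ a → ≤-trans (l a) (shrink a))
    where
    σ₁ = σ [ usr zero ≔ w ]
    σ₂ = σ₁ [ nothing ≔ b ∷ σ₁ nothing ]
    if-push : ∀ {σ σ' B} b → push nothing b ⊩ σ ⇒[ B ] σ' →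
        (if b then push nothing true else push nothing false) ⊩ σ ⇒[ B ] σ'
    if-push false p = p
    if-push true  p = p
    ew₂ : σ₂ (usr zero) ≡ w
    ew₂ = ≔-same σ (usr zero) w
    ey₂ : σ₂ nothing ≡ b ∷ y
    ey₂ = cong (b ∷_) ey
    shrink : ∀ a → length (σ₂ (just a)) ≤ length (σ (just a))
    shrink a = ≔-elim (λ v → length v ≤ length (σ (just a))) σ {usr zero} w (just a)
      (λ { refl → ≤-trans (ℕₚ.n≤1+n _) (≤-reflexive (cong length (sym ew))) }) (λ _ → ≤-refl)
    cost : U (suc (length w)) + U (length (σ nothing)) + suc (length w * 2) * U H ≤ suc (suc (length w) * 2) * U H
    cost rewrite ey = ≤-trans (+-mono-≤ (+-mono-≤ (U-mono {suc (length w)} (≤-trans (m≤m+n _ _) le))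
        (U-mono {length y} (≤-trans (m≤n+m (length y) (suc (length w))) le))) ≤-refl)
      (≤-reflexive (lem (length w) (U H)))
      where
      lem : ∀ l u → u + u + suc (l * 2) * u ≡ suc (suc l * 2) * u
      lem = solve-∀

  clear : J → Code
  clear a = while (just a) noop noop

  clear-ok : ∀ {H} w a σ → σ (just a) ≡ w → length w ≤ H →
             clear a ⊩ σ ⇒[ suc (length w * 2) * U H ] (σ [ just a ≔ [] ])
  clear-ok {H} [] a σ e le = ⊩-within (≤-trans (U-mono (z≤n {H})) (m≤m+n _ _))
      (⊩-ext (λ _ → refl) same (⊩-while-[] {c = just a} e))
    where
    same : ∀ c → σ c ≡ (σ [ just a ≔ [] ]) c
    same c with c ≟I just a
    ... | yes refl = e
    ... | no _     = refl
  clear-ok {H} (b ∷ w) a σ e le = ⊩-within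
    (≤-trans (+-mono-≤ (+-mono-≤ (U-mono {suc (length w)} le) (1≤U H)) ≤-refl) (≤-reflexive (lem (length w) (U H))))
    (⊩-while-∷ {c = just a} b w e (if-noop b)
      (⊩-ext (λ _ → refl) twice (clear-ok {H} w a (σ [ just a ≔ w ]) (≔-same σ (just a) w) (≤-trans (ℕₚ.n≤1+n _) le))))
    where
    if-noop : ∀ {σ} b → (if b then noop else noop) ⊩ σ ⇒[ 1 ] σ
    if-noop false = ⊩-noop
    if-noop true  = ⊩-noop
    twice : ∀ c → (σ [ just a ≔ w ] [ just a ≔ [] ]) c ≡ (σ [ just a ≔ [] ]) c
    twice c with c ≟I just a
    ... | yes _ = refl
    ... | no _  = refl
    lem : ∀ l u → u + u + suc (l * 2) * u ≡ suc (suc l * 2) * u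
    lem = solve-∀

  clears : List J → Code
  clears []       = noop
  clears (a ∷ as) = clear a ▸ clears as

  -- That empty stacks stay empty is what carries the induction: a stack cleared early has to
  -- survive the clearing of the others.
  clears-ok : ∀ {H} as σ → (∀ a → length (σ (just a)) ≤ H) →
              Σ[ σ' ∈ Store ] (clears as ⊩ σ ⇒[ suc (length as * suc (H * 2)) * U H ] σ' × σ' nothing ≡ σ nothing ×
                (∀ a → σ (just a) ≡ [] → σ' (just a) ≡ []) × (∀ a → a ∈ as → σ' (just a) ≡ []))
  clears-ok {H} [] σ h = σ , ⊩-within (≤-trans (1≤U H) (m≤m+n _ _)) ⊩-noop , refl , (λ a e → e) , (λ a ())
  clears-ok {H} (a ∷ as) σ h
    = let σ' , r , e , keep , em = clears-ok {H} as (σ [ just a ≔ [] ]) shrunk in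
      σ' , ⊩-within cost (⊩-seq (clear-ok {H} (σ (just a)) a σ refl (h a)) r) , e , (λ a' e' → keep a' (still a' e')) ,
          gone {σ'} keep em
    where
    shrunk : ∀ a' → length ((σ [ just a ≔ [] ]) (just a')) ≤ H
    shrunk a' = ≔-elim (λ v → length v ≤ H) σ {just a} [] (just a') (λ _ → z≤n) (λ _ → h a')
    still : ∀ a' → σ (just a') ≡ [] → (σ [ just a ≔ [] ]) (just a') ≡ []
    still a' e' = ≔-elim (λ v → v ≡ []) σ {just a} [] (just a') (λ _ → refl) (λ _ → e')
    gone : ∀ {σ' : Store} → (∀ a' → (σ [ just a ≔ [] ]) (just a') ≡ [] → σ' (just a') ≡ []) →
           (∀ a' → a' ∈ as → σ' (just a') ≡ []) → ∀ a' → a' ∈ a ∷ as → σ' (just a') ≡ []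
    gone keep em a' (here refl) = keep a' (≔-same σ (just a) [])
    gone keep em a' (there i)   = em a' i
    cost : suc (length (σ (just a)) * 2) * U H + suc (length as * suc (H * 2)) * U H
           ≤ suc (suc (length as) * suc (H * 2)) * U H
    cost = ≤-trans (+-mono-≤ (*-mono-≤ (s≤s (*-mono-≤ (h a) (≤-refl {2}))) (≤-refl {U H})) ≤-refl)
      (≤-reflexive (lem (length as) H (U H)))
      where
      lem : ∀ l h u → suc (h * 2) * u + suc (l * suc (h * 2)) * u ≡ suc (suc l * suc (h * 2)) * u
      lem = solve-∀

  everything : List J
  everything = map ψ (allFin k)

  body : Code
  body = prologue ▸ code P ≤-refl ▸ unload ▸ clears everything

  -- The stack code starts and ends at the origin, a program of `SFP` one cell further right, on the
  -- first symbol.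
  whole : Code
  whole = mv mvL ▸ body ▸ mv mvR

  heightP unitP countP timeP twiceP : Poly
  heightP = padd pid (opsP P)
  unitP   = pscale (suc W) (padd (pconst 6) (pscale 2 heightP))
  twiceP  = padd (pconst 1) (pscale 2 heightP)
  -- Per input symbol the prologue uses one pop, one push and 1 + D for the counters, which gives 3
  -- + D. The summand 3 is the final `noop` of `clears` and the two outer moves, each rounded up to
  -- `U H`.
  countP  = padd (1 ∷ (3 + D) ∷ []) (padd (opsP P) (padd twiceP (padd (pconst 3) (pscale k twiceP))))
  timeP   = pmul countP unitP

  height-val : ∀ n → eval heightP n ≡ n + ops P n
  height-val n = trans (eval-add pid (opsP P) n) (cong (_+ ops P n) (eval-id n))

  twice-val : ∀ n → eval twiceP n ≡ suc ((n + ops P n) * 2)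
  twice-val n rewrite eval-add (pconst 1) (pscale 2 heightP) n | eval-scale 2 heightP n | height-val n | ℕₚ.*-zeroʳ n
    = cong suc (ℕₚ.*-comm 2 (n + ops P n))

  unit-val : ∀ n → eval unitP n ≡ U (n + ops P n)
  unit-val n rewrite eval-scale (suc W) (padd (pconst 6) (pscale 2 heightP)) n | eval-add (pconst 6) (pscale 2 heightP) n
    | eval-scale 2 heightP n | height-val n | ℕₚ.*-zeroʳ n = ℕₚ.*-comm (suc W) (6 + 2 * (n + ops P n))

  count : ℕ → ℕ
  count n = suc (n * (3 + D)) + (ops P n + (suc ((n + ops P n) * 2) + (3 + k * suc ((n + ops P n) * 2))))

  count-val : ∀ n → eval countP n ≡ count n
  count-val n rewrite eval-add (1 ∷ (3 + D) ∷ []) (padd (opsP P) (padd twiceP (padd (pconst 3) (pscale k twiceP)))) n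
    | eval-add (opsP P) (padd twiceP (padd (pconst 3) (pscale k twiceP))) n
    | eval-add twiceP (padd (pconst 3) (pscale k twiceP)) n
    | eval-add (pconst 3) (pscale k twiceP) n | eval-scale k twiceP n | twice-val n | ℕₚ.*-zeroʳ n | ℕₚ.+-identityʳ D = refl

  time-val : ∀ n → eval timeP n ≡ count n * U (n + ops P n)
  time-val n = trans (eval-mul countP unitP n) (cong₂ _*_ (count-val n) (unit-val n))

  loaded-bounded : ∀ x → Bounded (loaded {K'} x) (length x)
  loaded-bounded x = bounded b
    where
    b : ∀ r → length (lookup (loaded x) r) ≤ length x
    b zero    = ≤-refl
    b (suc r) rewrite loaded-rest x r = z≤n

  final-bounded : ∀ x → Bounded (exec P (length x) (loaded x)) (length x + ops P (length x))
  final-bounded x = exec-bounded P (length x) (loaded-bounded x)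

  body-ok : ∀ x → let n = length x ; H = n + ops P n in
            Σ[ σ ∈ Store ] (body ⊩ init (reverse x) [] 0
                ⇒[ suc (n * (3 + D)) * U H + (ops P n * U H + (suc (H * 2) * U H + suc (k * suc (H * 2)) * U H)) ] σ
              × σ nothing ≡ reverse (result P x) × (∀ a → σ (just a) ≡ []))
  body-ok x
    = let
      σ₁ , r₁ , e₁ , l₁ = unload-ok {H} (result P x) [] (store n (exec P n (loaded x)) (λ _ → n)) refl refl
                               (≤-trans (≤-reflexive (ℕₚ.+-identityʳ _)) (height (final-bounded x) zero))
      σ₂ , r₂ , e₂ , _ , em = clears-ok {H} everything σ₁ (λ a → ≤-trans (l₁ a) (heights a))
      in σ₂ , ⊩-seq before (⊩-seq during (⊩-seq (⊩-within
            (*-mono-≤ (s≤s (*-mono-≤ (height (final-bounded x) zero) (≤-refl {2}))) (≤-refl {U H})) r₁)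
        (⊩-within (≤-reflexive (cong (λ l → suc (l * suc (H * 2)) * U H)
            (trans (length-map ψ (allFin k)) (length-tabulate {n = k} (λ i → i))))) r₂))) ,
      trans e₂ e₁ , (λ a → em a (subst (_∈ everything) (ψφ a) (∈-map⁺ ψ (∈-allFin (φ a)))))
    where
    n = length x
    H = n + ops P n
    heights : ∀ a → length (store n (exec P n (loaded x)) (λ _ → n) (just a)) ≤ H
    heights (inj₁ r)        = height (final-bounded x) r
    heights (inj₂ (inj₁ d)) = ≤-trans (≤-reflexive (length-replicate n)) (m≤m+n _ _)
    heights (inj₂ (inj₂ d)) rewrite ℕₚ.n∸n≡0 n = z≤n
    len : length (reverse x) ≡ n
    len = length-reverse x
    ready : ∀ c → init [] (reverse x ʳ++ []) (length (reverse x) + 0) c ≡ store n (loaded x) (λ _ → n) c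
    ready nothing                = refl
    ready (just (inj₁ r))        = cong (λ w → lookup (loaded w) r) (reverse-involutive x)
    ready (just (inj₂ (inj₁ d))) = cong ones (trans (ℕₚ.+-identityʳ _) len)
    ready (just (inj₂ (inj₂ d))) = cong ones (sym (ℕₚ.n∸n≡0 n))
    before : prologue ⊩ init (reverse x) [] 0 ⇒[ suc (n * (3 + D)) * U H ] store n (loaded x) (λ _ → n)
    before = ⊩-within (≤-reflexive (cong (λ l → suc (l * (3 + D)) * U H) len)) (⊩-ext (λ _ → refl) ready
      (prologue-ok {H} (reverse x) [] 0 le le))
      where
      le : length (reverse x) + 0 ≤ H
      le = ≤-trans (≤-reflexive (trans (ℕₚ.+-identityʳ _) len)) (m≤m+n _ _)
    during : code P ≤-refl ⊩ store n (loaded x) (λ _ → n) ⇒[ ops P n * U H ] store n (exec P n (loaded x)) (λ _ → n)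
    during = code-correct P ≤-refl (λ _ _ → refl) (loaded-bounded x) ≤-refl (m≤m+n _ _)

  total : ∀ n o h k u d → 1 ≤ u →
    1 + ((suc (n * (3 + d)) * u + (o * u + (suc (h * 2) * u + suc (k * suc (h * 2)) * u))) + 1)
      ≤ (suc (n * (3 + d)) + (o + (suc (h * 2) + (3 + k * suc (h * 2))))) * u
  total n o h k u d 1≤u = ≤-trans (+-mono-≤ 1≤u (+-monoʳ-≤ _ 1≤u))
      (≤-reflexive (lem (suc (n * (3 + d))) o (suc (h * 2)) (k * suc (h * 2)) u))
    where
    lem : ∀ a o b c u → u + ((a * u + (o * u + (b * u + suc c * u))) + u) ≡ (a + (o + (b + (3 + c)))) * u
    lem = solve-∀

  stage : SFP (result P)
  stage = sfp whole timeP short runs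
    where
    short : ∀ x → length (result P x) ≤ eval timeP (length x)
    short x rewrite time-val (length x) = ≤-trans (height (final-bounded x) zero) (≤-trans (≤-trans
      (≤-trans (ℕₚ.m≤m*n H 2) (ℕₚ.n≤1+n _)) (≤-trans (m≤m+n _ _)
          (≤-trans (m≤n+m _ (ops P (length x))) (m≤n+m _ (suc (length x * (3 + D)))))))
      (≤-trans (≤-reflexive (sym (ℕₚ.*-identityʳ (count (length x))))) (*-mono-≤ (≤-refl {count (length x)}) (1≤U H))))
      where H = length x + ops P (length x)
    runs : ∀ x g → Clean x g → Σ[ g' ∈ Content ]
           (whole ∶ (g , + 1) ↝[ eval timeP (length x) ] (g' , + 1) × Clean (result P x) g')
    runs x g (clean pos neg)
      = let
        σ , r , eio , em = body-ok x
        g' , r' , R' = r g (represents rep-init)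
        in g' , within (≤-trans (total n (ops P n) (n + ops P n) k (U (n + ops P n)) D (1≤U (n + ops P n)))
              (≤-reflexive (sym (time-val n))))
          ((1 , ≤-refl , r-mv) then r' then (1 , ≤-refl , r-mv)) ,
        clean (λ j → trans (cells R' nothing j) (cong (λ w → cell w j) eio)) (blanks R' em)
      where
      n = length x
      rep-init : ∀ c j → g (addr c j) ≡ cell (init (reverse x) [] 0 c) j
      rep-init nothing                j = pos j
      rep-init (just (inj₁ zero))     j = neg _
      rep-init (just (inj₁ (suc s)))  j rewrite loaded-rest [] s = neg _
      rep-init (just (inj₂ (inj₁ d))) j = neg _
      rep-init (just (inj₂ (inj₂ d))) j = neg _
      blanks : ∀ {σ : Store} {g'} → Rep σ g' → (∀ a → σ (just a) ≡ []) → ∀ m → g' -[1+ m ] ≡ blank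
      blanks {g' = g'} R' em m with a , j , e ← addr-surjective m =
        trans (cong g' (sym e)) (trans (cells R' (just a) j) (cong (λ w → cell w j) (em a)))

-- Composition of clean programs, and their Turing machines

open Assemble using (stage)

SFP-ext : ∀ {f g} → (∀ x → f x ≡ g x) → SFP f → SFP g
SFP-ext e (sfp P p sh r) = sfp P p
  (λ x → subst (λ w → length w ≤ eval p (length x)) (e x) (sh x))
  (λ x g c → let g' , s , c' = r x g c in g' , s , subst (λ w → Clean w g') (e x) c')

infixr 9 _∘ₛ_

_∘ₛ_ : ∀ {f g} → SFP g → SFP f → SFP (λ x → g (f x))
_∘ₛ_ {f} {g} (sfp Q q shq rq) (sfp P p shp rp) = sfp (P ▸ Q) time short runs
  where
  time = padd p (pcomp q p)
  val : ∀ n → eval time n ≡ eval p n + eval q (eval p n)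
  val n = trans (eval-add p (pcomp q p) n) (cong (_+_ (eval p n)) (eval-comp q p n))
  short : ∀ x → length (g (f x)) ≤ eval time (length x)
  short x rewrite val (length x) = ≤-trans (shq (f x)) (≤-trans (eval-mono q (shp x)) (m≤n+m _ _))
  runs : ∀ x c → Clean x c → Σ[ c' ∈ Content ] (P ▸ Q ∶ (c , + 1) ↝[ eval time (length x) ] (c' , + 1) × Clean (g (f x)) c')
  runs x c cl =
    let c₁ , r₁ , cl₁ = rp x c cl
        c₂ , r₂ , cl₂ = rq (f x) c₁ cl₁
    in c₂ , within (≤-trans (+-monoʳ-≤ (eval p (length x)) (eval-mono q (shp x))) (≤-reflexive (sym (val (length x)))))
          (r₁ then r₂) , cl₂

cell-low : ∀ x w {j} → j ≤ length w → cell (x ʳ++ w) j ≡ cell w j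
cell-low []      w le = refl
cell-low (b ∷ x) w le = trans (cell-low x (b ∷ w) (≤-trans le (ℕₚ.n≤1+n _)))
  (cell-below b w (λ e → ℕₚ.<-irrefl e (s≤s le)))

cell-high : ∀ x w j → cell (x ʳ++ w) (suc (length w + j)) ≡ nth (map bit x) j
cell-high []      w j       = cell-beyond w (s≤s (m≤m+n _ _))
cell-high (b ∷ x) w zero    rewrite ℕₚ.+-identityʳ (length w) = trans (cell-low x (b ∷ w) ≤-refl) (cell-top b w)
cell-high (b ∷ x) w (suc j) rewrite ℕₚ.+-suc (length w) j = cell-high x (b ∷ w) j

cell-reverse : ∀ x j → cell (reverse x) (suc j) ≡ nth (map bit x) j
cell-reverse x j = cell-high x [] j

initial : Str → Content
initial x (+ j)    = cell (reverse x) j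
initial x -[1+ _ ] = blank

initial-clean : ∀ x → Clean x (initial x)
initial-clean x = clean (λ j → refl) (λ m → refl)

itR-pos : ∀ j i → itR j (+ i) ≡ + (j + i)
itR-pos zero    i = refl
itR-pos (suc j) i = trans (itR-pos j (suc i)) (cong +_ (ℕₚ.+-suc j i))

clean-left : ∀ {x g} → Clean x g → ∀ j → g (itL j (+ 0)) ≡ blank
clean-left {x} (clean pos neg) zero    = trans (pos 0) (cell-base (reverse x))
clean-left {x} {g} (clean pos neg) (suc j) = trans (cong g (itL-neg j 0)) (neg _)

clean-right : ∀ {x g} → Clean x g → ∀ j → g (itR j (+ 1)) ≡ nth (map bit x) j
clean-right {x} {g} (clean pos neg) j = trans (cong g (trans (itR-pos j 1) (cong +_ (ℕₚ.+-comm j 1))))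
  (trans (pos (suc j)) (cell-reverse x j))

initTape-at : ∀ x {g} → Clean x g → At (initTape x) g (+ 1)
initTape-at []      c = at (sym (clean-right c 0)) (λ j → sym (clean-left c j)) (λ j → sym (clean-right c (suc j)))
initTape-at (b ∷ x) c = at (sym (clean-right c 0)) (λ j → sym (clean-left c j)) (λ j → sym (clean-right c (suc j)))

readSyms-nth : ∀ ss y → (∀ j → nth ss j ≡ nth (map bit y) j) → readSyms ss ≡ y
readSyms-nth []           []          e = refl
readSyms-nth []           (false ∷ y) e with () ← e 0
readSyms-nth []           (true ∷ y)  e with () ← e 0
readSyms-nth (blank ∷ ss) []          e = refl
readSyms-nth (b0 ∷ ss)    []          e with () ← e 0
readSyms-nth (b1 ∷ ss)    []          e with () ← e 0
readSyms-nth (b0 ∷ ss)    (false ∷ y) e = cong (false ∷_) (readSyms-nth ss y (λ j → e (suc j)))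
readSyms-nth (b1 ∷ ss)    (true ∷ y)  e = cong (true ∷_) (readSyms-nth ss y (λ j → e (suc j)))
readSyms-nth (b0 ∷ ss)    (true ∷ y)  e with () ← e 0
readSyms-nth (b1 ∷ ss)    (false ∷ y) e with () ← e 0
readSyms-nth (blank ∷ ss) (false ∷ y) e with () ← e 0
readSyms-nth (blank ∷ ss) (true ∷ y)  e with () ← e 0

readOut-clean : ∀ {y g t} → Clean y g → At t g (+ 1) → readOut t ≡ y
readOut-clean {y} {g} {t} c a = readSyms-nth (Tape.head t ∷ Tape.right t) y e
  where
  e : ∀ j → nth (Tape.head t ∷ Tape.right t) j ≡ nth (map bit y) j
  e zero    = trans (At.hd a) (clean-right c 0)
  e (suc j) = trans (At.rt a j) (clean-right c (suc j))

machine : Code → DTM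
machine P = record { Q = suc (size P) ; start = suc (toF P (ent P)) ; halting = halts ; δ = δ }
  where
  halts : Fin (suc (size P)) → Bool
  halts zero    = true
  halts (suc _) = false
  δ : Fin (suc (size P)) → Sym → Fin (suc (size P)) × Sym × Move
  δ zero    h = zero , h , mvS
  δ (suc i) h = let n , s , m = tr P (fromF P i) h in maybe (suc ∘ toF P) zero n , s , m

module Deterministic (P : Code) where
  open Host (λ c d → dstep (machine P) c ≡ d) public

  hosts : Hosts P (suc ∘ toF P) zero
  hosts s t rewrite fromF-toF P s = refl

  star-drun : ∀ {n c d} → Star n c d → drun (machine P) n c ≡ d
  star-drun stop = refl
  star-drun (step {n} e s) = trans (cong (drun (machine P) n) e) (star-drun s)

SFP⇒InFP : ∀ {f} → SFP f → InFP f
SFP⇒InFP {f} (sfp P p short runs) = machine P , p , computes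
  where
  open Deterministic P
  computes : Computes (machine P) f p
  computes x =
    let g' , (n , n≤ , r) , c' = runs x (initial x) (initial-clean x)
        t' , s , a = sim r hosts (initTape-at x (initial-clean x))
        e = star-drun s
    in n , n≤ , subst (λ c → DTM.halting (machine P) (proj₁ c) ≡ true) (sym e) refl ,
       trans (cong (readOut ∘ proj₂) e) (readOut-clean c' a)

-- Polynomial clocks

iter-+ : ∀ {A : Set} m n (f : A → A) x → iter (m + n) f x ≡ iter n f (iter m f x)
iter-+ zero    n f x = refl
iter-+ (suc m) n f x = iter-+ m n f (f x)

iter-* : ∀ {A : Set} m n (f : A → A) x → iter (m * n) f x ≡ iter m (iter n f) x
iter-* zero    n f x = refl
iter-* (suc m) n f x = trans (iter-+ n (m * n) f x) (iter-* m n f (iter n f x))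

iter-cong : ∀ {A : Set} m {f g : A → A} → (∀ x → f x ≡ g x) → ∀ x → iter m f x ≡ iter m g x
iter-cong zero    e x = refl
iter-cong (suc m) {f} e x = trans (cong (iter m f) (e x)) (iter-cong m e _)

repeat : ∀ {K} → ℕ → Cmd K → Cmd K
repeat zero    P = skip
repeat (suc c) P = P ⨟ repeat c P

exec-repeat : ∀ {K} c (P : Cmd K) n v → exec (repeat c P) n v ≡ iter c (exec P n) v
exec-repeat zero    P n v = refl
exec-repeat (suc c) P n v = exec-repeat c P n (exec P n v)

-- Horner's scheme, matching the recursion of `eval`: every further coefficient sits inside one more
-- loop.
clock : ∀ {K} → Poly → Cmd K → Cmd K
clock []      P = skip
clock (c ∷ p) P = repeat c P ⨟ loop (clock p P)

exec-clock : ∀ {K} p (P : Cmd K) n v → exec (clock p P) n v ≡ iter (eval p n) (exec P n) v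
exec-clock []      P n v = refl
exec-clock (c ∷ p) P n v = begin
  iter n (exec (clock p P) n) (exec (repeat c P) n v)
    ≡⟨ cong (iter n (exec (clock p P) n)) (exec-repeat c P n v) ⟩
  iter n (exec (clock p P) n) (iter c (exec P n) v)
    ≡⟨ iter-cong n (exec-clock p P n) _ ⟩
  iter n (iter (eval p n) (exec P n)) (iter c (exec P n) v)
    ≡⟨ sym (iter-* n (eval p n) (exec P n) _) ⟩
  iter (n * eval p n) (exec P n) (iter c (exec P n) v)
    ≡⟨ sym (iter-+ c (n * eval p n) (exec P n) v) ⟩
  iter (c + n * eval p n) (exec P n) v ∎
  where open ≡-Reasoning

-- A loop cannot stop early, so the body must do nothing once the stack is exhausted; the number of
-- turns then only has to be at least the length of the stack.
drain : ∀ {A S : Set} {F : S → S} (R : A → Str → S) (f : A → Bool → A) →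
        (∀ s → F (R s []) ≡ R s []) → (∀ s b w → F (R s (b ∷ w)) ≡ R (f s b) w) →
        ∀ m s w → length w ≤ m → iter m F (R s w) ≡ R (foldl f s w) []
drain R f e₀ e₁ zero    s []      le = refl
drain {F = F} R f e₀ e₁ (suc m) s [] le = trans (cong (iter m F) (e₀ s)) (drain R f e₀ e₁ m s [] z≤n)
drain {F = F} R f e₀ e₁ (suc m) s (b ∷ w) (s≤s le) =
  trans (cong (iter m F) (e₁ s b w)) (drain R f e₀ e₁ m (f s b) w le)

-- Programs with eight registers

-- rV holds the input and finally the output; rL, rR, rQ and rC hold the tape, state and driving bits of a simulated
-- machine, and rF is a flag.

pattern rV = zero
pattern rX = suc zero
pattern rY = suc (suc zero)
pattern rQ = suc (suc (suc zero))
pattern rL = suc (suc (suc (suc zero)))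
pattern rR = suc (suc (suc (suc (suc zero))))
pattern rC = suc (suc (suc (suc (suc (suc zero)))))
pattern rF = suc (suc (suc (suc (suc (suc (suc zero))))))

Regs : Set
Regs = Vec Str 8

Prog : Set
Prog = Cmd 8

infixr 4 _next_
infix 3 _⟨_⟩_⟶_

record _⟨_⟩_⟶_ (P : Prog) (n : ℕ) (s s' : Regs) : Set where
  constructor execs
  field
    exec≡ : exec P n s ≡ s'
open _⟨_⟩_⟶_

_next_ : ∀ {P Q n s s' s''} → P ⟨ n ⟩ s ⟶ s' → Q ⟨ n ⟩ s' ⟶ s'' → P ⨟ Q ⟨ n ⟩ s ⟶ s''
_next_ {Q = Q} {n} (execs e₁) (execs e₂) = execs (trans (cong (exec Q n) e₁) e₂)

stage-is : ∀ {f} (P : Prog) → (∀ x → Σ[ s ∈ Vec Str 7 ] (P ⟨ length x ⟩ loaded x ⟶ f x ∷ s)) → SFP f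
stage-is P r = SFP-ext (λ x → cong Data.Vec.head (trans (headed (exec P (length x) (loaded x))) (exec≡ (proj₂ (r x)))))
    (stage P)
  where
  headed : ∀ (u : Regs) → Data.Vec.lookup u zero ∷ Data.Vec.tail u ≡ u
  headed (_ ∷ _) = refl

-- Pairing

-- Arbitrary values on strings that are not pairs.
split : Str → Str → Str × Str
split a (false ∷ false ∷ z) = split (false ∷ a) z
split a (true ∷ true ∷ z)   = split (true ∷ a) z
split a (false ∷ true ∷ z)  = a , z
split a (true ∷ false ∷ z)  = a , z
split a (_ ∷ [])            = a , []
split a []                  = a , []

-- tsf is the first component reversed, as the programs leave it on a stack.
tsf fst snd : Str → Str
tsf z = proj₁ (split [] z)
fst z = reverse (tsf z)
snd z = proj₂ (split [] z)

split-pair : ∀ a x y → split a (pair x y) ≡ (x ʳ++ a , y)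
split-pair a []          y = refl
split-pair a (false ∷ x) y = split-pair (false ∷ a) x y
split-pair a (true ∷ x)  y = split-pair (true ∷ a) x y

fst-pair : ∀ x y → fst (pair x y) ≡ x
fst-pair x y = trans (cong (reverse ∘ proj₁) (split-pair [] x y)) (reverse-involutive x)

snd-pair : ∀ x y → snd (pair x y) ≡ y
snd-pair x y = cong proj₂ (split-pair [] x y)

split-short : ∀ a z → length (proj₁ (split a z)) + length (proj₂ (split a z)) ≤ length a + length z
split-short a (false ∷ false ∷ z) = ≤-trans (split-short (false ∷ a) z)
  (≤-trans (≤-reflexive (sym (ℕₚ.+-suc (length a) (length z)))) (+-monoʳ-≤ (length a) (ℕₚ.n≤1+n _)))
split-short a (true ∷ true ∷ z) = ≤-trans (split-short (true ∷ a) z)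
  (≤-trans (≤-reflexive (sym (ℕₚ.+-suc (length a) (length z)))) (+-monoʳ-≤ (length a) (ℕₚ.n≤1+n _)))
split-short a (false ∷ true ∷ z) = +-monoʳ-≤ (length a) (≤-trans (ℕₚ.n≤1+n _) (ℕₚ.n≤1+n _))
split-short a (true ∷ false ∷ z) = +-monoʳ-≤ (length a) (≤-trans (ℕₚ.n≤1+n _) (ℕₚ.n≤1+n _))
split-short a (false ∷ [])       = +-monoʳ-≤ (length a) z≤n
split-short a (true ∷ [])        = +-monoʳ-≤ (length a) z≤n
split-short a []                 = ≤-refl

tsf-short : ∀ z → length (tsf z) ≤ length z
tsf-short z = ≤-trans (m≤m+n _ _) (split-short [] z)

snd-short : ∀ z → length (snd z) ≤ length z
snd-short z = ≤-trans (m≤n+m _ _) (split-short [] z)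

-- As a loop cannot be left, the flag in `rF` records that the separator, or the end of a string
-- that is no pair, has been met; from then on the body merely takes the flag off and puts it back.
parse ubody unpack : Prog
parse  = pp rV (psh rF true)
              (pp rV (psh rF true) (psh rX false) (psh rF true))
              (pp rV (psh rF true) (psh rF true) (psh rX true))
ubody  = pp rF parse (psh rF false) (psh rF true)
unpack = loop ubody ⨟ pp rF skip skip skip

module _ (n : ℕ) {y q' l r c : Str} where

  private
    S : Str → Str → Str → Regs
    S z a f = z ∷ a ∷ y ∷ q' ∷ l ∷ r ∷ c ∷ f ∷ []

  flagged : ∀ m {z a} → iter m (exec ubody n) (S z a (true ∷ [])) ≡ S z a (true ∷ [])
  flagged zero    = refl
  flagged (suc m) = flagged m

  unpack-loop : ∀ m a z → length z ≤ m →
                exec (pp rF skip skip skip) n (iter m (exec ubody n) (S z a [])) ≡ S (proj₂ (split a z))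
                    (proj₁ (split a z)) []
  unpack-loop zero    a [] le = refl
  unpack-loop (suc m) a [] le = cong (exec (pp rF skip skip skip) n) (flagged m)
  unpack-loop (suc m) a (false ∷ []) le = cong (exec (pp rF skip skip skip) n) (flagged m)
  unpack-loop (suc m) a (true ∷ [])  le = cong (exec (pp rF skip skip skip) n) (flagged m)
  unpack-loop (suc m) a (false ∷ true ∷ z) le = cong (exec (pp rF skip skip skip) n) (flagged m)
  unpack-loop (suc m) a (true ∷ false ∷ z) le = cong (exec (pp rF skip skip skip) n) (flagged m)
  unpack-loop (suc m) a (false ∷ false ∷ z) (s≤s le) = unpack-loop m (false ∷ a) z (≤-trans (ℕₚ.n≤1+n _) le)
  unpack-loop (suc m) a (true ∷ true ∷ z) (s≤s le) = unpack-loop m (true ∷ a) z (≤-trans (ℕₚ.n≤1+n _) le)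

unpacks : ∀ z {y q' l r c} → unpack ⟨ length z ⟩ (z ∷ [] ∷ y ∷ q' ∷ l ∷ r ∷ c ∷ [] ∷ []) ⟶
          (snd z ∷ tsf z ∷ y ∷ q' ∷ l ∷ r ∷ c ∷ [] ∷ [])
unpacks z = execs (unpack-loop (length z) (length z) [] z ≤-refl)

transfer double : Fin 8 → Fin 8 → Prog
transfer a b = pp a skip (psh b false) (psh b true)
double a b = pp a skip (psh b false ⨟ psh b false) (psh b true ⨟ psh b true)

copy : Fin 8 → Fin 8 → Fin 8 → Prog
copy a b c = pp a skip (psh b false ⨟ psh c false) (psh b true ⨟ psh c true)

discard : Fin 8 → Prog
discard a = pp a skip skip skip

cons : Str → Bool → Str
cons s b = b ∷ s

doubled : Str → Bool → Str
doubled s b = b ∷ b ∷ s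

foldl-doubled : ∀ w s → foldl doubled s w ≡ concatMap (λ b → b ∷ b ∷ []) (reverse w) ++ s
foldl-doubled []      s = refl
foldl-doubled (b ∷ w) s = begin
  foldl doubled (b ∷ b ∷ s) w                ≡⟨ foldl-doubled w _ ⟩
  dbl (reverse w) ++ b ∷ b ∷ s               ≡⟨ sym (++-assoc (dbl (reverse w)) (b ∷ b ∷ []) s) ⟩
  (dbl (reverse w) ++ dbl (b ∷ [])) ++ s     ≡⟨ cong (_++ s) (sym (concatMap-++ _ (reverse w) (b ∷ []))) ⟩
  dbl (reverse w ++ b ∷ []) ++ s             ≡⟨ cong (λ z → dbl z ++ s) (sym (unfold-reverse b w)) ⟩
  dbl (reverse (b ∷ w)) ++ s                 ∎
  where
  open ≡-Reasoning
  dbl : Str → Str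
  dbl = concatMap (λ b → b ∷ b ∷ [])

module _ {n : ℕ} where

  transfer-vX : ∀ {w x y q' l r c f} → length w ≤ n → loop (transfer rV rX) ⟨ n ⟩
    (w ∷ x ∷ y ∷ q' ∷ l ∷ r ∷ c ∷ f ∷ []) ⟶ ([] ∷ (w ʳ++ x) ∷ y ∷ q' ∷ l ∷ r ∷ c ∷ f ∷ [])
  transfer-vX {w} {x} {y} {q'} {l} {r} {c} {f} le = execs (drain (λ s w → w ∷ s ∷ y ∷ q' ∷ l ∷ r ∷ c ∷ f ∷ []) cons
    (λ _ → refl) (λ { s false w → refl ; s true w → refl }) n x w le)

  transfer-vY : ∀ {w x y q' l r c f} → length w ≤ n → loop (transfer rV rY) ⟨ n ⟩
    (w ∷ x ∷ y ∷ q' ∷ l ∷ r ∷ c ∷ f ∷ []) ⟶ ([] ∷ x ∷ (w ʳ++ y) ∷ q' ∷ l ∷ r ∷ c ∷ f ∷ [])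
  transfer-vY {w} {x} {y} {q'} {l} {r} {c} {f} le = execs (drain (λ s w → w ∷ x ∷ s ∷ q' ∷ l ∷ r ∷ c ∷ f ∷ []) cons
    (λ _ → refl) (λ { s false w → refl ; s true w → refl }) n y w le)

  transfer-Xv : ∀ {w x y q' l r c f} → length x ≤ n → loop (transfer rX rV) ⟨ n ⟩
    (w ∷ x ∷ y ∷ q' ∷ l ∷ r ∷ c ∷ f ∷ []) ⟶ ((x ʳ++ w) ∷ [] ∷ y ∷ q' ∷ l ∷ r ∷ c ∷ f ∷ [])
  transfer-Xv {w} {x} {y} {q'} {l} {r} {c} {f} le = execs (drain (λ s x → s ∷ x ∷ y ∷ q' ∷ l ∷ r ∷ c ∷ f ∷ []) cons
    (λ _ → refl) (λ { s false w → refl ; s true w → refl }) n w x le)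

  transfer-Yv : ∀ {w x y q' l r c f} → length y ≤ n → loop (transfer rY rV) ⟨ n ⟩
    (w ∷ x ∷ y ∷ q' ∷ l ∷ r ∷ c ∷ f ∷ []) ⟶ ((y ʳ++ w) ∷ x ∷ [] ∷ q' ∷ l ∷ r ∷ c ∷ f ∷ [])
  transfer-Yv {w} {x} {y} {q'} {l} {r} {c} {f} le = execs (drain (λ s y → s ∷ x ∷ y ∷ q' ∷ l ∷ r ∷ c ∷ f ∷ []) cons
    (λ _ → refl) (λ { s false w → refl ; s true w → refl }) n w y le)

  transfer-YX : ∀ {w x y q' l r c f} → length y ≤ n → loop (transfer rY rX) ⟨ n ⟩
    (w ∷ x ∷ y ∷ q' ∷ l ∷ r ∷ c ∷ f ∷ []) ⟶ (w ∷ (y ʳ++ x) ∷ [] ∷ q' ∷ l ∷ r ∷ c ∷ f ∷ [])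
  transfer-YX {w} {x} {y} {q'} {l} {r} {c} {f} le = execs (drain (λ s y → w ∷ s ∷ y ∷ q' ∷ l ∷ r ∷ c ∷ f ∷ []) cons
    (λ _ → refl) (λ { s false w → refl ; s true w → refl }) n x y le)

  transfer-YL : ∀ {w x y q' l r c f} → length y ≤ n → loop (transfer rY rL) ⟨ n ⟩
    (w ∷ x ∷ y ∷ q' ∷ l ∷ r ∷ c ∷ f ∷ []) ⟶ (w ∷ x ∷ [] ∷ q' ∷ (y ʳ++ l) ∷ r ∷ c ∷ f ∷ [])
  transfer-YL {w} {x} {y} {q'} {l} {r} {c} {f} le = execs (drain (λ s y → w ∷ x ∷ y ∷ q' ∷ s ∷ r ∷ c ∷ f ∷ []) cons
    (λ _ → refl) (λ { s false w → refl ; s true w → refl }) n l y le)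

  transfer-LX : ∀ {w x y q' l r c f} → length l ≤ n → loop (transfer rL rX) ⟨ n ⟩
    (w ∷ x ∷ y ∷ q' ∷ l ∷ r ∷ c ∷ f ∷ []) ⟶ (w ∷ (l ʳ++ x) ∷ y ∷ q' ∷ [] ∷ r ∷ c ∷ f ∷ [])
  transfer-LX {w} {x} {y} {q'} {l} {r} {c} {f} le = execs (drain (λ s l → w ∷ s ∷ y ∷ q' ∷ l ∷ r ∷ c ∷ f ∷ []) cons
    (λ _ → refl) (λ { s false w → refl ; s true w → refl }) n x l le)

  copy-XvY : ∀ {x q' l r c f} → length x ≤ n → loop (copy rX rV rY) ⟨ n ⟩
    ([] ∷ x ∷ [] ∷ q' ∷ l ∷ r ∷ c ∷ f ∷ []) ⟶ (reverse x ∷ [] ∷ reverse x ∷ q' ∷ l ∷ r ∷ c ∷ f ∷ [])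
  copy-XvY {x} {q'} {l} {r} {c} {f} le = execs (drain (λ s x → s ∷ x ∷ s ∷ q' ∷ l ∷ r ∷ c ∷ f ∷ []) cons
    (λ _ → refl) (λ { s false w → refl ; s true w → refl }) n [] x le)

  copy-YvC : ∀ {x y q' l r f} → length y ≤ n → loop (copy rY rV rC) ⟨ n ⟩
    ([] ∷ x ∷ y ∷ q' ∷ l ∷ r ∷ [] ∷ f ∷ []) ⟶ (reverse y ∷ x ∷ [] ∷ q' ∷ l ∷ r ∷ reverse y ∷ f ∷ [])
  copy-YvC {x} {y} {q'} {l} {r} {f} le = execs (drain (λ s y → s ∷ x ∷ y ∷ q' ∷ l ∷ r ∷ s ∷ f ∷ []) cons
    (λ _ → refl) (λ { s false w → refl ; s true w → refl }) n [] y le)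

  discards : ∀ {w x y q' l r c f} → length w ≤ n → loop (discard rV) ⟨ n ⟩
    (w ∷ x ∷ y ∷ q' ∷ l ∷ r ∷ c ∷ f ∷ []) ⟶ ([] ∷ x ∷ y ∷ q' ∷ l ∷ r ∷ c ∷ f ∷ [])
  discards {w} {x} {y} {q'} {l} {r} {c} {f} le = execs
      (drain {A = Str} (λ s w → w ∷ x ∷ y ∷ q' ∷ l ∷ r ∷ c ∷ f ∷ []) (λ s _ → s)
    (λ _ → refl) (λ { s false w → refl ; s true w → refl }) n [] w le)

-- A clock p instead of a plain loop, because the first component may be longer than the input, for
-- instance when it is the output of a simulated machine.
pack : Poly → Prog
pack p = psh rV true ⨟ psh rV false ⨟ clock p (double rX rV)

packs : ∀ p {n z x y q' l r c f} → length x ≤ eval p n → pack p ⟨ n ⟩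
        (z ∷ x ∷ y ∷ q' ∷ l ∷ r ∷ c ∷ f ∷ []) ⟶ (pair (reverse x) z ∷ [] ∷ y ∷ q' ∷ l ∷ r ∷ c ∷ f ∷ [])
packs p {n} {z} {x} {y} {q'} {l} {r} {c} {f} le = execs (
  trans (exec-clock p (double rX rV) n _)
    (trans (drain (λ s w → s ∷ w ∷ y ∷ q' ∷ l ∷ r ∷ c ∷ f ∷ []) doubled
             (λ _ → refl) (λ { s false w → refl ; s true w → refl }) (eval p n) (false ∷ true ∷ z) x le)
      (cong (λ s → s ∷ [] ∷ y ∷ q' ∷ l ∷ r ∷ c ∷ f ∷ []) (foldl-doubled x (false ∷ true ∷ z)))))

≤id : ∀ {m n} → m ≤ n → m ≤ eval pid n
≤id {m} {n} le = subst (m ≤_) (sym (eval-id n)) le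

rev≤ : ∀ (x : Str) {m} → length x ≤ m → length (reverse x) ≤ m
rev≤ x {m} le = subst (_≤ m) (sym (length-reverse x)) le

dup : SFP (λ x → pair x x)
dup = SFP-ext unreversed (stage-is (loop (transfer rV rX) ⨟ loop (copy rX rV rY) ⨟ loop (transfer rY rX) ⨟ pack pid)
  (λ x → _ , (transfer-vX ≤-refl next copy-XvY (rev≤ x ≤-refl)
          next transfer-YX (rev≤ (reverse x) (rev≤ x ≤-refl))
          next packs pid (≤id (rev≤ (reverse (reverse x)) (rev≤ (reverse x) (rev≤ x ≤-refl)))))))
  where
  unreversed : ∀ x → pair (reverse (reverse (reverse (reverse x)))) (reverse (reverse x)) ≡ pair x x
  unreversed x rewrite reverse-involutive x | reverse-involutive x = refl

-- Each transfer reverses a string and `pack` expects its first component reversed, so the number of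
-- transfers has to be odd: this is the reason for the detour through `rL`.
swap : SFP (λ z → pair (snd z) (fst z))
swap = SFP-ext unreversed (stage-is (unpack ⨟ loop (transfer rV rY) ⨟ loop (transfer rX rV) ⨟ loop (transfer rY rL) ⨟
    loop (transfer rL rX) ⨟ pack pid)
  (λ z → _ , (unpacks z next transfer-vY (snd-short z) next transfer-Xv (tsf-short z)
          next transfer-YL (rev≤ (snd z) (snd-short z)) next
              transfer-LX (rev≤ (reverse (snd z)) (rev≤ (snd z) (snd-short z)))
          next packs pid (≤id (rev≤ (reverse (reverse (snd z))) (rev≤ (reverse (snd z)) (rev≤ (snd z) (snd-short z))))))))
  where
  unreversed : ∀ z → pair (reverse (reverse (reverse (reverse (snd z))))) (fst z) ≡ pair (snd z) (fst z)
  unreversed z rewrite reverse-involutive (snd z) | reverse-involutive (snd z) = refl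

id-fp : SFP (λ x → x)
id-fp = stage-is skip (λ x → _ , execs refl)

snd-fp : SFP snd
snd-fp = stage-is unpack (λ z → _ , unpacks z)

fst-fp : SFP fst
fst-fp = stage-is (unpack ⨟ loop (discard rV) ⨟ loop (transfer rX rV))
  (λ z → _ , (unpacks z next discards (snd-short z) next transfer-Xv (tsf-short z)))

cons-fp : ∀ b → SFP (b ∷_)
cons-fp b = stage-is (psh rV b) (λ z → _ , execs refl)

tail : Str → Str
tail []      = []
tail (_ ∷ w) = w

tail-fp : SFP tail
tail-fp = stage-is (discard rV) (λ { [] → _ , execs refl ; (false ∷ z) → _ , execs refl ; (true ∷ z) → _ , execs refl })

emit : Str → Prog
emit []      = skip
emit (b ∷ d) = emit d ⨟ psh rV b

emits : ∀ d {n x y q' l r c f} → emit d ⟨ n ⟩ ([] ∷ x ∷ y ∷ q' ∷ l ∷ r ∷ c ∷ f ∷ []) ⟶ (d ∷ x ∷ y ∷ q' ∷ l ∷ r ∷ c ∷ f ∷ [])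
emits []      = execs refl
emits (b ∷ d) = emits d next execs refl

const-fp : ∀ d → SFP (λ _ → d)
const-fp d = stage-is (loop (discard rV) ⨟ emit d) (λ z → _ , (discards ≤-refl next emits d))

poly-fp : ∀ p → SFP (λ x → ones (eval p (length x)))
poly-fp p = SFP-ext (λ x → cong ones (ℕₚ.+-identityʳ (eval p (length x))))
    (stage-is (loop (discard rV) ⨟ clock p (psh rV true))
  (λ x → _ , (discards ≤-refl next execs (trans (exec-clock p (psh rV true) (length x) _)
      (pushes (length x) (eval p (length x)) 0)))))
  where
  pushes : ∀ {u : Vec Str 7} n m k → iter m (exec (psh rV true) n) (ones k ∷ u) ≡ ones (m + k) ∷ u
  pushes n zero    k = refl
  pushes {u} n (suc m) k = trans (pushes n m (suc k)) (cong (λ i → ones i ∷ u) (ℕₚ.+-suc m k))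

-- Tests are strings from here on: the empty string means no and any other yes, so that with d = []
-- this is a conjunction which also passes on the value y.
guardElse : Str → Str → Str → Str
guardElse d []      y = d
guardElse d (_ ∷ _) y = y

guardElse-reverse : ∀ d x y → guardElse d (reverse x) y ≡ guardElse d x y
guardElse-reverse d []      y = refl
guardElse-reverse d (b ∷ x) y rewrite unfold-reverse b x = lem (reverse x)
  where
  lem : ∀ w → guardElse d (w ++ b ∷ []) y ≡ y
  lem []      = refl
  lem (_ ∷ _) = refl

guardElse-fp : ∀ d → SFP (λ z → guardElse d (fst z) (snd z))
guardElse-fp d = SFP-ext (λ z → sym (guardElse-reverse d (tsf z) (snd z)))
  (stage-is (unpack ⨟ pp rX (loop (discard rV) ⨟ emit d) skip skip)
      (λ z → _ , (unpacks z next checks (tsf z) (snd-short z))))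
  where
  rest : Str → Vec Str 7
  rest x = tail x ∷ [] ∷ [] ∷ [] ∷ [] ∷ [] ∷ [] ∷ []
  checks : ∀ {n y} x → length y ≤ n → pp rX (loop (discard rV) ⨟ emit d) skip skip ⟨ n ⟩
      (y ∷ x ∷ [] ∷ [] ∷ [] ∷ [] ∷ [] ∷ [] ∷ [])
           ⟶ (guardElse d x y ∷ rest x)
  checks []          le = execs (exec≡ (discards le next emits d))
  checks (false ∷ x) le = execs refl
  checks (true ∷ x)  le = execs refl

takeLen : Str → Str → Str
takeLen a y = take (length a) y

take-fp : SFP (λ z → takeLen (fst z) (snd z))
take-fp = SFP-ext unreversed (stage-is (unpack ⨟ loop step ⨟ loop (discard rV) ⨟ loop (transfer rY rV))
  (λ z → _ , (unpacks z next execs (steps (length z) (tsf z) (snd z) [] (tsf-short z))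
          next discards (≤-trans (left-short (tsf z) (snd z)) (snd-short z))
          next transfer-Yv (≤-trans (taken-short (tsf z) (snd z) [])
              (≤-trans (≤-reflexive (ℕₚ.+-identityʳ _)) (snd-short z))))))
  where
  step : Prog
  step = pp rX skip (transfer rV rY) (transfer rV rY)
  left : Str → Str → Str
  left []      y       = y
  left (_ ∷ x) []      = []
  left (_ ∷ x) (_ ∷ y) = left x y
  taken : Str → Str → Str → Str
  taken []      y       a = a
  taken (_ ∷ x) []      a = a
  taken (_ ∷ x) (b ∷ y) a = taken x y (b ∷ a)
  left-[] : ∀ x → left x [] ≡ []
  left-[] []      = refl
  left-[] (_ ∷ x) = refl
  taken-[] : ∀ x a → taken x [] a ≡ a
  taken-[] []      a = refl
  taken-[] (_ ∷ x) a = refl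
  left-short : ∀ x y → length (left x y) ≤ length y
  left-short []      y       = ≤-refl
  left-short (_ ∷ x) []      = z≤n
  left-short (_ ∷ x) (_ ∷ y) = ≤-trans (left-short x y) (ℕₚ.n≤1+n _)
  taken-short : ∀ x y a → length (taken x y a) ≤ length y + length a
  taken-short []      y       a = m≤n+m _ _
  taken-short (_ ∷ x) []      a = ≤-refl
  taken-short (_ ∷ x) (b ∷ y) a = ≤-trans (taken-short x y (b ∷ a)) (≤-reflexive (ℕₚ.+-suc _ _))
  steps : ∀ {n q' l r c f} m x y a → length x ≤ m → iter m (exec step n) (y ∷ x ∷ a ∷ q' ∷ l ∷ r ∷ c ∷ f ∷ []) ≡
          left x y ∷ [] ∷ taken x y a ∷ q' ∷ l ∷ r ∷ c ∷ f ∷ []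
  steps zero    []          y           a le = refl
  steps (suc m) []          y           a le = steps m [] y a z≤n
  steps (suc m) (false ∷ x) []          a (s≤s le) =
      trans (steps m x [] a le) (cong₂ (λ u w → u ∷ [] ∷ w ∷ _) (left-[] x) (taken-[] x a))
  steps (suc m) (true ∷ x)  []          a (s≤s le) =
      trans (steps m x [] a le) (cong₂ (λ u w → u ∷ [] ∷ w ∷ _) (left-[] x) (taken-[] x a))
  steps (suc m) (false ∷ x) (false ∷ y) a (s≤s le) = steps m x y (false ∷ a) le
  steps (suc m) (false ∷ x) (true ∷ y)  a (s≤s le) = steps m x y (true ∷ a) le
  steps (suc m) (true ∷ x)  (false ∷ y) a (s≤s le) = steps m x y (false ∷ a) le
  steps (suc m) (true ∷ x)  (true ∷ y)  a (s≤s le) = steps m x y (true ∷ a) le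
  taken-take : ∀ x y a → taken x y a ≡ take (length x) y ʳ++ a
  taken-take []      y       a = refl
  taken-take (_ ∷ x) []      a = refl
  taken-take (_ ∷ x) (b ∷ y) a = taken-take x y (b ∷ a)
  unreversed : ∀ z → reverse (taken (tsf z) (snd z) []) ≡ takeLen (fst z) (snd z)
  unreversed z = begin
    reverse (taken (tsf z) (snd z) [])                    ≡⟨ cong reverse (taken-take (tsf z) (snd z) []) ⟩
    reverse (reverse (take (length (tsf z)) (snd z)))     ≡⟨ reverse-involutive _ ⟩
    take (length (tsf z)) (snd z)                         ≡⟨ cong (λ i → take i (snd z)) (sym (length-reverse (tsf z))) ⟩
    take (length (fst z)) (snd z)                         ∎
    where open ≡-Reasoning

_≟S_ : (x y : Str) → Dec (x ≡ y)
_≟S_ = ≡-dec Bool._≟_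

eq : Str → Str → Str
eq x y = if does (x ≟S y) then true ∷ [] else []

eq-fp : SFP (λ z → eq (fst z) (snd z))
-- `tsf z` is the first component backwards, so the second is reversed as well before the two are
-- compared; `rF` receives one mark per disagreement.
eq-fp = SFP-ext unreversed (stage-is (unpack ⨟ loop (transfer rV rY) ⨟ loop step ⨟ pp rF (psh rV true) skip skip)
  (λ z → _ , (unpacks z next transfer-vY (snd-short z)
    next execs (steps (length z) (tsf z) (reverse (snd z)) [] (tsf-short z) (rev≤ (snd z) (snd-short z)))
    next answers (diff (tsf z) (reverse (snd z)) []))))
  where
  bad step : Prog
  bad  = psh rF true
  step = pp rX (pp rY skip bad bad) (pp rY bad skip bad) (pp rY bad bad skip)
  diff : Str → Str → Str → Str
  diff []          []          f = f
  diff []          (_ ∷ y)     f = diff [] y (true ∷ f)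
  diff (_ ∷ x)     []          f = diff x [] (true ∷ f)
  diff (false ∷ x) (false ∷ y) f = diff x y f
  diff (true ∷ x)  (true ∷ y)  f = diff x y f
  diff (false ∷ x) (true ∷ y)  f = diff x y (true ∷ f)
  diff (true ∷ x)  (false ∷ y) f = diff x y (true ∷ f)
  steps : ∀ {n w q' l r c} m x y f → length x ≤ m → length y ≤ m →
      iter m (exec step n) (w ∷ x ∷ y ∷ q' ∷ l ∷ r ∷ c ∷ f ∷ []) ≡
          w ∷ [] ∷ [] ∷ q' ∷ l ∷ r ∷ c ∷ diff x y f ∷ []
  steps zero    []          []          f le le' = refl
  steps (suc m) []          []          f le le' = steps m [] [] f z≤n z≤n
  steps (suc m) []          (false ∷ y) f le (s≤s le') = steps m [] y (true ∷ f) z≤n le'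
  steps (suc m) []          (true ∷ y)  f le (s≤s le') = steps m [] y (true ∷ f) z≤n le'
  steps (suc m) (false ∷ x) []          f (s≤s le) le' = steps m x [] (true ∷ f) le z≤n
  steps (suc m) (true ∷ x)  []          f (s≤s le) le' = steps m x [] (true ∷ f) le z≤n
  steps (suc m) (false ∷ x) (false ∷ y) f (s≤s le) (s≤s le') = steps m x y f le le'
  steps (suc m) (false ∷ x) (true ∷ y)  f (s≤s le) (s≤s le') = steps m x y (true ∷ f) le le'
  steps (suc m) (true ∷ x)  (false ∷ y) f (s≤s le) (s≤s le') = steps m x y (true ∷ f) le le'
  steps (suc m) (true ∷ x)  (true ∷ y)  f (s≤s le) (s≤s le') = steps m x y f le le'
  diff-same : ∀ x → diff x x [] ≡ []
  diff-same []          = refl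
  diff-same (false ∷ x) = diff-same x
  diff-same (true ∷ x)  = diff-same x
  diff-[] : ∀ x y f → diff x y f ≡ [] → x ≡ y × f ≡ []
  diff-[] []          []          f e = refl , e
  diff-[] []          (_ ∷ y)     f e with () ← proj₂ (diff-[] [] y (true ∷ f) e)
  diff-[] (_ ∷ x)     []          f e with () ← proj₂ (diff-[] x [] (true ∷ f) e)
  diff-[] (false ∷ x) (false ∷ y) f e with refl , e' ← diff-[] x y f e = refl , e'
  diff-[] (true ∷ x)  (true ∷ y)  f e with refl , e' ← diff-[] x y f e = refl , e'
  diff-[] (false ∷ x) (true ∷ y)  f e with () ← proj₂ (diff-[] x y (true ∷ f) e)
  diff-[] (true ∷ x)  (false ∷ y) f e with () ← proj₂ (diff-[] x y (true ∷ f) e)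
  answer : Str → Str
  answer []      = true ∷ []
  answer (_ ∷ _) = []
  answers : ∀ {n x y q' l r c} f → pp rF (psh rV true) skip skip ⟨ n ⟩ ([] ∷ x ∷ y ∷ q' ∷ l ∷ r ∷ c ∷ f ∷ []) ⟶
            (answer f ∷ x ∷ y ∷ q' ∷ l ∷ r ∷ c ∷ tail f ∷ [])
  answers []          = execs refl
  answers (false ∷ f) = execs refl
  answers (true ∷ f)  = execs refl
  unreversed : ∀ z → answer (diff (tsf z) (reverse (snd z)) []) ≡ eq (fst z) (snd z)
  unreversed z with fst z ≟S snd z
  ... | yes e = cong answer (trans (cong (λ w → diff w (reverse (snd z)) [])
      (trans (sym (reverse-involutive (tsf z))) (cong reverse e))) (diff-same (reverse (snd z))))
  ... | no ne with diff (tsf z) (reverse (snd z)) [] in d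
  ...   | []    = contradiction (trans (cong reverse (proj₁ (diff-[] (tsf z) (reverse (snd z)) [] d)))
      (reverse-involutive (snd z))) ne
  ...   | _ ∷ _ = refl

-- Simulation of Turing machines by stack programs

open _⟨_⟩_⟶_

-- Machines driven by a string of bits, one bit per step (0 once the string is used up).
record BitMachine : Set where
  field
    Q    : ℕ
    init : Fin Q
    δ    : Fin Q → Sym → Bool → Fin Q × Sym × Move
    flag : Fin Q → Bool

hdB : Str → Bool
hdB []      = false
hdB (b ∷ _) = b

hdS : List Sym → Sym
hdS []      = blank
hdS (s ∷ _) = s

tlS : List Sym → List Sym
tlS []       = []
tlS (_ ∷ ss) = ss

tapeOf : List Sym → List Sym → Tape
tapeOf ls rs = tape ls (hdS rs) (tlS rs)

initTape-tapeOf : ∀ x → initTape x ≡ tapeOf [] (map bit x)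
initTape-tapeOf []      = refl
initTape-tapeOf (_ ∷ _) = refl

readOut-tapeOf : ∀ ls rs → readOut (tapeOf ls rs) ≡ readSyms rs
readOut-tapeOf ls []      = refl
readOut-tapeOf ls (_ ∷ _) = refl

readSyms-short : ∀ rs → length (readSyms rs) ≤ length rs
readSyms-short []           = z≤n
readSyms-short (b0 ∷ rs)    = s≤s (readSyms-short rs)
readSyms-short (b1 ∷ rs)    = s≤s (readSyms-short rs)
readSyms-short (blank ∷ rs) = z≤n

-- A prefix code in which a leading 1 is a blank: popping a symbol then treats a stored blank and an
-- exhausted stack alike, as the infinite tape demands.
enc : List Sym → Str
enc []           = []
enc (b0 ∷ ss)    = false ∷ false ∷ enc ss
enc (b1 ∷ ss)    = false ∷ true ∷ enc ss
enc (blank ∷ ss) = true ∷ enc ss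

pushSym : Fin 8 → Sym → Prog
pushSym r b0    = psh r false ⨟ psh r false
pushSym r b1    = psh r true ⨟ psh r false
pushSym r blank = psh r true

popSym : Fin 8 → (Sym → Prog) → Prog
popSym r k = pp r (k blank) (pp r skip (k b0) (k b1)) (k blank)

module _ {n : ℕ} where

  pushSym-L : ∀ s {w x y q' ls r c f} → pushSym rL s ⟨ n ⟩
    (w ∷ x ∷ y ∷ q' ∷ enc ls ∷ r ∷ c ∷ f ∷ []) ⟶ (w ∷ x ∷ y ∷ q' ∷ enc (s ∷ ls) ∷ r ∷ c ∷ f ∷ [])
  pushSym-L b0    = execs refl
  pushSym-L b1    = execs refl
  pushSym-L blank = execs refl

  pushSym-R : ∀ s {w x y q' l rs c f} → pushSym rR s ⟨ n ⟩
    (w ∷ x ∷ y ∷ q' ∷ l ∷ enc rs ∷ c ∷ f ∷ []) ⟶ (w ∷ x ∷ y ∷ q' ∷ l ∷ enc (s ∷ rs) ∷ c ∷ f ∷ [])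
  pushSym-R b0    = execs refl
  pushSym-R b1    = execs refl
  pushSym-R blank = execs refl

  popSym-L : ∀ k ls {w x y q' r c f s} → k (hdS ls) ⟨ n ⟩ (w ∷ x ∷ y ∷ q' ∷ enc (tlS ls) ∷ r ∷ c ∷ f ∷ []) ⟶ s →
             popSym rL k ⟨ n ⟩ (w ∷ x ∷ y ∷ q' ∷ enc ls ∷ r ∷ c ∷ f ∷ []) ⟶ s
  popSym-L k []           (execs e) = execs e
  popSym-L k (b0 ∷ ls)    (execs e) = execs e
  popSym-L k (b1 ∷ ls)    (execs e) = execs e
  popSym-L k (blank ∷ ls) (execs e) = execs e

  popSym-R : ∀ k rs {w x y q' l c f s} → k (hdS rs) ⟨ n ⟩ (w ∷ x ∷ y ∷ q' ∷ l ∷ enc (tlS rs) ∷ c ∷ f ∷ []) ⟶ s →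
             popSym rR k ⟨ n ⟩ (w ∷ x ∷ y ∷ q' ∷ l ∷ enc rs ∷ c ∷ f ∷ []) ⟶ s
  popSym-R k []           (execs e) = execs e
  popSym-R k (b0 ∷ ls)    (execs e) = execs e
  popSym-R k (b1 ∷ ls)    (execs e) = execs e
  popSym-R k (blank ∷ ls) (execs e) = execs e

setState : ℕ → Prog
setState zero    = skip
setState (suc i) = setState i ⨟ psh rQ true

sets : ∀ i {n w x y l r c f} → setState i ⟨ n ⟩ (w ∷ x ∷ y ∷ [] ∷ l ∷ r ∷ c ∷ f ∷ []) ⟶
    (w ∷ x ∷ y ∷ ones i ∷ l ∷ r ∷ c ∷ f ∷ [])
sets zero    = execs refl
sets (suc i) = sets i next execs refl

-- The state is kept in unary, so that reading it also empties `rQ`, which is what `setState` needs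
-- in order to store the next one.
dispatch : ∀ {Q} → (Fin Q → Prog) → Prog
dispatch {zero}  k = skip
dispatch {suc Q} k = pp rQ (k zero) skip (dispatch (k ∘ suc))

dispatches : ∀ {Q} (k : Fin Q → Prog) i {n w x y l r c f s} → k i ⟨ n ⟩ (w ∷ x ∷ y ∷ [] ∷ l ∷ r ∷ c ∷ f ∷ []) ⟶ s →
             dispatch k ⟨ n ⟩ (w ∷ x ∷ y ∷ ones (toℕ i) ∷ l ∷ r ∷ c ∷ f ∷ []) ⟶ s
dispatches k zero    (execs e) = execs e
dispatches k (suc i) r = execs (exec≡ (dispatches (k ∘ suc) i r))

loadR : Prog
loadR = pp rX skip (pushSym rR b0) (pushSym rR b1)

loads : ∀ {n w x y q' l c f} → length x ≤ n → loop loadR ⟨ n ⟩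
        (w ∷ x ∷ y ∷ q' ∷ l ∷ [] ∷ c ∷ f ∷ []) ⟶ (w ∷ [] ∷ y ∷ q' ∷ l ∷ enc (map bit (reverse x)) ∷ c ∷ f ∷ [])
loads {n} {w} {x} {y} {q'} {l} {c} {f} le = execs (trans
  (drain (λ s x → w ∷ x ∷ y ∷ q' ∷ l ∷ enc s ∷ c ∷ f ∷ []) (λ s b → bit b ∷ s) (λ _ → refl)
    (λ { s false x → refl ; s true x → refl }) n [] x le)
  (cong (λ s → w ∷ [] ∷ y ∷ q' ∷ l ∷ enc s ∷ c ∷ f ∷ []) (bits x [])))
  where
  bits : ∀ x s → foldl (λ s b → bit b ∷ s) (map bit s) x ≡ map bit (x ʳ++ s)
  bits []      s = refl
  bits (b ∷ x) s = bits x (b ∷ s)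

extract : Prog
extract = pp rF (popSym rR grab) (psh rF false) (psh rF true)
  where
  grab : Sym → Prog
  grab b0    = psh rX false
  grab b1    = psh rX true
  grab blank = psh rF true

idles : ∀ n m {w a y q' l r c} → iter m (exec extract n) (w ∷ a ∷ y ∷ q' ∷ l ∷ r ∷ c ∷ (true ∷ []) ∷ []) ≡
        w ∷ a ∷ y ∷ q' ∷ l ∷ r ∷ c ∷ (true ∷ []) ∷ []
idles n zero    = refl
idles n (suc m) = idles n m

extracts : ∀ n m rs {w a y q' l c} → length rs ≤ m → Σ[ r ∈ Str ] Σ[ f ∈ Str ]
  (iter m (exec extract n) (w ∷ a ∷ y ∷ q' ∷ l ∷ enc rs ∷ c ∷ [] ∷ []) ≡ w ∷
      (readSyms rs ʳ++ a) ∷ y ∷ q' ∷ l ∷ r ∷ c ∷ f ∷ [])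
extracts n zero    []           le = _ , _ , refl
extracts n (suc m) []           le = _ , _ , idles n m
extracts n (suc m) (blank ∷ rs) le = _ , _ , idles n m
extracts n (suc m) (b0 ∷ rs)    (s≤s le) = extracts n m rs le
extracts n (suc m) (b1 ∷ rs)    (s≤s le) = extracts n m rs le

module Simulation (M : BitMachine) where
  open BitMachine M

  -- The scanned symbol is the first of the second list, and an empty list scans a blank; this is
  -- `view`. Two stacks thus hold the whole tape.
  Conf : Set
  Conf = Fin Q × List Sym × List Sym × Str

  act : Fin Q × Sym × Move → List Sym → List Sym → Str → Conf
  act (i , s , mvS) ls rs c = i , ls , s ∷ rs , c
  act (i , s , mvR) ls rs c = i , s ∷ ls , rs , c
  act (i , s , mvL) ls rs c = i , tlS ls , hdS ls ∷ s ∷ rs , c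

  bstep : Conf → Conf
  bstep (i , ls , rs , c) = act (δ i (hdS rs) (hdB c)) ls (tlS rs) (tail c)

  tstep : Fin Q × Tape × Str → Fin Q × Tape × Str
  tstep (i , t , c) = let j , s , m = δ i (Tape.head t) (hdB c) in j , move m (write s t) , tail c

  view : Conf → Fin Q × Tape × Str
  view (i , ls , rs , c) = i , tapeOf ls rs , c

  view-act : ∀ a ls rs c → view (act a ls rs c) ≡ (proj₁ a , move (proj₂ (proj₂ a)) (tape ls (proj₁ (proj₂ a)) rs) , c)
  view-act (i , s , mvS) ls       rs      c = refl
  view-act (i , s , mvR) ls       []      c = refl
  view-act (i , s , mvR) ls       (_ ∷ _) c = refl
  view-act (i , s , mvL) []       rs      c = refl
  view-act (i , s , mvL) (_ ∷ ls) rs      c = refl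

  view-iter : ∀ m cf → view (iter m bstep cf) ≡ iter m tstep (view cf)
  view-iter zero    cf = refl
  view-iter (suc m) cf@(i , ls , rs , c) = trans (view-iter m (bstep cf))
    (cong (iter m tstep) (view-act (δ i (hdS rs) (hdB c)) ls (tlS rs) (tail c)))

  rightLen : Conf → ℕ
  rightLen (_ , _ , rs , _) = length rs

  tlS-short : ∀ rs → length (tlS rs) ≤ length rs
  tlS-short []       = z≤n
  tlS-short (_ ∷ rs) = ℕₚ.n≤1+n _

  act-short : ∀ a ls rs c → rightLen (act a ls rs c) ≤ 2 + length rs
  act-short (i , s , mvS) ls rs c = ℕₚ.n≤1+n _
  act-short (i , s , mvR) ls rs c = ≤-trans (ℕₚ.n≤1+n _) (ℕₚ.n≤1+n _)
  act-short (i , s , mvL) ls rs c = ≤-refl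

  -- Two cells per step are possible: a left move with an empty right list stores both the cell just
  -- written and its left neighbour there.
  iter-short : ∀ m cf → rightLen (iter m bstep cf) ≤ rightLen cf + 2 * m
  iter-short zero    cf = m≤m+n _ _
  iter-short (suc m) cf@(i , ls , rs , c) = ≤-trans (iter-short m (bstep cf)) (≤-trans
    (+-mono-≤ (≤-trans (act-short (δ i (hdS rs) (hdB c)) ls (tlS rs) (tail c)) (+-monoʳ-≤ 2 (tlS-short rs)))
        (≤-refl {2 * m}))
    (≤-reflexive (lem (length rs) m)))
    where
    lem : ∀ l m → 2 + l + 2 * m ≡ l + 2 * suc m
    lem = solve-∀

  actC : Fin Q × Sym × Move → Prog
  actC (i , s , mvS) = setState (toℕ i) ⨟ pushSym rR s
  actC (i , s , mvR) = setState (toℕ i) ⨟ pushSym rL s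
  actC (i , s , mvL) = setState (toℕ i) ⨟ pushSym rR s ⨟ popSym rL (pushSym rR)

  readC : Bool → Prog
  readC b = dispatch (λ i → popSym rR (λ h → actC (δ i h b)))

  stepC : Prog
  stepC = pp rC (readC false) (readC false) (readC true)

  module _ {n : ℕ} {w x y f : Str} where

    regs : Conf → Regs
    regs (i , ls , rs , c) = w ∷ x ∷ y ∷ ones (toℕ i) ∷ enc ls ∷ enc rs ∷ c ∷ f ∷ []

    acts : ∀ a ls rs c → actC a ⟨ n ⟩ (w ∷ x ∷ y ∷ [] ∷ enc ls ∷ enc rs ∷ c ∷ f ∷ []) ⟶ regs (act a ls rs c)
    acts (i , s , mvS) ls rs c = sets (toℕ i) next pushSym-R s {rs = rs}
    acts (i , s , mvR) ls rs c = sets (toℕ i) next pushSym-L s {ls = ls}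
    acts (i , s , mvL) ls rs c = sets (toℕ i) next pushSym-R s {rs = rs} next
        popSym-L (pushSym rR) ls (pushSym-R (hdS ls) {rs = s ∷ rs})

    reads : ∀ b i ls rs c → readC b ⟨ n ⟩ regs (i , ls , rs , c) ⟶ regs (act (δ i (hdS rs) b) ls (tlS rs) c)
    reads b i ls rs c = dispatches _ i (popSym-R (λ h → actC (δ i h b)) rs (acts (δ i (hdS rs) b) ls (tlS rs) c))

    steps : ∀ cf → exec stepC n (regs cf) ≡ regs (bstep cf)
    steps (i , ls , rs , [])        = exec≡ (reads false i ls rs [])
    steps (i , ls , rs , false ∷ c) = exec≡ (reads false i ls rs c)
    steps (i , ls , rs , true ∷ c)  = exec≡ (reads true i ls rs c)

    iter-steps : ∀ m cf → iter m (exec stepC n) (regs cf) ≡ regs (iter m bstep cf)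
    iter-steps zero    cf = refl
    iter-steps (suc m) cf = trans (cong (iter m (exec stepC n)) (steps cf)) (iter-steps m (bstep cf))

    ticks : ∀ p cf → clock p stepC ⟨ n ⟩ regs cf ⟶ regs (iter (eval p n) bstep cf)
    ticks p cf = execs (trans (exec-clock p stepC n (regs cf)) (iter-steps (eval p n) cf))

  -- The leading 1 tells an empty output in a flagged state from the absence of an output.
  outcome : Fin Q × Tape × Str → Str
  outcome (i , t , _) = if flag i then true ∷ readOut t else []

  runBits : ℕ → Str → Str → Str
  runBits T x c = outcome (iter T tstep (init , initTape x , c))

  -- Prepares both forms of `outcome`: in a flagged state the leading 1 is placed in `rX` ahead of
  -- the output; otherwise `rF` is set, which makes `extract` idle and leaves the outcome empty.
  mark : Prog
  mark = dispatch (λ i → if flag i then psh rX true else psh rF true)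

  collect : Poly → Prog
  collect p = mark ⨟ clock p extract ⨟ pack p

  collects : ∀ p {n w y} cf → rightLen cf < eval p n →
             Σ[ u ∈ Vec Str 7 ] (collect p ⟨ n ⟩ (regs {n} {w} {[]} {y} {[]} cf) ⟶ (pair (outcome (view cf)) w ∷ u))
  collects p {n} {w} {y} (i , ls , rs , c) lt with flag i in e
  ... | true =
    let r , f , e' = extracts n (eval p n) rs {w} {true ∷ []} {y} {[]} {enc ls} {c} (≤-trans (ℕₚ.n≤1+n _) lt)
    in _ , (dispatches (λ i → if flag i then psh rX true else psh rF true) i marked
        next execs (trans (exec-clock p extract n _) e')
        next execs (trans (exec≡ (packs p {n} {w} {readSyms rs ʳ++ (true ∷ [])} short))
            (cong (λ z → pair z w ∷ [] ∷ y ∷ [] ∷ enc ls ∷ r ∷ c ∷ f ∷ []) rev)))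
    where
    marked : (if flag i then psh rX true else psh rF true) ⟨ n ⟩ (w ∷ [] ∷ y ∷ [] ∷ enc ls ∷ enc rs ∷ c ∷ [] ∷ [])
             ⟶ (w ∷ (true ∷ []) ∷ y ∷ [] ∷ enc ls ∷ enc rs ∷ c ∷ [] ∷ [])
    marked rewrite e = execs refl
    short : length (readSyms rs ʳ++ (true ∷ [])) ≤ eval p n
    short = ≤-trans (≤-reflexive (length-ʳ++ (readSyms rs)))
        (≤-trans (≤-reflexive (ℕₚ.+-comm _ 1)) (≤-trans (s≤s (readSyms-short rs)) lt))
    rev : reverse (readSyms rs ʳ++ (true ∷ [])) ≡ true ∷ readOut (tapeOf ls rs)
    rev = trans (ʳ++-ʳ++ (readSyms rs) {ys = true ∷ []} {zs = []})
        (cong (true ∷_) (trans (++-identityʳ _) (sym (readOut-tapeOf ls rs))))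
  ... | false = _ , (dispatches (λ i → if flag i then psh rX true else psh rF true) i marked
        next execs (trans (exec-clock p extract n _) (idles n (eval p n)))
        next packs p z≤n)
    where
    marked : (if flag i then psh rX true else psh rF true) ⟨ n ⟩ (w ∷ [] ∷ y ∷ [] ∷ enc ls ∷ enc rs ∷ c ∷ [] ∷ [])
             ⟶ (w ∷ [] ∷ y ∷ [] ∷ enc ls ∷ enc rs ∷ c ∷ (true ∷ []) ∷ [])
    marked rewrite e = execs refl

  -- The driving string is returned along with the outcome. For a deterministic machine it is merely
  -- carried, so the machine acts on one half of a pair, and from this the pairing of functions is
  -- obtained.
  simulate-fp : ∀ p → SFP (λ z → pair (runBits (eval p (length z)) (fst z) (snd z)) (snd z))
  simulate-fp p = stage-is
    (unpack ⨟ loop (transfer rV rY) ⨟ loop (copy rY rV rC) ⨟ loop loadR ⨟ setState (toℕ init) ⨟ clock p stepC ⨟ collect pc)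
    (λ z → let n = length z
               u , r = collects pc {n} {reverse (reverse (snd z))} {[]} (final z) (bound z)
           in u , execs (trans (exec≡ (unpacks z next transfer-vY (snd-short z) next copy-YvC (rev≤ (snd z) (snd-short z))
                  next loads {l = []} (tsf-short z) next sets (toℕ init) next ticks p (initial' z) next r))
                      (cong (_∷ u) (unreversed z))))
    where
    pc : Poly
    -- At most n cells at the start, two more per simulated step, and one for the leading 1 of the
    -- outcome.
    pc = padd (pconst 1) (padd pid (pscale 2 p))
    initial' final : Str → Conf
    initial' z = init , [] , map bit (fst z) , reverse (reverse (snd z))
    final z = iter (eval p (length z)) bstep (initial' z)
    pc-val : ∀ n → eval pc n ≡ suc (n + 2 * eval p n)
    pc-val n rewrite eval-add (pconst 1) (padd pid (pscale 2 p)) n | eval-add pid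
        (pscale 2 p) n | eval-scale 2 p n | eval-id n | ℕₚ.*-zeroʳ n = refl
    bound : ∀ z → rightLen (final z) < eval pc (length z)
    bound z rewrite pc-val (length z) = s≤s (≤-trans (iter-short (eval p (length z)) (initial' z))
      (+-mono-≤ (≤-trans (≤-reflexive (length-map bit (fst z))) (rev≤ (tsf z) (tsf-short z)))
          (≤-refl {2 * eval p (length z)})))
    unreversed : ∀ z → pair (outcome (view (final z))) (reverse (reverse (snd z))) ≡ pair
        (runBits (eval p (length z)) (fst z) (snd z)) (snd z)
    unreversed z = cong₂ pair
      (cong outcome (trans (view-iter (eval p (length z)) (initial' z))
          (cong₂ (λ t c → iter (eval p (length z)) tstep (init , t , c)) (sym (initTape-tapeOf (fst z)))
          (reverse-involutive (snd z)))))
      (reverse-involutive (snd z))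

-- Halting states are made to idle, so that running on to the end of the clock does not disturb the
-- result.
deterministic : DTM → BitMachine
deterministic M = record { Q = DTM.Q M ; init = DTM.start M ; δ = λ i h _ → if DTM.halting M i then
    (i , h , mvS) else DTM.δ M i h ; flag = λ _ → true }

module _ (M : DTM) where
  open Simulation (deterministic M)

  dstep-tstep : ∀ i t c → let j , t' , _ = tstep (i , t , c) in dstep M (i , t) ≡ (j , t')
  dstep-tstep i t c with DTM.halting M i
  ... | true  = refl
  ... | false = refl

  drun-tstep : ∀ m i t c → let j , t' , _ = iter m tstep (i , t , c) in drun M m (i , t) ≡ (j , t')
  drun-tstep zero    i t c = refl
  drun-tstep (suc m) i t c = trans (cong (drun M m) (dstep-tstep i t c)) (drun-tstep m _ _ (tail c))

  dstep-halted : ∀ c → DTM.halting M (proj₁ c) ≡ true → dstep M c ≡ c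
  dstep-halted (i , t) h rewrite h = refl

  drun-halted : ∀ m c → DTM.halting M (proj₁ c) ≡ true → drun M m c ≡ c
  drun-halted zero    c h = refl
  drun-halted (suc m) c h = trans (cong (drun M m) (dstep-halted c h)) (drun-halted m c h)

  drun-+ : ∀ m k c → drun M (m + k) c ≡ drun M k (drun M m c)
  drun-+ zero    k c = refl
  drun-+ (suc m) k c = drun-+ m k (dstep M c)

  drun-late : ∀ {m m'} c → m ≤ m' → DTM.halting M (proj₁ (drun M m c)) ≡ true → drun M m' c ≡ drun M m c
  drun-late {m} {m'} c le h = trans (cong (λ i → drun M i c) (sym (ℕₚ.m+[n∸m]≡n le)))
    (trans (drun-+ m (m' ∸ m) c) (drun-halted (m' ∸ m) (drun M m c) h))

  runBits-computes : ∀ {f p} → Computes M f p → ∀ {T} x c → eval p (length x) ≤ T → runBits T x c ≡ true ∷ f x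
  runBits-computes co {T} x c le with co x
  ... | t , t≤ , h , o = cong (true ∷_) (trans (cong (readOut ∘ proj₂)
          (trans (sym (drun-tstep T (DTM.start M) (initTape x) c)) (drun-late _ (≤-trans t≤ le) h))) o)

first-fp : ∀ {f} → InFP f → SFP (λ z → pair (f (fst z)) (snd z))
-- The leading 1 of the outcome stands doubled at the front of the pair, so two `tail`s remove it.
first-fp {f} (M , p , co) = SFP-ext correct (tail-fp ∘ₛ tail-fp ∘ₛ Simulation.simulate-fp (deterministic M) p)
  where
  correct : ∀ z → tail (tail (pair (Simulation.runBits (deterministic M) (eval p (length z)) (fst z) (snd z))
      (snd z))) ≡ pair (f (fst z)) (snd z)
  correct z = cong (λ w → tail (tail (pair w (snd z))))
      (runBits-computes M {f} {p} co (fst z) (snd z) (eval-mono p (rev≤ (tsf z) (tsf-short z))))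

-- The tape left by the given machine is confined to registers of the simulating program, and these
-- are cleared at the end. With `SFP⇒InFP` this gives the closure properties of polynomial-time
-- functions.
InFP⇒SFP : ∀ {f} → InFP f → SFP f
InFP⇒SFP {f} h = SFP-ext (λ x → trans (fst-pair _ _) (cong f (fst-pair x x))) (fst-fp ∘ₛ first-fp h ∘ₛ dup)

⟪_,_⟫ : ∀ {f g} → SFP f → SFP g → SFP (λ x → pair (f x) (g x))
⟪_,_⟫ {f} {g} hf hg = SFP-ext correct (first-fp (SFP⇒InFP hf) ∘ₛ swap ∘ₛ first-fp (SFP⇒InFP hg) ∘ₛ dup)
  where
  correct : ∀ x → let z = pair (g (fst (pair x x))) (snd (pair x x))
                      w = pair (snd z) (fst z)
                  in pair (f (fst w)) (snd w) ≡ pair (f x) (g x)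
  correct x rewrite fst-pair x x | snd-pair x x | fst-pair (g x) x | snd-pair (g x) x
                  | fst-pair x (g x) | snd-pair x (g x) = refl

op₂ : ∀ {h : Str → Str → Str} {f g} → SFP (λ z → h (fst z) (snd z)) → SFP f → SFP g → SFP (λ x → h (f x) (g x))
op₂ {h} {f} {g} hh hf hg = SFP-ext (λ x → cong₂ h (fst-pair (f x) (g x)) (snd-pair (f x) (g x))) (hh ∘ₛ ⟪ hf , hg ⟫)

-- Counting strings of given length

extend : Str → List Str
extend x = (false ∷ x) ∷ (true ∷ x) ∷ []

extend-fresh : ∀ b {x} xs → All (x ≢_) xs → All ((b ∷ x) ≢_) (concatMap extend xs)
extend-fresh b []       []       = []
extend-fresh b (y ∷ xs) (n ∷ ns) = (λ { refl → n refl }) ∷ (λ { refl → n refl }) ∷ extend-fresh b xs ns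

extend-unique : ∀ {xs} → Unique xs → Unique (concatMap extend xs)
extend-unique []       = []
extend-unique {x ∷ xs} (n ∷ u) = ((λ ()) ∷ extend-fresh false xs n) ∷ extend-fresh true xs n ∷ extend-unique u

strings-unique : ∀ n → Unique (strings n)
strings-unique zero    = [] ∷ []
strings-unique (suc n) = extend-unique (strings-unique n)

extend-∈ : ∀ b {x} xs → x ∈ xs → b ∷ x ∈ concatMap extend xs
extend-∈ false (x ∷ xs) (here refl) = here refl
extend-∈ true  (x ∷ xs) (here refl) = there (here refl)
extend-∈ b     (x ∷ xs) (there i)   = there (there (extend-∈ b xs i))

extend-length : ∀ {n} xs → (∀ {x} → x ∈ xs → length x ≡ n) → ∀ {w} → w ∈ concatMap extend xs → length w ≡ suc n
extend-length (x ∷ xs) h (here refl)         = cong suc (h (here refl))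
extend-length (x ∷ xs) h (there (here refl)) = cong suc (h (here refl))
extend-length (x ∷ xs) h (there (there i))   = extend-length xs (h ∘ there) i

∈-strings⁺ : ∀ x → x ∈ strings (length x)
∈-strings⁺ []      = here refl
∈-strings⁺ (b ∷ x) = extend-∈ b _ (∈-strings⁺ x)

∈-strings⁻ : ∀ n {x} → x ∈ strings n → length x ≡ n
∈-strings⁻ zero    (here refl) = refl
∈-strings⁻ (suc n) i = extend-length (strings n) (∈-strings⁻ n) i

selected : (Str → Bool) → ℕ → List Str
selected P n = filter (λ w → P w Bool.≟ true) (strings n)

selected-unique : ∀ P n → Unique (selected P n)
selected-unique P n = Uniqueₚ.filter⁺ (λ w → P w Bool.≟ true) (strings-unique n)

∈-selected : ∀ P n {w} → w ∈ selected P n ⇔ (length w ≡ n × P w ≡ true)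
∈-selected P n = mk⇔
  (λ i → let j , e = ∈-filter⁻ (λ w → P w Bool.≟ true) {xs = strings n} i in ∈-strings⁻ n j , e)
  (λ { (refl , e) → ∈-filter⁺ (λ w → P w Bool.≟ true) (∈-strings⁺ _) e })

countLen-selected : ∀ P n → countLen P n ≡ length (selected P n)
countLen-selected P n = go (strings n)
  where
  go : ∀ xs → sum (map (λ y → if P y then 1 else 0) xs) ≡ length (filter (λ w → P w Bool.≟ true) xs)
  go []       = refl
  go (x ∷ xs) with P x
  ... | true  = cong suc (go xs)
  ... | false = go xs

-- Duplicate-free lists with the same members are permutations of each other. This reduces every
-- later count to exhibiting a list.
countLen-unique : ∀ P n {ws} → Unique ws → (∀ {w} → w ∈ ws ⇔ (length w ≡ n × P w ≡ true)) → countLen P n ≡ length ws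
countLen-unique P n {ws} u m = trans (countLen-selected P n)
  (↭-length (∼bag⇒↭ (unique∧set⇒bag (selected-unique P n) u
    (λ {w} → mk⇔ (λ i → Equivalence.from m (Equivalence.to (∈-selected P n) i))
                 (λ i → Equivalence.from (∈-selected P n) (Equivalence.to m i))))))

-- Well-formed pairs

length-pair : ∀ x y → length (pair x y) ≡ 2 * length x + 2 + length y
length-pair []      y = refl
length-pair (b ∷ x) y = trans (cong (_+_ 2) (length-pair x y)) (lem (length x) (length y))
  where
  lem : ∀ a b → suc (suc (2 * a + 2 + b)) ≡ 2 * suc a + 2 + b
  lem = solve-∀

pair-injective : ∀ {x y x' y'} → pair x y ≡ pair x' y' → x ≡ x' × y ≡ y'
pair-injective {x} {y} {x'} {y'} e =
  trans (sym (fst-pair x y)) (trans (cong fst e) (fst-pair x' y')) ,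
  trans (sym (snd-pair x y)) (trans (cong snd e) (snd-pair x' y'))

pairSize : Poly → Poly
pairSize p = padd (2 ∷ 2 ∷ []) p

eval-pairSize : ∀ p n → eval (pairSize p) n ≡ 2 * n + 2 + eval p n
eval-pairSize p n = trans (eval-add (2 ∷ 2 ∷ []) p n) (cong (_+ eval p n) (lem n))
  where
  lem : ∀ n → 2 + n * (2 + n * 0) ≡ 2 * n + 2
  lem = solve-∀

pairSize-< : ∀ p {m n} → m < n → eval (pairSize p) m < eval (pairSize p) n
pairSize-< p {m} {n} lt rewrite eval-pairSize p m | eval-pairSize p n =
  ℕₚ.+-mono-<-≤ (ℕₚ.+-monoˡ-< 2 (ℕₚ.*-monoʳ-< 2 lt)) (eval-mono p (ℕₚ.<⇒≤ lt))

pairSize-injective : ∀ p {m n} → eval (pairSize p) m ≡ eval (pairSize p) n → m ≡ n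
pairSize-injective p {m} {n} e = ℕₚ.≤-antisym
  (ℕₚ.≮⇒≥ (λ lt → ℕₚ.<-irrefl (sym e) (pairSize-< p lt)))
  (ℕₚ.≮⇒≥ (λ lt → ℕₚ.<-irrefl e (pairSize-< p lt)))

length-pair-eval : ∀ p x y → length y ≡ eval p (length x) → length (pair x y) ≡ eval (pairSize p) (length x)
length-pair-eval p x y e = trans (length-pair x y)
    (trans (cong (_+_ (2 * length x + 2)) e) (sym (eval-pairSize p (length x))))

nonempty : Str → Bool
nonempty []      = false
nonempty (_ ∷ _) = true

guard-nonempty⁻ : ∀ a b → nonempty (guardElse [] a b) ≡ true → nonempty a ≡ true × nonempty b ≡ true
guard-nonempty⁻ (_ ∷ a) b e = refl , e

guard-nonempty⁺ : ∀ a b → nonempty a ≡ true → nonempty b ≡ true → nonempty (guardElse [] a b) ≡ true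
guard-nonempty⁺ (_ ∷ a) b e e' = e'

eq-nonempty⁻ : ∀ x y → nonempty (eq x y) ≡ true → x ≡ y
eq-nonempty⁻ x y e with x ≟S y
... | yes p = p
eq-nonempty⁻ x y () | no _

eq-nonempty⁺ : ∀ {x y} → x ≡ y → nonempty (eq x y) ≡ true
eq-nonempty⁺ {x} {y} e with x ≟S y
... | yes _ = refl
... | no ne = contradiction e ne

-- `fst` and `snd` return something on every string, so pairs are recognised by pairing the
-- components again and comparing. The function r additionally forces a first component that it
-- fixes: `canonical` fixes just the tally strings, the identity everything. Lengths are compared in
-- unary.
wellFormed : (Str → Str) → Poly → Str → Str
wellFormed r p w = guardElse [] (eq w (pair (r (fst w)) (snd w)))
  (eq (ones (eval pid (length (snd w)))) (ones (eval p (length (fst w)))))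

wellFormed-fp : ∀ {r} → SFP r → ∀ p → SFP (wellFormed r p)
wellFormed-fp hr p = op₂ {guardElse []} (guardElse-fp [])
  (op₂ {eq} eq-fp id-fp ⟪ hr ∘ₛ fst-fp , snd-fp ⟫)
  (op₂ {eq} eq-fp (poly-fp pid ∘ₛ snd-fp) (poly-fp p ∘ₛ fst-fp))

wellFormed⁻ : ∀ r p w → nonempty (wellFormed r p w) ≡ true →
              w ≡ pair (r (fst w)) (snd w) × length (snd w) ≡ eval p (length (fst w))
wellFormed⁻ r p w e with guard-nonempty⁻ _ _ e
... | e₁ , e₂ = eq-nonempty⁻ _ _ e₁ , (begin
  length (snd w)                          ≡⟨ sym (eval-id _) ⟩
  eval pid (length (snd w))               ≡⟨ sym (length-replicate _) ⟩
  length (ones (eval pid (length (snd w)))) ≡⟨ cong length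
      (eq-nonempty⁻ (ones (eval pid (length (snd w)))) (ones (eval p (length (fst w)))) e₂) ⟩
  length (ones (eval p (length (fst w)))) ≡⟨ length-replicate _ ⟩
  eval p (length (fst w))                 ∎)
  where open ≡-Reasoning

wellFormed⁺ : ∀ r p x y → r x ≡ x → length y ≡ eval p (length x) → nonempty (wellFormed r p (pair x y)) ≡ true
wellFormed⁺ r p x y e l rewrite fst-pair x y | snd-pair x y = guard-nonempty⁺ _ _
  (eq-nonempty⁺ (cong (λ z → pair z y) (sym e))) (eq-nonempty⁺ (cong ones (trans (eval-id (length y)) l)))

-- Reductions within the polynomial hierarchy

InFP-ext : ∀ {f g} → (∀ x → f x ≡ g x) → InFP f → InFP g
InFP-ext e (M , p , co) = M , p , λ x → let t , t≤ , h , o = co x in t , t≤ , h , trans o (e x)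

ΣP-ext : ∀ k {L L' : Language} → (∀ x → L x ≡ L' x) → ΣP k L → ΣP k L'
ΣP-ext zero    e h = InFP-ext (λ x → cong (if_then true ∷ [] else (false ∷ [])) (e x)) h
ΣP-ext (suc k) e (A , p , s , iff) = A , p , s , λ x → mk⇔
  (λ h → Equivalence.to (iff x) (trans (e x) h))
  (λ h → trans (sym (e x)) (Equivalence.from (iff x) h))

-- A reduction may answer directly, by [] for b; any other value (_ ∷ s) asks about s.
lift : Bool → Language → Language
lift b A []      = b
lift b A (_ ∷ s) = A s

-- Complementing a reduction with direct answers gives one of the same form with the opposite
-- default, which is what carries `ΣP-reduce` through the alternation.
not-lift : ∀ b A w → not (lift b A w) ≡ lift (not b) (λ z → not (A z)) w
not-lift b A []      = refl
not-lift b A (_ ∷ s) = refl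

take-++-length : ∀ (x : Str) y → take (length x) (x ++ y) ≡ x
take-++-length []      y = refl
take-++-length (b ∷ x) y = cong (b ∷_) (take-++-length x y)

tail-short : ∀ w → length (tail w) ≤ length w
tail-short []      = z≤n
tail-short (_ ∷ w) = ℕₚ.n≤1+n _

fits : ∀ {m n} (y : Str) → length y ≡ m → m ≤ n → length (y ++ ones (n ∸ m)) ≡ n
fits {m} {n} y refl le = trans (length-++ y) (trans (cong (_+_ m) (length-replicate (n ∸ m))) (ℕₚ.m+[n∸m]≡n le))

-- Induction on k. A certificate for x is one for the question asked by G, padded to a length that
-- depends on |x| only; the new matrix cuts it to the length the question calls for. A direct answer
-- of G is passed on as a direct answer with the same default, so the complement of the matrix is
-- again covered by the induction hypothesis, with the default negated.
ΣP-reduce : ∀ k {A} → ΣP k A → ∀ b {G} → SFP G → ΣP k (λ x → lift b A (G x))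
ΣP-reduce zero {A} h b {G} hG = SFP⇒InFP (SFP-ext correct
  (op₂ {guardElse (b ∷ [])} (guardElse-fp (b ∷ [])) hG (InFP⇒SFP h ∘ₛ tail-fp ∘ₛ hG)))
  where
  answer : Bool → Str
  answer c = if c then true ∷ [] else false ∷ []
  answer-id : ∀ c → c ∷ [] ≡ answer c
  answer-id true  = refl
  answer-id false = refl
  correct : ∀ x → guardElse (b ∷ []) (G x) (answer (A (tail (G x)))) ≡ answer (lift b A (G x))
  correct x with G x
  ... | []    = answer-id b
  ... | _ ∷ s = refl
ΣP-reduce (suc k) {A} (B , p , s , iff) b {G} hG = B' , p' , s' , iff'
  where
  ask : Str → Str
  ask w = ones (eval p (length (tail (G (fst w)))))
  query G' : Str → Str
  query w = true ∷ pair (tail (G (fst w))) (takeLen (ask w) (snd w))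
  G' w = guardElse [] (G (fst w)) (query w)
  hGf = hG ∘ₛ fst-fp
  hG' : SFP G'
  hG' = op₂ {guardElse []} (guardElse-fp []) hGf
    (cons-fp true ∘ₛ ⟪ tail-fp ∘ₛ hGf , op₂ {takeLen} take-fp (poly-fp p ∘ₛ tail-fp ∘ₛ hGf) snd-fp ⟫)
  B' : Language
  B' w = lift b B (G' w)
  p' : Poly
  p' = pcomp p (SFP.time hG)
  s' : ΣP k (λ w → not (B' w))
  s' = ΣP-ext k (λ w → sym (not-lift b B (G' w))) (ΣP-reduce k s (not b) hG')
  enough : ∀ x → eval p (length (tail (G x))) ≤ eval p' (length x)
  enough x rewrite eval-comp p (SFP.time hG) (length x) = eval-mono p (≤-trans (tail-short (G x)) (SFP.short hG x))
  B'-pair : ∀ x y → B' (pair x y) ≡ lift b B (guardElse [] (G x)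
      (true ∷ pair (tail (G x)) (take (eval p (length (tail (G x)))) y)))
  B'-pair x y rewrite fst-pair x y | snd-pair x y | length-replicate (eval p (length (tail (G x)))) {true} = refl
  iff' : ∀ x → (lift b A (G x) ≡ true) ⇔ (Σ[ y ∈ Str ] (length y ≡ eval p' (length x) × B' (pair x y) ≡ true))
  iff' x = mk⇔ to from
    where
    pad : Str → Str
    pad z = ones (eval p' (length x) ∸ eval p (length z))
    to : lift b A (G x) ≡ true → Σ[ y ∈ Str ] (length y ≡ eval p' (length x) × B' (pair x y) ≡ true)
    to h with G x | B'-pair x | enough x
    -- A direct answer does not depend on the certificate, but one of the right length still has to
    -- be exhibited.
    ... | []    | bp | le = ones (eval p' (length x)) , length-replicate _ , trans (bp _) h
    ... | _ ∷ z | bp | le =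
      let y , l , a = Equivalence.to (iff z) h
      in y ++ pad z , fits y l le ,
         trans (bp _) (trans (cong (λ u → B (pair z u))
             (trans (cong (λ i → take i (y ++ pad z)) (sym l)) (take-++-length y (pad z)))) a)
    from : Σ[ y ∈ Str ] (length y ≡ eval p' (length x) × B' (pair x y) ≡ true) → lift b A (G x) ≡ true
    from (y , l , a) with G x | B'-pair x y | enough x
    ... | []    | bp | le = trans (sym bp) a
    ... | _ ∷ z | bp | le = Equivalence.from (iff z) (take (eval p (length z)) y ,
      trans (length-take _ y) (ℕₚ.m≤n⇒m⊓n≡m (≤-trans le (≤-reflexive (sym l)))) , trans (sym bp) a)

-- Census functions and #₁·PH

canonical : Str → Str
canonical x = ones (eval pid (length x))

canonical-ones : ∀ n → canonical (ones n) ≡ ones n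
canonical-ones n = cong ones (trans (eval-id _) (length-replicate n))

InFP₁-pad : ∀ {g} p → InFP₁ g → ∀ {f} → (∀ n → f n ≡ g (eval p n)) → InFP₁ f
InFP₁-pad {g} p (h , hh , e) {f} fg = _ , SFP⇒InFP (InFP⇒SFP hh ∘ₛ poly-fp p) , λ n →
  trans (cong (λ m → h (ones (eval p m))) (length-replicate n)) (trans (e (eval p n)) (cong toBin (sym (fg n))))

census⇐sharp : ((f : ℕ → ℕ) → Sharp₁PH f → InFP₁ f) → (L : Language) → InPH L → HasFPCensus L
census⇐sharp h L (k , s) = h (census L) ((λ z → L (snd z)) , pid , (k , ΣP-reduce k s false (cons-fp true ∘ₛ snd-fp)) , eqn)
  where
  cong-count : ∀ {P Q : Language} → (∀ y → P y ≡ Q y) → ∀ xs →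
               sum (map (λ y → if P y then 1 else 0) xs) ≡ sum (map (λ y → if Q y then 1 else 0) xs)
  cong-count e []       = refl
  cong-count e (x ∷ xs) rewrite e x = cong (_+_ _) (cong-count e xs)
  eqn : ∀ n → census L n ≡ countLen (λ y → L (snd (pair (ones n) y))) (eval pid n)
  eqn n rewrite eval-id n = cong-count (λ y → cong L (sym (snd-pair (ones n) y))) (strings n)

census⇒sharp : ((L : Language) → InPH L → HasFPCensus L) → (f : ℕ → ℕ) → Sharp₁PH f → InFP₁ f
census⇒sharp h f (A , p , (k , s) , fA) = InFP₁-pad (pairSize p) (h L (k , ΣP-reduce k s false hG))
    (λ n → trans (fA n) (sym (count n)))
  where
  G : Str → Str
  G w = guardElse [] (wellFormed canonical p w) (true ∷ w)
  hG : SFP G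
  hG = op₂ {guardElse []} (guardElse-fp []) (wellFormed-fp (poly-fp pid) p) (cons-fp true)
  L : Language
  L w = lift false A (G w)
  L⁻ : ∀ w → L w ≡ true → nonempty (wellFormed canonical p w) ≡ true × A w ≡ true
  L⁻ w e with wellFormed canonical p w
  ... | _ ∷ _ = refl , e
  L⁺ : ∀ w → nonempty (wellFormed canonical p w) ≡ true → A w ≡ true → L w ≡ true
  L⁺ w e a with wellFormed canonical p w
  ... | _ ∷ _ = a
  count : ∀ n → countLen L (eval (pairSize p) n) ≡ countLen (λ y → A (pair (ones n) y)) (eval p n)
  count n = trans (countLen-unique L _ (Uniqueₚ.map⁺ (λ e → proj₂ (pair-injective {ones n} {_} {ones n} e))
      (selected-unique P (eval p n))) (mk⇔ to from))
    (trans (length-map (pair (ones n)) (selected P (eval p n))) (sym (countLen-selected P (eval p n))))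
    where
    P : Str → Bool
    P y = A (pair (ones n) y)
    to : ∀ {w} → w ∈ map (pair (ones n)) (selected P (eval p n)) → length w ≡ eval (pairSize p) n × L w ≡ true
    to i with y , j , refl ← ∈-map⁻ (pair (ones n)) i with l , a ← Equivalence.to (∈-selected P (eval p n)) j =
      trans (length-pair-eval p (ones n) y l') (cong (eval (pairSize p)) (length-replicate n)) ,
      L⁺ (pair (ones n) y) (wellFormed⁺ canonical p (ones n) y (canonical-ones n) l') a
      where
      l' : length y ≡ eval p (length (ones n))
      l' = trans l (cong (eval p) (sym (length-replicate n)))
    from : ∀ {w} → length w ≡ eval (pairSize p) n × L w ≡ true → w ∈ map (pair (ones n)) (selected P (eval p n))
    from {w} (l , e) = subst (_∈ _) (sym w≡) (∈-map⁺ (pair (ones n))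
      (Equivalence.from (∈-selected P (eval p n)) (trans sl (cong (eval p) n≡) , trans (cong A (sym w≡)) a)))
      where
      wf = proj₁ (L⁻ w e)
      a  = proj₂ (L⁻ w e)
      x = fst w
      y = snd w
      w₁ : w ≡ pair (canonical x) y
      w₁ = proj₁ (wellFormed⁻ canonical p w wf)
      sl : length y ≡ eval p (length x)
      sl = proj₂ (wellFormed⁻ canonical p w wf)
      n≡ : length x ≡ n
      n≡ = pairSize-injective p (trans (sym (trans (cong length w₁) (trans (length-pair-eval p (canonical x) y
             (trans sl (cong (eval p) (sym len)))) (cong (eval (pairSize p)) len)))) l)
        where
        len : length (canonical x) ≡ length x
        len = trans (length-replicate _) (eval-id _)
      w≡ : w ≡ pair (ones n) y
      w≡ = trans w₁ (cong (λ m → pair (ones m) y) (trans (eval-id _) n≡))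

-- Nondeterministic machines as bit-driven machines

option : ∀ {A : Set} → List A → ℕ → Maybe A
option []       _       = nothing
option (x ∷ xs) zero    = just x
option (x ∷ xs) (suc i) = option xs i

option-∈ : ∀ {A : Set} (xs : List A) i {x} → option xs i ≡ just x → x ∈ xs
option-∈ (x ∷ xs) zero    refl = here refl
option-∈ (x ∷ xs) (suc i) e    = there (option-∈ xs i e)

∈-option : ∀ {A : Set} {xs : List A} {x} → x ∈ xs → Σ[ i ∈ ℕ ] (i < length xs × option xs i ≡ just x)
∈-option (here refl) = 0 , s≤s z≤n , refl
∈-option (there m)   = let i , lt , e = ∈-option m in suc i , s≤s lt , e

maximum : ∀ {n} → (Fin n → ℕ) → ℕ
maximum {zero}  f = 0
maximum {suc n} f = f zero ⊔ maximum (f ∘ suc)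

≤-maximum : ∀ {n} (f : Fin n → ℕ) i → f i ≤ maximum f
≤-maximum f zero    = ℕₚ.m≤m⊔n _ _
≤-maximum f (suc i) = ≤-trans (≤-maximum (f ∘ suc) i) (ℕₚ.m≤n⊔m (f zero) _)

module Nondeterministic (N : NTM) where
  open NTM N

  branching : ℕ
  branching = maximum (λ i → length (δ i b0) ⊔ (length (δ i b1) ⊔ length (δ i blank)))

  ≤-branching : ∀ i h → length (δ i h) ≤ branching
  ≤-branching i h = ≤-trans (lem h) (≤-maximum _ i)
    where
    lem : ∀ h → length (δ i h) ≤ length (δ i b0) ⊔ (length (δ i b1) ⊔ length (δ i blank))
    lem b0    = ℕₚ.m≤m⊔n _ _
    lem b1    = ≤-trans (ℕₚ.m≤m⊔n _ _) (ℕₚ.m≤n⊔m (length (δ i b0)) _)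
    lem blank = ≤-trans (ℕₚ.m≤n⊔m (length (δ i b1)) _) (ℕₚ.m≤n⊔m (length (δ i b0)) _)

  -- A transition list may have any number of entries while the driving bits are two-valued, so a
  -- choice is spelled in unary: the pointer counts the 1s read since the last transition.
  Pointer : Set
  Pointer = Fin (suc branching)

  inc : Pointer → Pointer
  inc j with suc (toℕ j) <? suc branching
  ... | yes lt = fromℕ< lt
  ... | no _   = j

  toℕ-inc : ∀ j → toℕ j < branching → toℕ (inc j) ≡ suc (toℕ j)
  toℕ-inc j lt with suc (toℕ j) <? suc branching
  ... | yes lt' = toℕ-fromℕ< lt'
  ... | no nlt  = contradiction (s≤s lt) nlt

  -- Bit 1 moves the pointer to the next applicable transition, bit 0 takes the one pointed at.
  taking : Fin Q → Pointer → Sym → Maybe (Fin Q × Sym × Move) → Fin (Q * suc branching) × Sym × Move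
  taking i j h nothing             = combine i j , h , mvS
  taking i j h (just (i' , s , m)) = combine i' (zero {branching}) , s , m

  following : Fin Q × Pointer → Sym → Bool → Fin (Q * suc branching) × Sym × Move
  following (i , j) h b with halting i
  ... | true = combine i j , h , mvS
  following (i , j) h true  | false = combine i (inc j) , h , mvS
  following (i , j) h false | false = taking i j h (option (δ i h) (toℕ j))

  stateOf : Fin (Q * suc branching) → Fin Q
  stateOf k = proj₁ (remQuot {Q} (suc branching) k)

  bitDriven : BitMachine
  bitDriven = record
    { Q    = Q * suc branching
    ; init = combine start (zero {branching})
    ; δ    = λ k → following (remQuot {Q} (suc branching) k)
    ; flag = λ k → halting (stateOf k) ∧ accept (stateOf k)
    }

  open Simulation bitDriven public

  follow : Fin Q × Pointer → Tape → Str → Fin (Q * suc branching) × Tape × Str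
  follow ij t c = let k , s , m = following ij (Tape.head t) (hdB c) in k , move m (write s t) , tail c

  tstep-combine : ∀ i j t c → tstep (combine i j , t , c) ≡ follow (i , j) t c
  tstep-combine i j t c = cong (λ ij → follow ij t c) (remQuot-combine {Q} {suc branching} i j)

  stateOf-combine : ∀ i j → stateOf (combine i j) ≡ i
  stateOf-combine i j = cong proj₁ (remQuot-combine {Q} {suc branching} i j)

  follow-cases : ∀ i j t c → Σ[ i' ∈ Fin Q ] Σ[ j' ∈ Pointer ] Σ[ t' ∈ Tape ]
    (follow (i , j) t c ≡ (combine i' j' , t' , tail c) × ((i , t) ≡ (i' , t') ⊎ NStep N (i , t) (i' , t')))
  follow-cases i j t c with halting i in h
  ... | true = i , j , t , refl , inj₁ refl
  ... | false with hdB c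
  ...   | true = i , inc j , t , refl , inj₁ refl
  ...   | false with option (δ i (Tape.head t)) (toℕ j) in o
  ...     | nothing            = i , j , t , refl , inj₁ refl
  ...     | just (i' , s , m) = i' , zero , _ , refl , inj₂ (nstep h (option-∈ _ (toℕ j) o))

  -- Each driven step either leaves state and tape alone, when the pointer moves or nothing applies,
  -- or is one step of N.
  sound : ∀ T i j t c → let k , t' , _ = iter T tstep (combine i j , t , c) in
          Σ[ n ∈ ℕ ] NSteps N n (i , t) (stateOf k , t')
  sound zero    i j t c = 0 , subst (λ k → NSteps N 0 (i , t) (k , t)) (sym (stateOf-combine i j)) done
  sound (suc T) i j t c with follow-cases i j t c
  ... | i' , j' , t' , e , r = subst
      (λ u → let k , t' , _ = iter T tstep u in Σ[ n ∈ ℕ ] NSteps N n (i , t) (stateOf k , t'))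
      (sym (trans (tstep-combine i j t c) e)) (prepend r (sound T i' j' t' (tail c)))
    where
    prepend : ∀ {c c' c''} → c ≡ c' ⊎ NStep N c c' → Σ[ n ∈ ℕ ] NSteps N n c' c'' → Σ[ n ∈ ℕ ] NSteps N n c c''
    prepend (inj₁ refl) ss       = ss
    prepend (inj₂ st)   (n , ss) = suc n , more st ss

  runBits-sound : ∀ T x c z → runBits T x c ≡ true ∷ z → AccOut N x z
  runBits-sound T x c z e with iter T tstep (BitMachine.init bitDriven , initTape x , c) | sound T start zero (initTape x) c
  ... | k , t , _ | n , ss with halting (stateOf k) in h | accept (stateOf k) in a
  runBits-sound T x c z refl | k , t , _ | n , ss | true | true = n , (stateOf k , t) , ss , h , a , refl

  advance : ∀ i t c d j → halting i ≡ false → toℕ j + d ≤ branching →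
            Σ[ j' ∈ Pointer ] (toℕ j' ≡ toℕ j + d × iter d tstep (combine i j , t , ones d ++ c) ≡ (combine i j' , t , c))
  advance i t c zero    j h le = j , sym (ℕₚ.+-identityʳ _) , refl
  advance i t c (suc d) j h le =
    let j' , e , r = advance i t c d (inc j) h (≤-trans
              (≤-reflexive (trans (cong (_+ d) inc≡) (sym (ℕₚ.+-suc (toℕ j) d)))) le)
    in j' , trans e (trans (cong (_+ d) inc≡) (sym (ℕₚ.+-suc (toℕ j) d))) , trans (cong (iter d tstep) one) r
    where
    inc≡ : toℕ (inc j) ≡ suc (toℕ j)
    inc≡ = toℕ-inc j (≤-trans (≤-by d (sym (ℕₚ.+-suc (toℕ j) d))) le)
    one : tstep (combine i j , t , ones (suc d) ++ c) ≡ (combine i (inc j) , t , ones d ++ c)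
    one = trans (tstep-combine i j t (ones (suc d) ++ c)) same
      where
      same : follow (i , j) t (ones (suc d) ++ c) ≡ (combine i (inc j) , t , ones d ++ c)
      same rewrite h = refl

  take-option : ∀ i t c j {i' s m} → halting i ≡ false → option (δ i (Tape.head t)) (toℕ j) ≡ just (i' , s , m) →
                tstep (combine i j , t , false ∷ c) ≡ (combine i' zero , move m (write s t) , c)
  take-option i t c j {i'} {s} {m} h o = trans (tstep-combine i j t (false ∷ c)) same
    where
    same : follow (i , j) t (false ∷ c) ≡ (combine i' zero , move m (write s t) , c)
    same rewrite h | o = refl

  -- The transition at position d of its list is spelled by d ones and a zero; a fresh pointer
  -- stands at position 0.
  complete-step : ∀ {i t i' t'} → NStep N (i , t) (i' , t') →
    Σ[ e ∈ Str ] (length e ≤ suc branching × (∀ c →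
        iter (length e) tstep (combine i zero , t , e ++ c) ≡ (combine i' zero , t' , c)))
  complete-step {i} {t} {i'} (nstep {s = s} {m = m} h mem) = ones d ++ false ∷ [] , short , runs
    where
    d  = proj₁ (∈-option mem)
    lt = proj₁ (proj₂ (∈-option mem))
    o  = proj₂ (proj₂ (∈-option mem))
    len : length (ones d ++ false ∷ []) ≡ d + 1
    len = trans (length-++ (ones d)) (cong (_+ 1) (length-replicate d))
    short : length (ones d ++ false ∷ []) ≤ suc branching
    short = ≤-trans (≤-reflexive (trans len (ℕₚ.+-comm d 1)))
        (≤-trans lt (≤-trans (≤-branching i (Tape.head t)) (ℕₚ.n≤1+n _)))
    runs : ∀ c → iter (length (ones d ++ false ∷ [])) tstep
        (combine i zero , t , (ones d ++ false ∷ []) ++ c) ≡ (combine i' zero , move m (write s t) , c)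
    runs c with j , e , r ← advance i t (false ∷ c) d zero h (≤-trans (ℕₚ.<⇒≤ lt) (≤-branching i (Tape.head t))) = begin
      iter (length (ones d ++ false ∷ [])) tstep (combine i zero , t , (ones d ++ false ∷ []) ++ c)
        ≡⟨ cong₂ (λ n w → iter n tstep (combine i zero , t , w)) len (++-assoc (ones d) (false ∷ []) c) ⟩
      iter (d + 1) tstep (combine i zero , t , ones d ++ false ∷ c)
        ≡⟨ iter-+ d 1 tstep _ ⟩
      tstep (iter d tstep (combine i zero , t , ones d ++ false ∷ c))
        ≡⟨ cong tstep r ⟩
      tstep (combine i j , t , false ∷ c)
        ≡⟨ take-option i t c j h (trans (cong (option (δ i (Tape.head t))) e) o) ⟩
      (combine i' zero , move m (write s t) , c) ∎
      where open ≡-Reasoning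

  complete : ∀ {n i t i' t'} → NSteps N n (i , t) (i' , t') →
    Σ[ e ∈ Str ] (length e ≤ n * suc branching × (∀ c →
        iter (length e) tstep (combine i zero , t , e ++ c) ≡ (combine i' zero , t' , c)))
  complete done = [] , z≤n , λ c → refl
  complete {i = i} {t} (more {c' = i₁ , t₁} st ss) =
    let e₁ , l₁ , r₁ = complete-step st
        e₂ , l₂ , r₂ = complete ss
    in e₁ ++ e₂ , ≤-trans (≤-reflexive (length-++ e₁)) (+-mono-≤ l₁ l₂) , λ c →
       trans (cong₂ (λ n w → iter n tstep (combine i zero , t , w)) (length-++ e₁) (++-assoc e₁ e₂ c))
         (trans (iter-+ (length e₁) (length e₂) tstep _) (trans (cong (iter (length e₂) tstep) (r₁ (e₂ ++ c))) (r₂ c)))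

  halted : ∀ T i t c → halting i ≡ true → Σ[ c' ∈ Str ] (iter T tstep (combine i zero , t , c) ≡ (combine i zero , t , c'))
  halted zero    i t c h = c , refl
  halted (suc T) i t c h = let c' , e = halted T i t (tail c) h in c' , trans (cong (iter T tstep) one) e
    where
    one : tstep (combine i zero , t , c) ≡ (combine i zero , t , tail c)
    one = trans (tstep-combine i zero t c) same
      where
      same : follow (i , zero) t c ≡ (combine i zero , t , tail c)
      same rewrite h = refl

  -- Arbitrary further bits and time are allowed, since a halted machine idles. Both are needed:
  -- certificates are padded to a fixed length, and the clock depends on lengths only.
  runBits-complete : ∀ x {n i t} → NSteps N n (nInit N x) (i , t) → halting i ≡ true → accept i ≡ true →
    Σ[ e ∈ Str ] (length e ≤ n * suc branching × (∀ T c → length e ≤ T → runBits T x (e ++ c) ≡ true ∷ readOut t))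
  runBits-complete x {n} {i} {t} ss h a with complete ss
  ... | e , l , r = e , l , λ T c le →
    let c' , q = halted (T ∸ length e) i t c h
    in trans (cong outcome (trans (cong (λ m → iter m tstep (combine start zero , initTape x , e ++ c))
          (sym (ℕₚ.m+[n∸m]≡n le)))
         (trans (iter-+ (length e) (T ∸ length e) tstep _) (trans (cong (iter (T ∸ length e) tstep) (r c)) q)))) (final c')
    where
    final : ∀ c → outcome (combine i zero , t , c) ≡ true ∷ readOut t
    final c = trans (cong shown (cong₂ _∧_ (trans (cong halting (stateOf-combine i zero)) h)
        (trans (cong accept (stateOf-combine i zero)) a))) refl
      where
      shown : Bool → Str
      shown b = if b then true ∷ readOut t else []

  rightOf : Tape → List Sym
  rightOf t = Tape.head t ∷ Tape.right t

  move-right : ∀ m s t → length (rightOf (move m (write s t))) ≤ suc (length (rightOf t))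
  move-right mvS s t = ℕₚ.n≤1+n _
  move-right mvL s (tape [] h r) = ≤-refl
  move-right mvL s (tape (_ ∷ l) h r) = ≤-refl
  move-right mvR s (tape l h []) = ℕₚ.n≤1+n _
  move-right mvR s (tape l h (_ ∷ r)) = ≤-trans (ℕₚ.n≤1+n _) (ℕₚ.n≤1+n _)

  NSteps-right : ∀ {n i t i' t'} → NSteps N n (i , t) (i' , t') → length (rightOf t') ≤ n + length (rightOf t)
  NSteps-right done = ≤-refl
  NSteps-right {suc n} {t = t} (more (nstep {s = s} {m = m} h mem) ss) = ≤-trans (NSteps-right ss)
    (≤-trans (+-monoʳ-≤ n (move-right m s t)) (≤-reflexive (ℕₚ.+-suc n _)))

  output-short : ∀ x {n i t} → NSteps N n (nInit N x) (i , t) → length (readOut t) ≤ n + suc (length x)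
  output-short x {n} {t = t} ss = ≤-trans (readSyms-short (rightOf t))
      (≤-trans (NSteps-right ss) (+-monoʳ-≤ n (init-right x)))
    where
    init-right : ∀ x → length (rightOf (initTape x)) ≤ suc (length x)
    init-right []      = ≤-refl
    init-right (_ ∷ x) = s≤s (≤-trans (≤-reflexive (length-map bit x)) (ℕₚ.n≤1+n _))

-- From census functions to spanP₁

-- The doubled z and the separator fill exactly 2|z| + 2 symbols, so a later cut shortens only the
-- second component.
take-pair : ∀ z s l → 2 * length z + 2 ≤ l → Σ[ s' ∈ Str ] (take l (pair z s) ≡ pair z s')
take-pair []      s (suc zero)    (s≤s ())
take-pair []      s (suc (suc l)) le = take l s , refl
take-pair (b ∷ z) s l le with subst (_≤ l) (lem (length z)) le
  where
  lem : ∀ a → 2 * suc a + 2 ≡ suc (suc (2 * a + 2))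
  lem = solve-∀
take-pair (b ∷ z) s (suc (suc l)) le | s≤s (s≤s le') = let s' , e = take-pair z s l le' in s' , cong (λ w → b ∷ b ∷ w) e

module SpanToCensus (N : NTM) (p : Poly) (timed : TallyPolyTime N p) (f : ℕ → ℕ) (span : IsSpan N f) where
  open Nondeterministic N

  outputs : ℕ → List Str
  outputs n = proj₁ (span n)

  outputs-unique : ∀ n → Unique (outputs n)
  outputs-unique n = proj₁ (proj₂ (span n))

  ∈-outputs : ∀ n z → z ∈ outputs n ⇔ AccOut N (ones n) z
  ∈-outputs n = proj₁ (proj₂ (proj₂ (span n)))

  -- Large enough for every output, and for the bits driving any run.
  room : Poly
  room = padd (pscale 2 (padd (1 ∷ 1 ∷ []) p)) (padd (pconst 2) (pscale (suc branching) p))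

  -- An output has at most n + 1 + p(n) symbols, which are doubled and followed by a separator of
  -- length 2; the last summand is one unary choice for each of p(n) steps.
  room-val : ∀ n → eval room n ≡ 2 * (suc n + eval p n) + (2 + suc branching * eval p n)
  room-val n rewrite eval-add (pscale 2 (padd (1 ∷ 1 ∷ []) p)) (padd (pconst 2) (pscale (suc branching) p)) n
    | eval-scale 2 (padd (1 ∷ 1 ∷ []) p) n | eval-add (1 ∷ 1 ∷ []) p n
    | eval-add (pconst 2) (pscale (suc branching) p) n | eval-scale (suc branching) p n | ℕₚ.*-zeroʳ n | ℕₚ.*-identityʳ n =
        refl

  -- Gives all outputs for n one length while keeping them readable: the doubled code of z ends
  -- itself, so it does not matter where the filler is cut.
  padded : ℕ → Str → Str
  padded n z = takeLen (ones (eval room n)) (pair z (ones (eval room n)))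

  word : ℕ → Str → Str
  word n z = pair (ones n) (padded n z)

  output-fits : ∀ n {z} → AccOut N (ones n) z → 2 * length z + 2 ≤ eval room n
  output-fits n (k , (i , t) , ss , h , a , refl) rewrite room-val n = ≤-trans
    (+-mono-≤ (*-mono-≤ (≤-refl {2}) (≤-trans (output-short (ones n) ss)
      (≤-trans (+-mono-≤ (timed n k _ ss) (s≤s (≤-reflexive (length-replicate n))))
          (≤-reflexive (ℕₚ.+-comm (eval p n) (suc n)))))) (≤-refl {2}))
    (+-monoʳ-≤ (2 * (suc n + eval p n)) (m≤m+n 2 _))

  bits-fit : ∀ n {k} → k ≤ eval p n → k * suc branching ≤ eval (pairSize room) n
  bits-fit n {k} le rewrite eval-pairSize room n | room-val n = ≤-trans (*-mono-≤ le (≤-refl {suc branching}))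
    (≤-trans (≤-reflexive (ℕₚ.*-comm (eval p n) (suc branching)))
      (≤-trans (≤-trans (m≤n+m _ 2) (m≤n+m _ (2 * (suc n + eval p n)))) (m≤n+m _ (2 * n + 2))))

  padded-length : ∀ n z → length (padded n z) ≡ eval room n
  padded-length n z = begin
    length (padded n z)                                   ≡⟨ length-take _ (pair z (ones r)) ⟩
    length (ones r) ⊓ length (pair z (ones r))            ≡⟨ ℕₚ.m≤n⇒m⊓n≡m
        (≤-trans (m≤n+m _ _) (≤-reflexive (sym (length-pair z (ones r))))) ⟩
    length (ones r)                                       ≡⟨ length-replicate r ⟩
    r                                                     ∎
    where
    open ≡-Reasoning
    r = eval room n

  padded-fst : ∀ n {z} → 2 * length z + 2 ≤ eval room n → fst (padded n z) ≡ z
  padded-fst n {z} le with s' , e ← take-pair z (ones (eval room n)) (length (ones (eval room n)))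
      (subst (2 * length z + 2 ≤_) (sym (length-replicate _)) le)
    = trans (cong fst e) (fst-pair z s')

  index : Str → ℕ
  index w = length (fst w)

  index-word : ∀ n z → index (word n z) ≡ n
  index-word n z = trans (cong length (fst-pair (ones n) (padded n z))) (length-replicate n)

  word-length : ∀ n z → length (word n z) ≡ eval (pairSize room) n
  word-length n z = trans (length-pair-eval room (ones n) (padded n z)
      (trans (padded-length n z) (cong (eval room) (sym (length-replicate n)))))
    (cong (eval (pairSize room)) (length-replicate n))

  named? : ∀ w → Dec _
  named? w = any? (λ z → w ≟S word (index w) z) (outputs (index w))

  -- Decided by searching the list of outputs that `IsSpan` supplies, with no regard to time;
  -- efficiency enters only through the certificates in `L⇔A`.
  L : Language
  L w = does (named? w)

  L⁻ : ∀ w → L w ≡ true → Σ[ z ∈ Str ] (z ∈ outputs (index w) × w ≡ word (index w) z)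
  L⁻ w e with named? w
  ... | yes a = let z , i , e' = find a in z , i , e'
  L⁻ w () | no _

  L⁺ : ∀ w {z} → z ∈ outputs (index w) → w ≡ word (index w) z → L w ≡ true
  L⁺ w i e = dec-true (named? w) (lose i e)

  -- Here v is a word w paired with driving bits. The run on the tally yields an output, from which
  -- the only admissible word is rebuilt; comparing it with w tests form and content together. The
  -- clock is the length of the pair handed to the simulation, hence at least the number of bits.
  tally answer check : Str → Str
  tally v = ones (eval pid (index (fst v)))
  answer v = runBits (eval pid (length (pair (tally v) (snd v)))) (tally v) (snd v)
  check v = guardElse [] (answer v) (eq (fst v)
    (pair (tally v) (takeLen (ones (eval room (index (fst v))))
        (pair (tail (answer v)) (ones (eval room (index (fst v))))))))

  A : Language
  A v = nonempty (check v)

  answer-fp : SFP answer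
  answer-fp = SFP-ext correct (fst-fp ∘ₛ simulate-fp pid ∘ₛ ⟪ poly-fp pid ∘ₛ fst-fp ∘ₛ fst-fp , snd-fp ⟫)
    where
    correct : ∀ v → let z = pair (tally v) (snd v) in
              fst (pair (runBits (eval pid (length z)) (fst z) (snd z)) (snd z)) ≡ answer v
    correct v = trans (fst-pair (runBits T (fst z) (snd z)) (snd z))
      (cong₂ (runBits T) (fst-pair (tally v) (snd v)) (snd-pair (tally v) (snd v)))
      where
      z = pair (tally v) (snd v)
      T = eval pid (length z)

  check-fp : SFP check
  check-fp = op₂ {guardElse []} (guardElse-fp []) answer-fp (op₂ {eq} eq-fp fst-fp
    ⟪ poly-fp pid ∘ₛ fst-fp ∘ₛ fst-fp , op₂ {takeLen} take-fp room-fp ⟪ tail-fp ∘ₛ answer-fp , room-fp ⟫ ⟫)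
    where
    room-fp : SFP (λ v → ones (eval room (index (fst v))))
    room-fp = poly-fp room ∘ₛ fst-fp ∘ₛ fst-fp

  A-inP : InP (λ v → not (A v))
  A-inP = SFP⇒InFP (SFP-ext correct (op₂ {guardElse (true ∷ [])} (guardElse-fp (true ∷ [])) check-fp
      (const-fp (false ∷ []))))
    where
    correct : ∀ v → guardElse (true ∷ []) (check v) (false ∷ []) ≡ (if not (A v) then true ∷ [] else false ∷ [])
    correct v with check v
    ... | []    = refl
    ... | _ ∷ _ = refl

  runBits-flag : ∀ T x c → nonempty (runBits T x c) ≡ true → runBits T x c ≡ true ∷ tail (runBits T x c)
  runBits-flag T x c e with iter T tstep (BitMachine.init bitDriven , initTape x , c)
  ... | k , t , _ with BitMachine.flag bitDriven k
  ...   | true = refl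

  L⇔A : ∀ w → (L w ≡ true) ⇔ (Σ[ y ∈ Str ] (length y ≡ eval pid (length w) × A (pair w y) ≡ true))
  L⇔A w = mk⇔ to from
    where
    n = index w
    to : L w ≡ true → Σ[ y ∈ Str ] (length y ≡ eval pid (length w) × A (pair w y) ≡ true)
    to l with z , mem , w≡ ← L⁻ w l
         with k , (i , t) , ss , h , a , refl ← Equivalence.to (∈-outputs n z) mem
         with e , el , r ← runBits-complete (ones n) ss h a
      = y , trans (fits e refl e≤) (sym (eval-id _)) , good
      where
      -- The share of the bits in `room` makes w itself at least as long as any driving string, so
      -- certificates can have the length of w.
      e≤ : length e ≤ length w
      e≤ = ≤-trans el (≤-trans (bits-fit n (timed n k _ ss))
          (≤-reflexive (trans (sym (word-length n z)) (cong length (sym w≡)))))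
      y = e ++ ones (length w ∸ length e)
      good : A (pair w y) ≡ true
      good rewrite fst-pair w y | snd-pair w y | eval-id n
        | r (eval pid (length (pair (ones n) y))) (ones (length w ∸ length e))
            (≤-trans (≤-trans (m≤m+n _ _) (≤-reflexive (sym (length-++ e))))
                (≤id (≤-trans (m≤n+m _ _) (≤-reflexive (sym (length-pair (ones n) y))))))
        = eq-nonempty⁺ w≡
    from : Σ[ y ∈ Str ] (length y ≡ eval pid (length w) × A (pair w y) ≡ true) → L w ≡ true
    from (y , _ , a) rewrite fst-pair w y | snd-pair w y | eval-id n
      with T ← eval pid (length (pair (ones n) y))
      with ne , e ← guard-nonempty⁻ (runBits T (ones n) y) _ a
      = L⁺ w (Equivalence.from (∈-outputs n _) (runBits-sound T (ones n) y _ (runBits-flag T (ones n) y ne)))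
          (eq-nonempty⁻ _ _ e)

  L-NP : InNP L
  L-NP = A , pid , A-inP , L⇔A

  words : ℕ → List Str
  words n = map (word n) (outputs n)

  words-unique : ∀ n → Unique (words n)
  words-unique n = go (outputs n) (λ i → output-fits n (Equivalence.to (∈-outputs n _) i)) (outputs-unique n)
    where
    word-injective : ∀ {z z'} → 2 * length z + 2 ≤ eval room n → 2 * length z' + 2 ≤ eval room n → word n z ≡ word n z' →
        z ≡ z'
    word-injective l l' e = trans (sym (padded-fst n l))
        (trans (cong fst (proj₂ (pair-injective {ones n} {_} {ones n} e))) (padded-fst n l'))
    -- `word n` is injective only on strings that fit into `room`, so this bound is carried along
    -- the list.
    go : ∀ zs → (∀ {z} → z ∈ zs → 2 * length z + 2 ≤ eval room n) → Unique zs → Unique (map (word n) zs)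
    go []       h []       = []
    go (z ∷ zs) h (ne ∷ u) = fresh zs (h ∘ there) ne ∷ go zs (h ∘ there) u
      where
      fresh : ∀ ys → (∀ {y} → y ∈ ys → 2 * length y + 2 ≤ eval room n) → All (z ≢_) ys → All (word n z ≢_) (map (word n) ys)
      fresh []       h' []       = []
      fresh (y ∷ ys) h' (d ∷ ds) = (λ e → d (word-injective (h (here refl)) (h' (here refl)) e)) ∷ fresh ys (h' ∘ there) ds

  census-L : ∀ n → census L (eval (pairSize room) n) ≡ f n
  census-L n = trans (countLen-unique L _ (words-unique n) (mk⇔ to from))
    (trans (length-map (word n) (outputs n)) (sym (proj₂ (proj₂ (proj₂ (span n))))))
    where
    to : ∀ {w} → w ∈ words n → length w ≡ eval (pairSize room) n × L w ≡ true
    to i with z , mem , refl ← ∈-map⁻ (word n) i = word-length n z ,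
      L⁺ (word n z) (subst (λ m → z ∈ outputs m) (sym (index-word n z)) mem) (cong (λ m → word m z) (sym (index-word n z)))
    from : ∀ {w} → length w ≡ eval (pairSize room) n × L w ≡ true → w ∈ words n
    from {w} (l , e) with z , mem , w≡ ← L⁻ w e = subst (_∈ words n) (sym (trans w≡ (cong (λ m → word m z) n≡)))
      (∈-map⁺ (word n) (subst (λ m → z ∈ outputs m) n≡ mem))
      where
      n≡ : index w ≡ n
      n≡ = pairSize-injective room (trans (sym (word-length (index w) z)) (trans (cong length (sym w≡)) l))

census⇒span : ((L : Language) → InNP L → HasFPCensus L) → (f : ℕ → ℕ) → SpanP₁ f → InFP₁ f
census⇒span h f (N , p , timed , span) = InFP₁-pad (pairSize room) (h L L-NP) (λ n → sym (census-L n))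
  where open SpanToCensus N p timed f span

-- Computation paths of nondeterministic machines

module Paths (M : NTM) where
  open NTM M

  -- Follows all paths at once: each takes at most k steps and ends either halted in Φ or stuck, the
  -- latter when `steps` has no successors. The time bound on every path and the soundness of
  -- accepted outputs are both read off from it.
  data Terminates (Φ : NConfig M → Set) : ℕ → NConfig M → Set where
    halts : ∀ {k c} → halting (proj₁ c) ≡ true → Φ c → Terminates Φ k c
    steps : ∀ {k c} → halting (proj₁ c) ≡ false → (∀ d → NStep M c d → Terminates Φ k d) → Terminates Φ (suc k) c

  ¬halted-step : ∀ {c d} → halting (proj₁ c) ≡ true → ¬ NStep M c d
  ¬halted-step h (nstep h' _) with () ← trans (sym h) h'

  terminates-mono : ∀ {Φ k k' c} → k ≤ k' → Terminates Φ k c → Terminates Φ k' c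
  terminates-mono le       (halts h φ) = halts h φ
  terminates-mono (s≤s le) (steps h f) = steps h (λ d s → terminates-mono le (f d s))

  terminates-time : ∀ {Φ k c j d} → Terminates Φ k c → NSteps M j c d → j ≤ k
  terminates-time t           done        = z≤n
  terminates-time (halts h φ) (more s ss) = contradiction s (¬halted-step h)
  terminates-time (steps h f) (more s ss) = s≤s (terminates-time (f _ s) ss)

  terminates-final : ∀ {Φ k c j d} → Terminates Φ k c → NSteps M j c d → halting (proj₁ d) ≡ true → Φ d
  terminates-final (halts h φ) done        e = φ
  terminates-final (steps h f) done        e with () ← trans (sym h) e
  terminates-final (halts h φ) (more s ss) e = contradiction s (¬halted-step h)
  terminates-final (steps h f) (more s ss) e = terminates-final (f _ s) ss e

  -- Uniqueness makes a hosted deterministic run the only path, so that bounds on what follows it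
  -- become bounds on all paths.
  Forced : NConfig M → NConfig M → Set
  Forced c d = NStep M c d × (∀ d' → NStep M c d' → d' ≡ d)

  open Host Forced public

  forced : ∀ i t {i' s m} → halting i ≡ false → δ i (Tape.head t) ≡ (i' , s , m) ∷ [] →
           Forced (i , t) (i' , move m (write s t))
  forced i t {i'} {s} {m} h e = nstep h (subst ((i' , s , m) ∈_) (sym e) (here refl)) , unique
    where
    unique : ∀ d → NStep M (i , t) d → d ≡ (i' , move m (write s t))
    unique _ (nstep _ mem) with here refl ← subst (_ ∈_) e mem = refl

  star-terminates : ∀ {Φ n k c d} → Star n c d → Terminates Φ k d → Terminates Φ (n + k) c
  star-terminates stop t = t
  star-terminates (step (nstep h mem , u) s) t =
    steps h (λ d' s' → subst (Terminates _ _) (sym (u d' s')) (star-terminates s t))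

  star-NSteps : ∀ {n c d} → Star n c d → NSteps M n c d
  star-NSteps stop             = done
  star-NSteps (step (s , _) r) = more s (star-NSteps r)

  NSteps-++ : ∀ {m n c d e} → NSteps M m c d → NSteps M n d e → NSteps M (m + n) c e
  NSteps-++ done        r = r
  NSteps-++ (more s ss) r = more s (NSteps-++ ss r)

nth-mid : ∀ u b w → nth (map bit (u ++ b ∷ w)) (length u) ≡ bit b
nth-mid []      b w = refl
nth-mid (_ ∷ u) b w = nth-mid u b w

nth-other : ∀ u c b w j → j ≢ length u → nth (map bit (u ++ c ∷ w)) j ≡ nth (map bit (u ++ b ∷ w)) j
nth-other []      c b w zero    ne = contradiction refl ne
nth-other []      c b w (suc j) ne = refl
nth-other (_ ∷ u) c b w zero    ne = refl
nth-other (_ ∷ u) c b w (suc j) ne = nth-other u c b w j (λ e → ne (cong suc e))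

nth-end : ∀ u → nth (map bit u) (length u) ≡ blank
nth-end []      = refl
nth-end (_ ∷ u) = nth-end u

clean-nth : ∀ {x g} → Clean x g → ∀ j → g (+ suc j) ≡ nth (map bit x) j
clean-nth {x} (clean pos neg) j = trans (pos (suc j)) (cell-reverse x j)

clean-by-nth : ∀ {x g} → g (+ 0) ≡ blank → (∀ j → g (+ suc j) ≡ nth (map bit x) j) → (∀ m → g -[1+ m ] ≡ blank) → Clean x g
clean-by-nth {x} {g} z s n = clean pos n
  where
  pos : ∀ j → g (+ j) ≡ cell (reverse x) j
  pos zero    = trans z (sym (cell-base (reverse x)))
  pos (suc j) = trans (s j) (sym (cell-reverse x j))

clean-overwrite : ∀ u c b w {g} → Clean (u ++ c ∷ w) g → Clean (u ++ b ∷ w) (upd (+ suc (length u)) (bit b) g)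
clean-overwrite u c b w {g} cl = clean-by-nth
  (trans (upd-≢ {+ suc (length u)} {+ 0} (bit b) g (λ ())) (clean-left cl 0))
  new
  (λ m → trans (upd-≢ {+ suc (length u)} { -[1+ m ]} (bit b) g (λ ())) (Clean.neg cl m))
  where
  new : ∀ j → upd (+ suc (length u)) (bit b) g (+ suc j) ≡ nth (map bit (u ++ b ∷ w)) j
  new j with j ℕ.≟ length u
  ... | yes refl = trans (upd-≡ (+ suc j) (bit b) g) (sym (nth-mid u b w))
  ... | no ne = trans (upd-≢ (bit b) g (λ e → ne (ℕₚ.suc-injective (ℤₚ.+-injective e))))
      (trans (clean-nth cl j) (nth-other u c b w j ne))

-- Guessing ends on the blank just behind the word. One move left leaves that blank, the scan stops
-- at the blank origin, and one move right reaches the first symbol.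
rewind : Code → Code
rewind P = mv mvL ▸ wh (mv mvL) ▸ mv mvR ▸ P

rewinds : ∀ {P w g B d} → Clean w g → P ∶ (g , + 1) ↝[ B ] d → rewind P ∶ (g , + suc (length w)) ↝[ 3 + 2 * length w + B ] d
rewinds {w = w} {g} {B} cl r = within (≤-reflexive (lem (length w) B))
  ((1 , ≤-refl , r-mv) then back (length w) ≤-refl then (1 , ≤-refl , r-mv) then r)
  where
  lem : ∀ l b → 1 + (suc (l * 2) + (1 + b)) ≡ 3 + 2 * l + b
  lem = solve-∀
  back : ∀ j → j ≤ length w → wh (mv mvL) ∶ (g , + j) ↝[ suc (j * 2) ] (g , + 0)
  back zero    le = 1 , ≤-refl , r-stop (clean-left cl 0)
  back (suc j) le with n , n≤ , s ← back j (ℕₚ.<⇒≤ le) = suc (1 + n) , s≤s (s≤s n≤) ,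
    r-go (λ e → cell-occupied (reverse w) (subst (j <_) (sym (length-reverse w)) le)
        (trans (sym (Clean.pos cl (suc j))) e)) r-mv s

-- Guessing between two deterministic phases

module Guess (P₁ P₂ : Code) where

  data Extra : Set where
    guessing finishing accepting : Extra

  State : Set
  State = St P₁ ⊎ (St P₂ ⊎ Extra)

  count : ℕ
  count = size P₁ + (size P₂ + 3)

  toFin3 : Extra → Fin 3
  toFin3 guessing  = zero
  toFin3 finishing = suc zero
  toFin3 accepting = suc (suc zero)

  fromFin3 : Fin 3 → Extra
  fromFin3 zero             = guessing
  fromFin3 (suc zero)       = finishing
  fromFin3 (suc (suc zero)) = accepting

  code : State → Fin count
  code (inj₁ a)        = join (size P₁) _ (inj₁ (toF P₁ a))
  code (inj₂ (inj₁ a)) = join (size P₁) _ (inj₂ (join (size P₂) 3 (inj₁ (toF P₂ a))))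
  code (inj₂ (inj₂ x)) = join (size P₁) _ (inj₂ (join (size P₂) 3 (inj₂ (toFin3 x))))

  decode : Fin count → State
  decode i = [ (λ a → inj₁ (fromF P₁ a)) , (λ j → inj₂
      ([ (λ a → inj₁ (fromF P₂ a)) , (λ x → inj₂ (fromFin3 x)) ] (splitAt (size P₂) j))) ] (splitAt (size P₁) i)

  decode-code : ∀ s → decode (code s) ≡ s
  decode-code (inj₁ a) rewrite splitAt-join (size P₁) (size P₂ + 3) (inj₁ (toF P₁ a)) = cong inj₁ (fromF-toF P₁ a)
  decode-code (inj₂ (inj₁ a))
    rewrite splitAt-join (size P₁) (size P₂ + 3) (inj₂ (join (size P₂) 3 (inj₁ (toF P₂ a))))
          | splitAt-join (size P₂) 3 (inj₁ (toF P₂ a)) = cong (inj₂ ∘ inj₁) (fromF-toF P₂ a)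
  decode-code (inj₂ (inj₂ x))
    rewrite splitAt-join (size P₁) (size P₂ + 3) (inj₂ (join (size P₂) 3 (inj₂ (toFin3 x))))
          | splitAt-join (size P₂) 3 (inj₂ (toFin3 x)) = cong (inj₂ ∘ inj₂) (extra x)
    where
    extra : ∀ x → fromFin3 (toFin3 x) ≡ x
    extra guessing  = refl
    extra finishing = refl
    extra accepting = refl

  Option : Set
  Option = Fin count × Sym × Move

  guess finish acc : Fin count
  guess  = code (inj₂ (inj₂ guessing))
  finish = code (inj₂ (inj₂ finishing))
  acc    = code (inj₂ (inj₂ accepting))

  inside : ∀ {A : Set} → (A → Fin count) → Fin count → Trans A → Option
  inside e x (n , s , m) = maybe e x n , s , m

  -- The first phase leaves a block of 1s as a template; `guessing` replaces each by a bit of its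
  -- choice up to the blank. After the second phase a leading 1 means acceptance, and it is erased
  -- so that the output begins behind it; on an empty tape `finishing` has no move, and the path
  -- dies without output.
  moves : State → Sym → List Option
  moves (inj₁ a)                 h     = inside (code ∘ inj₁) guess (tr P₁ a h) ∷ []
  moves (inj₂ (inj₁ a))          h     = inside (code ∘ inj₂ ∘ inj₁) finish (tr P₂ a h) ∷ []
  moves (inj₂ (inj₂ guessing))   blank = (code (inj₂ (inj₁ (ent P₂))) , blank , mvS) ∷ []
  moves (inj₂ (inj₂ guessing))   _     = (guess , b0 , mvR) ∷ (guess , b1 , mvR) ∷ []
  moves (inj₂ (inj₂ finishing))  b1    = (acc , blank , mvR) ∷ []
  moves (inj₂ (inj₂ finishing))  _     = []
  moves (inj₂ (inj₂ accepting))  _     = []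

  stops : State → Bool
  stops (inj₂ (inj₂ accepting)) = true
  stops _                       = false

  M : NTM
  M = record
    { Q       = count
    ; start   = code (inj₁ (ent P₁))
    ; halting = stops ∘ decode
    ; accept  = λ _ → true
    ; δ       = λ i → moves (decode i)
    }

  open Paths M public

  halting-code : ∀ s → NTM.halting M (code s) ≡ stops s
  halting-code s = cong stops (decode-code s)

  δ-code : ∀ s h → NTM.δ M (code s) h ≡ moves s h
  δ-code s h = cong (λ s → moves s h) (decode-code s)

  hosts₁ : Hosts P₁ (code ∘ inj₁) guess
  hosts₁ s t = forced _ t (halting-code (inj₁ s)) (δ-code (inj₁ s) (Tape.head t))

  hosts₂ : Hosts P₂ (code ∘ inj₂ ∘ inj₁) finish
  hosts₂ s t = forced _ t (halting-code (inj₂ (inj₁ s))) (δ-code (inj₂ (inj₁ s)) (Tape.head t))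

  guess-moves : ∀ t b → Tape.head t ≡ bit b → NTM.δ M guess (Tape.head t) ≡ (guess , b0 , mvR) ∷ (guess , b1 , mvR) ∷ []
  guess-moves t false e = trans (δ-code (inj₂ (inj₂ guessing)) (Tape.head t)) (cong (moves (inj₂ (inj₂ guessing))) e)
  guess-moves t true  e = trans (δ-code (inj₂ (inj₂ guessing)) (Tape.head t)) (cong (moves (inj₂ (inj₂ guessing))) e)

  guess-step : ∀ t b → Tape.head t ≡ b1 → NStep M (guess , t) (guess , move mvR (write (bit b) t))
  guess-step t b e = nstep (halting-code (inj₂ (inj₂ guessing)))
      (subst ((guess , bit b , mvR) ∈_) (sym (guess-moves t true e)) (mem b))
    where
    mem : ∀ b → (guess , bit b , mvR) ∈ (guess , b0 , mvR) ∷ (guess , b1 , mvR) ∷ []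
    mem false = here refl
    mem true  = there (here refl)

  guess-done : ∀ t → Tape.head t ≡ blank → Forced (guess , t) (code (inj₂ (inj₁ (ent P₂))) , t)
  guess-done t e = subst (λ h → Forced (guess , t) (code (inj₂ (inj₁ (ent P₂))) , write h t)) (sym e)
    (forced guess t (halting-code (inj₂ (inj₂ guessing)))
        (trans (δ-code (inj₂ (inj₂ guessing)) (Tape.head t)) (cong (moves (inj₂ (inj₂ guessing))) e)))

  module _ (u : Str) (r : ℕ) {t : Tape} {g : Content} (cl : Clean (u ++ ones (suc r)) g)
      (a : At t g (+ suc (length u))) where

    guess-head : Tape.head t ≡ b1
    guess-head = trans (At.hd a) (trans (clean-nth cl (length u)) (nth-mid u true (ones r)))

    guess-clean : ∀ b → Clean ((u ∷ʳ b) ++ ones r) (upd (+ suc (length u)) (bit b) g)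
    guess-clean b = subst (λ w → Clean w _) (sym (++-assoc u (b ∷ []) (ones r))) (clean-overwrite u true b (ones r) cl)

    guess-at : ∀ b → At (move mvR (write (bit b) t)) (upd (+ suc (length u)) (bit b) g) (+ suc (length (u ∷ʳ b)))
    guess-at b = subst (λ i → At (move mvR (write (bit b) t)) (upd (+ suc (length u)) (bit b) g) (+ suc i))
      (sym (trans (length-++ u) (ℕₚ.+-comm (length u) 1))) (At-move mvR (At-write (bit b) a))

  guess-end : ∀ u {t g} → Clean (u ++ ones 0) g → At t g (+ suc (length u)) → Tape.head t ≡ blank
  guess-end u cl a = trans (At.hd a) (trans (clean-nth cl (length u))
      (trans (cong (λ w → nth (map bit w) (length u)) (++-identityʳ u)) (nth-end u)))

  -- u is the part already guessed and r the number of template symbols left. Both bits are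
  -- followed, so the continuation has to be supplied for every word of full length.
  guess-all : ∀ {Φ k} r u {t g} → Clean (u ++ ones r) g → At t g (+ suc (length u)) →
    (∀ w → length w ≡ length u + r → ∀ {t g} → Clean w g → At t g (+ suc (length w)) →
        Terminates Φ k (code (inj₂ (inj₁ (ent P₂))) , t)) →
    Terminates Φ (r + suc k) (guess , t)
  guess-all zero u {t} cl a next = star-terminates (step (guess-done t (guess-end u cl a)) stop)
    (next u (sym (ℕₚ.+-identityʳ _)) (subst (λ w → Clean w _) (++-identityʳ u) cl) a)
  guess-all {Φ} {k} (suc r) u {t} {g} cl a next = steps (halting-code (inj₂ (inj₂ guessing))) each
    where
    go : ∀ b → Terminates Φ (r + suc k) (guess , move mvR (write (bit b) t))
    go b = guess-all r (u ∷ʳ b) (guess-clean u r cl a b) (guess-at u r cl a b)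
      (λ w e → next w (trans e (trans (cong (_+ r) (trans (length-++ u) (ℕₚ.+-comm (length u) 1)))
          (sym (ℕₚ.+-suc (length u) r)))))
    each : ∀ d → NStep M (guess , t) d → Terminates Φ (r + suc k) d
    each _ (nstep _ mem) with subst (_ ∈_) (guess-moves t true (guess-head u r cl a)) mem
    ... | here refl         = go false
    ... | there (here refl) = go true

  guess-path : ∀ w u {t g} → Clean (u ++ ones (length w)) g → At t g (+ suc (length u)) →
    Σ[ k ∈ ℕ ] Σ[ t' ∈ Tape ] Σ[ g' ∈ Content ]
      (NSteps M k (guess , t) (code (inj₂ (inj₁ (ent P₂))) , t') × Clean (u ++ w) g' × At t' g' (+ suc (length (u ++ w))))
  guess-path [] u {t} {g} cl a = 1 , t , g , more (proj₁ (guess-done t (guess-end u cl a))) done , cl ,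
    subst (λ w → At t g (+ suc (length w))) (sym (++-identityʳ u)) a
  guess-path (b ∷ w) u {t} {g} cl a =
    let k , t' , g' , ss , cl' , a' = guess-path w (u ∷ʳ b) (guess-clean u (length w) cl a b) (guess-at u (length w) cl a b)
        e = ++-assoc u (b ∷ []) w
    in suc k , t' , g' , more (guess-step t b (guess-head u (length w) cl a)) ss ,
       subst (λ z → Clean z g') e cl' , subst (λ z → At t' g' (+ suc (length z))) e a'

  finish-accept : ∀ {x t g} → Clean (true ∷ x) g → At t g (+ 1) →
    Σ[ t' ∈ Tape ] (Forced (finish , t) (acc , t') × readOut t' ≡ x)
  finish-accept {x} {t} {g} cl a = _ , forced finish t (halting-code (inj₂ (inj₂ finishing)))
      (trans (δ-code (inj₂ (inj₂ finishing)) (Tape.head t)) (cong (moves (inj₂ (inj₂ finishing))) head≡)) ,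
    readSyms-nth _ x same
    where
    head≡ : Tape.head t ≡ b1
    head≡ = trans (At.hd a) (clean-nth cl 0)
    a' : At (move mvR (write blank t)) (upd (+ 1) blank g) (+ 2)
    a' = At-move mvR (At-write blank a)
    later : ∀ j → upd (+ 1) blank g (+ suc (suc j)) ≡ nth (map bit x) j
    later j = trans (upd-≢ {+ 1} {+ suc (suc j)} blank g (λ ())) (clean-nth cl (suc j))
    same : ∀ j → nth (Tape.head (moveR (write blank t)) ∷ Tape.right (moveR (write blank t))) j ≡ nth (map bit x) j
    same zero    = trans (At.hd a') (later 0)
    same (suc j) = trans (At.rt a' j) (trans (cong (upd (+ 1) blank g) (trans (itR-pos j 3) (cong +_ (ℕₚ.+-comm j 3))))
        (later (suc j)))

  finish-reject : ∀ {Φ t g} → Clean [] g → At t g (+ 1) → Terminates Φ 1 (finish , t)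
  finish-reject {Φ} {t} cl a = steps (halting-code (inj₂ (inj₂ finishing))) none
    where
    none : ∀ d → NStep M (finish , t) d → Terminates Φ 0 d
    none _ (nstep _ mem) with () ← subst (_ ∈_) (trans (δ-code (inj₂ (inj₂ finishing)) (Tape.head t))
        (cong (moves (inj₂ (inj₂ finishing))) (trans (At.hd a) (clean-nth cl 0)))) mem

-- From spanP₁ to census functions

-- The value computed by the machine that `InNP` provides, which decides the complement of A;
-- membership in A therefore shows as the answer 0.
answerTo : Language → Str → Str
answerTo A u = if not (A u) then true ∷ [] else false ∷ []

verdict : Language → Poly → Str → Str
verdict A p u = guardElse [] (wellFormed (λ x → x) p u) (guardElse [] (eq (answerTo A u) (false ∷ [])) (true ∷ fst u))

verdict-fp : ∀ A p → InP (λ z → not (A z)) → SFP (verdict A p)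
verdict-fp A p notA = op₂ {guardElse []} (guardElse-fp []) (wellFormed-fp id-fp p)
  (op₂ {guardElse []} (guardElse-fp []) (op₂ {eq} eq-fp (InFP⇒SFP notA) (const-fp (false ∷ []))) (cons-fp true ∘ₛ fst-fp))

module CensusToSpan (L A : Language) (p : Poly)
  (iff : ∀ x → (L x ≡ true) ⇔ (Σ[ y ∈ Str ] (length y ≡ eval p (length x) × A (pair x y) ≡ true)))
  (phase₁ : SFP (λ x → ones (eval (pairSize p) (length x)))) (phase₂ : SFP (verdict A p)) where

  verdict-cases : ∀ u → verdict A p u ≡ [] ⊎ (verdict A p u ≡ true ∷ fst u × nonempty (wellFormed (λ x → x) p u) ≡ true ×
      A u ≡ true)
  verdict-cases u with wellFormed (λ x → x) p u | A u
  ... | []    | _     = inj₁ refl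
  ... | _ ∷ _ | false = inj₁ refl
  ... | _ ∷ _ | true  = inj₂ (refl , refl , refl)

  verdict-accepts : ∀ x y → length y ≡ eval p (length x) → A (pair x y) ≡ true → verdict A p (pair x y) ≡ true ∷ x
  verdict-accepts x y l a = trans (lem (wellFormed (λ x → x) p (pair x y)) (wellFormed⁺ (λ x → x) p x y refl l))
    (trans (cong (λ b → guardElse [] (eq (if not b then true ∷ [] else false ∷ []) (false ∷ [])) (true ∷ fst (pair x y))) a)
        (cong (true ∷_) (fst-pair x y)))
    where
    lem : ∀ w {z} → nonempty w ≡ true → guardElse [] w z ≡ z
    lem (_ ∷ _) e = refl

  open SFP phase₁ using () renaming (prog to P₁; time to time₁; runs to runs₁)
  open SFP phase₂ using () renaming (prog to P₂; time to time₂; runs to runs₂)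
  open Guess P₁ (rewind P₂)

  Good : ℕ → NConfig M → Set
  Good n (i , t) = length (readOut t) ≡ n × L (readOut t) ≡ true

  verify : ∀ n u → length u ≡ eval (pairSize p) n → ∀ {t g} → Clean u g → At t g (+ suc (length u)) →
           Terminates (Good n) (3 + 2 * length u + eval time₂ (length u) + 1) (code (inj₂ (inj₁ (ent (rewind P₂)))) , t)
  verify n u l {t} {g} cl a =
    let g' , r , cl' = runs₂ u g cl
        m , m≤ , run = rewinds cl r
        t' , s , a' = sim run hosts₂ a
    in terminates-mono (+-mono-≤ m≤ (≤-refl {1})) (star-terminates s (ending cl' a' (verdict-cases u)))
    where
    ending : ∀ {t g} → Clean (verdict A p u) g → At t g (+ 1) →
             verdict A p u ≡ [] ⊎ (verdict A p u ≡ true ∷ fst u × nonempty (wellFormed (λ x → x) p u) ≡ true × A u ≡ true) →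
                 Terminates (Good n) 1 (finish , t)
    ending cl a (inj₁ e) = finish-reject (subst (λ w → Clean w _) e cl) a
    ending cl a (inj₂ (e , wf , au)) =
      let t' , f , o = finish-accept (subst (λ w → Clean w _) e cl) a
      in star-terminates (step f stop) (halts (halting-code (inj₂ (inj₂ accepting)))
            (trans (cong length o) len , trans (cong L o) inL))
      where
      u≡ : u ≡ pair (fst u) (snd u)
      u≡ = proj₁ (wellFormed⁻ (λ x → x) p u wf)
      sl : length (snd u) ≡ eval p (length (fst u))
      sl = proj₂ (wellFormed⁻ (λ x → x) p u wf)
      len : length (fst u) ≡ n
      len = pairSize-injective p (trans (sym (trans (cong length u≡) (length-pair-eval p (fst u) (snd u) sl))) l)
      inL : L (fst u) ≡ true
      inL = Equivalence.from (iff (fst u)) (snd u , sl , trans (cong A (sym u≡)) au)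

  width : ℕ → ℕ
  width n = eval (pairSize p) n

  bound : Poly
  -- With w the width: w guesses and one step to leave them, 3 + 2w for the rewinding and one step
  -- of `finishing`, which is 5 + 3w besides the two phases.
  bound = padd time₁ (pcomp (padd (5 ∷ 3 ∷ []) time₂) (pairSize p))

  bound-val : ∀ n → eval bound n ≡ eval time₁ n + (width n + suc (3 + 2 * width n + eval time₂ (width n) + 1))
  bound-val n rewrite eval-add time₁ (pcomp (padd (5 ∷ 3 ∷ []) time₂) (pairSize p)) n
    | eval-comp (padd (5 ∷ 3 ∷ []) time₂) (pairSize p) n | eval-add (5 ∷ 3 ∷ []) time₂ (width n) =
        cong (_+_ (eval time₁ n)) (lem (width n) (eval time₂ (width n)))
    where
    lem : ∀ w t → 5 + w * (3 + w * 0) + t ≡ w + suc (3 + 2 * w + t + 1)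
    lem = solve-∀

  prepare : ∀ n → Σ[ k ∈ ℕ ] Σ[ t ∈ Tape ] Σ[ g ∈ Content ]
            (k ≤ eval time₁ n × Star k (nInit M (ones n)) (guess , t) × Clean (ones (width n)) g × At t g (+ 1))
  prepare n =
    let g' , (m , m≤ , run) , cl' = runs₁ (ones n) (initial (ones n)) (initial-clean (ones n))
        t' , s , a' = sim run hosts₁ (initTape-at (ones n) (initial-clean (ones n)))
        e = length-replicate n
    in m , t' , g' , subst (λ i → m ≤ eval time₁ i) e m≤ , s , subst (λ i → Clean (ones (eval (pairSize p) i)) g') e cl' ,
          a'

  terminates : ∀ n → Terminates (Good n) (eval bound n) (nInit M (ones n))
  terminates n =
    let k , t , g , k≤ , s , cl , a = prepare n
    in terminates-mono (≤-trans (+-mono-≤ k≤ ≤-refl) (≤-reflexive (sym (bound-val n))))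
         (star-terminates s (guess-all (width n) [] cl a (λ w e cl' a' →
           subst (λ i → Terminates (Good n) (3 + 2 * i + eval time₂ i + 1) _) e (verify n w e cl' a'))))

  accepts : ∀ x → L x ≡ true → AccOut M (ones (length x)) x
  accepts x lx =
    let y , l , a = Equivalence.to (iff x) lx
        u = pair x y
        k₁ , t₁ , g₁ , _ , s₁ , cl₁ , a₁ = prepare (length x)
        k₂ , t₂ , g₂ , s₂ , cl₂ , a₂ = guess-path u []
            (subst (λ i → Clean (ones i) g₁) (sym (length-pair-eval p x y l)) cl₁) a₁
        g₃ , r , cl₃ = runs₂ u g₂ cl₂
        k₃ , _ , run = rewinds cl₂ r
        t₃ , s₃ , a₃ = sim run hosts₂ a₂
        t₄ , f , o = finish-accept (subst (λ w → Clean w g₃) (verdict-accepts x y l a) cl₃) a₃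
    in _ , (acc , t₄) , NSteps-++ (star-NSteps s₁) (NSteps-++ s₂ (NSteps-++ (star-NSteps s₃) (more (proj₁ f) done))) ,
       halting-code (inj₂ (inj₂ accepting)) , refl , o

  isSpan : IsSpan M (census L)
  isSpan n = selected L n , selected-unique L n , (λ z → mk⇔ (to z) (from z)) , countLen-selected L n
    where
    to : ∀ z → z ∈ selected L n → AccOut M (ones n) z
    to z i with refl , lz ← Equivalence.to (∈-selected L n) i = accepts z lz
    from : ∀ z → AccOut M (ones n) z → z ∈ selected L n
    from z (k , c , ss , h , _ , refl) = Equivalence.from (∈-selected L n) (terminates-final (terminates n) ss h)

  spanP₁ : SpanP₁ (census L)
  spanP₁ = M , bound , (λ n k c ss → terminates-time (terminates n) ss) , isSpan

census⇐span : ((f : ℕ → ℕ) → SpanP₁ f → InFP₁ f) → (L : Language) → InNP L → HasFPCensus L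
census⇐span h L (A , p , notA , iff) = h (census L)
    (CensusToSpan.spanP₁ L A p iff (poly-fp (pairSize p)) (verdict-fp A p notA))

theorem3p5 : (((L : Language) → InNP L → HasFPCensus L) ⇔ ((f : ℕ → ℕ) → SpanP₁ f → InFP₁ f))
    × (((L : Language) → InPH L → HasFPCensus L) ⇔ ((f : ℕ → ℕ) → Sharp₁PH f → InFP₁ f))
theorem3p5 = mk⇔ census⇒span census⇐span , mk⇔ census⇒sharp census⇐sharp
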